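{- Let $a$ be a positive integer and let $r$ be a variable. For any integer $k\geq 2$, we have $$\sum_{n=1}^{k-1}\left((1-2r)^{k-n-1}2^{n-1}\sum_{\mathbf{k}\in I_0(k,n)}t_{2a,a}^r(\mathbf{k})\right)=\sum_{\substack{n+n_1+\cdots+n_m=k-2\\ n,m\geq 0,\ n_1,\ldots,n_m\geq 2}}\frac{2^{n+2m}(2^{n_1-1}-1)\cdots(2^{n_m-1}-1)}{a^k\,n!\,m!\,n_1\cdots n_m(2^{n_1}-1)\cdots(2^{n_m}-1)}\,t(2)\,t(n_1)\cdots t(n_m)\log^n(2).$$
   Context: An index is a finite sequence $\mathbf{k}=(k_1,\ldots,k_n)$ of positive integers. Its weight is $k_1+\cdots+k_n$ and its depth is $\operatorname{dep}(\mathbf{k})=n$. It is admissible if $k_1>1$. For a positive integer $N$, $a\in\{1,\ldots,N\}$ and an admissible index define the multiple $t$-value of level $N$ $$t_{N,a}(\mathbf{k})=\sum_{\substack{m_1>\cdots>m_n>0\\ m_i\equiv a \ (\mathrm{mod}\ N)}}\frac{1}{m_1^{k_1}\cdots m_n^{k_n}}$$ and the interpolated multiple $t$-value of level $N$ $$t_{N,a}^r(\mathbf{k})=\sum_{\mathbf{p}}r^{\,n-\operatorname{dep}(\mathbf{p})}\,t_{N,a}(\mathbf{p}),$$ where $\mathbf{p}$ runs over all $2^{n-1}$ indices obtained from $(k_1\,\Box\, k_2\,\Box\cdots\Box\, k_n)$ by replacing each $\Box$ with either a comma or a plus sign (each choice of replacements counted once). Here the level is $N=2a$. Also $t(n)=t_{2,1}(n)=\sum_{m>0,\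 m\text{ odd}}m^{ -n}$ for $n\geq 2$. $I_0(k,n)$ is the set of all admissible indices of weight $k$ and depth $n$. On the right-hand side the sum is over all integers $n,m\geq 0$ and all ordered tuples $(n_1,\ldots,n_m)$ of integers $\geq 2$ satisfying the condition; for $m=0$ the tuple is empty and the products over $n_i$ equal $1$. $\log^n(2)$ means $(\log 2)^n$. -}

module Defs where

open import Algebra.Bundles.Raw using (RawRing)
import Algebra.Definitions.RawSemiring as RawSemiringDefs
open import Data.Empty using (⊥-elim)
open import Data.Integer.Base using (+_; +[1+_])
import Data.Integer.Base as ℤ
import Data.Integer.Properties as ℤ
open import Data.List.Base using (List; []; _∷_; _++_; map; foldr; concatMap; filter; upTo; applyUpTo; length)
import Data.List.Properties as List
open import Data.List.Relation.Unary.All using (All; []; _∷_)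
open import Data.Nat.Base as ℕ using (ℕ; zero; suc; NonZero; _∸_; _!; z≤n; s≤s)
open import Data.Nat.Divisibility using (_∣?_)
open import Data.Nat.ListAction using (product)
import Data.Nat.ListAction.Properties as ℕ using (product≢0)
import Data.Nat.Properties as ℕ
open import Data.Product.Base using (Σ; ∃; _×_; _,_; proj₁; proj₂)
open import Data.Rational.Base as ℚ using (ℚ; 0ℚ; 1ℚ; ½; mkℚ; _/_; toℚᵘ; fromℚᵘ; positive; nonNegative)
import Data.Rational.Properties as ℚ
open import Data.Rational.Solver using (module +-*-Solver)
open import Data.Rational.Unnormalised.Base as ℚᵘ using (mkℚᵘ; *≡*; *≤*)
import Data.Rational.Unnormalised.Properties as ℚᵘ
open import Data.Sum.Base using (inj₁; inj₂)
open import Level using (0ℓ)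
open import Relation.Binary.PropositionalEquality
open import Relation.Nullary using (yes; no)

module Finite (R : RawRing 0ℓ 0ℓ) where
  open RawRing R
  open RawSemiringDefs rawSemiring public using (_^_)

  ∑ : {A : Set} → List A → (A → Carrier) → Carrier
  ∑ xs f = foldr _+_ 0# (map f xs)

  ∏ : {A : Set} → List A → (A → Carrier) → Carrier
  ∏ xs f = foldr _*_ 1# (map f xs)

open Finite ℚ.+-*-rawRing using () renaming (∑ to ∑ℚ; _^_ to _^ℚ_)

IsCauchy : (ℕ → ℚ) → Set
IsCauchy x = ∀ ε → 0ℚ ℚ.< ε →
  ∃ λ N → ∀ m n → N ℕ.≤ m → N ℕ.≤ n → ℚ.∣ x m ℚ.- x n ∣ ℚ.< ε

-- Cauchy sequences of rationals; equality of real numbers is _≈_ below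
record ℝ : Set where
  constructor real
  field
    approx : ℕ → ℚ
    cauchy : IsCauchy approx
open ℝ public

infix 4 _≈_
_≈_ : ℝ → ℝ → Set
x ≈ y = ∀ ε → 0ℚ ℚ.< ε →
  ∃ λ N → ∀ n → N ℕ.≤ n → ℚ.∣ approx x n ℚ.- approx y n ∣ ℚ.< ε

module CauchyLemmas where
  open +-*-Solver

  0<½ : 0ℚ ℚ.< ½
  0<½ = ℚ.positive⁻¹ ½

  *-mono-0≤ : ∀ {p q} → 0ℚ ℚ.≤ p → 0ℚ ℚ.≤ q → 0ℚ ℚ.≤ p ℚ.* q
  *-mono-0≤ {p} {q} 0≤p 0≤q = ℚ.nonNegative⁻¹ (p ℚ.* q)
    {{ℚ.nonNeg*nonNeg⇒nonNeg p {{nonNegative 0≤p}} q {{nonNegative 0≤q}}}}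

  *-mono-0< : ∀ {p q} → 0ℚ ℚ.< p → 0ℚ ℚ.< q → 0ℚ ℚ.< p ℚ.* q
  *-mono-0< {p} {q} 0<p 0<q = ℚ.positive⁻¹ (p ℚ.* q)
    {{ℚ.pos*pos⇒pos p {{positive 0<p}} q {{positive 0<q}}}}

  *-monoˡ : ∀ {r p q} → 0ℚ ℚ.≤ r → p ℚ.≤ q → r ℚ.* p ℚ.≤ r ℚ.* q
  *-monoˡ {r} 0≤r = ℚ.*-monoˡ-≤-nonNeg r {{nonNegative 0≤r}}

  *-monoʳ : ∀ {r p q} → 0ℚ ℚ.≤ r → p ℚ.≤ q → p ℚ.* r ℚ.≤ q ℚ.* r
  *-monoʳ {r} 0≤r = ℚ.*-monoʳ-≤-nonNeg r {{nonNegative 0≤r}}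

  ≤-by : ∀ {p q} d → 0ℚ ℚ.≤ d → q ≡ p ℚ.+ d → p ℚ.≤ q
  ≤-by {p} d 0≤d refl = subst (ℚ._≤ p ℚ.+ d) (ℚ.+-identityʳ p) (ℚ.+-monoʳ-≤ p 0≤d)

  halves : ∀ ε → ε ≡ ½ ℚ.* ε ℚ.+ ½ ℚ.* ε
  halves ε = trans (sym (ℚ.*-identityˡ ε)) (ℚ.*-distribʳ-+ ε ½ ½)

  const-cauchy : ∀ q → IsCauchy (λ _ → q)
  const-cauchy q ε 0<ε = 0 , λ _ _ _ _ →
    subst (λ z → ℚ.∣ z ∣ ℚ.< ε) (sym (ℚ.+-inverseʳ q)) 0<ε

  +-cauchy : ∀ {x y} → IsCauchy x → IsCauchy y → IsCauchy (λ n → x n ℚ.+ y n)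
  +-cauchy {x} {y} cx cy ε 0<ε with cx (½ ℚ.* ε) (*-mono-0< 0<½ 0<ε) | cy (½ ℚ.* ε) (*-mono-0< 0<½ 0<ε)
  ... | M , hx | N , hy = M ℕ.+ N , λ m n m≥ n≥ →
    let open ℚ.≤-Reasoning in begin-strict
    ℚ.∣ (x m ℚ.+ y m) ℚ.- (x n ℚ.+ y n) ∣
      ≡⟨ cong ℚ.∣_∣ (solve 4 (λ a b c d → (a :+ b) :- (c :+ d) := (a :- c) :+ (b :- d)) refl (x m) (y m) (x n) (y n)) ⟩
    ℚ.∣ (x m ℚ.- x n) ℚ.+ (y m ℚ.- y n) ∣
      ≤⟨ ℚ.∣p+q∣≤∣p∣+∣q∣ (x m ℚ.- x n) (y m ℚ.- y n) ⟩
    ℚ.∣ x m ℚ.- x n ∣ ℚ.+ ℚ.∣ y m ℚ.- y n ∣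
      <⟨ ℚ.+-mono-< (hx m n (ℕ.m+n≤o⇒m≤o M m≥) (ℕ.m+n≤o⇒m≤o M n≥))
                    (hy m n (ℕ.m+n≤o⇒n≤o M m≥) (ℕ.m+n≤o⇒n≤o M n≥)) ⟩
    ½ ℚ.* ε ℚ.+ ½ ℚ.* ε
      ≡⟨ sym (halves ε) ⟩
    ε ∎

  neg-cauchy : ∀ {x} → IsCauchy x → IsCauchy (λ n → ℚ.- x n)
  neg-cauchy {x} cx ε 0<ε with cx ε 0<ε
  ... | N , hx = N , λ m n m≥ n≥ → subst (ℚ._< ε)
    (trans (sym (ℚ.∣-p∣≡∣p∣ (x m ℚ.- x n)))
           (cong ℚ.∣_∣ (solve 2 (λ a b → :- (a :- b) := :- a :- :- b) refl (x m) (x n))))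
    (hx m n m≥ n≥)

  bounded : ∀ {x} → IsCauchy x → ∃ λ B → 0ℚ ℚ.< B × ∃ λ N → ∀ n → N ℕ.≤ n → ℚ.∣ x n ∣ ℚ.≤ B
  bounded {x} cx with cx 1ℚ (ℚ.positive⁻¹ 1ℚ)
  ... | N , hx = ℚ.∣ x N ∣ ℚ.+ 1ℚ
      , ℚ.<-≤-trans (ℚ.positive⁻¹ 1ℚ) (≤-by _ (ℚ.0≤∣p∣ (x N)) (ℚ.+-comm ℚ.∣ x N ∣ 1ℚ))
      , N , λ n n≥ → let open ℚ.≤-Reasoning in begin
    ℚ.∣ x n ∣
      ≡⟨ cong ℚ.∣_∣ (solve 2 (λ a b → a := b :+ (a :- b)) refl (x n) (x N)) ⟩
    ℚ.∣ x N ℚ.+ (x n ℚ.- x N) ∣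
      ≤⟨ ℚ.∣p+q∣≤∣p∣+∣q∣ (x N) (x n ℚ.- x N) ⟩
    ℚ.∣ x N ∣ ℚ.+ ℚ.∣ x n ℚ.- x N ∣
      ≤⟨ ℚ.+-monoʳ-≤ ℚ.∣ x N ∣ (ℚ.<⇒≤ (hx n N n≥ ℕ.≤-refl)) ⟩
    ℚ.∣ x N ∣ ℚ.+ 1ℚ ∎

  *-close : ∀ {A B δ ε} a b c d → 0ℚ ℚ.< A → 0ℚ ℚ.< B → A ℚ.* δ ℚ.+ B ℚ.* δ ≡ ε →
    ℚ.∣ a ∣ ℚ.≤ A → ℚ.∣ d ∣ ℚ.≤ B → ℚ.∣ b ℚ.- d ∣ ℚ.< δ → ℚ.∣ a ℚ.- c ∣ ℚ.< δ →
    ℚ.∣ a ℚ.* b ℚ.- c ℚ.* d ∣ ℚ.< ε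
  *-close {A} {B} {δ} {ε} a b c d 0<A 0<B ≡ε a≤A d≤B b-d a-c = let open ℚ.≤-Reasoning in begin-strict
    ℚ.∣ a ℚ.* b ℚ.- c ℚ.* d ∣
      ≡⟨ cong ℚ.∣_∣ (solve 4 (λ a b c d → a :* b :- c :* d := a :* (b :- d) :+ d :* (a :- c)) refl a b c d) ⟩
    ℚ.∣ a ℚ.* (b ℚ.- d) ℚ.+ d ℚ.* (a ℚ.- c) ∣
      ≤⟨ ℚ.∣p+q∣≤∣p∣+∣q∣ (a ℚ.* (b ℚ.- d)) (d ℚ.* (a ℚ.- c)) ⟩
    ℚ.∣ a ℚ.* (b ℚ.- d) ∣ ℚ.+ ℚ.∣ d ℚ.* (a ℚ.- c) ∣
      ≡⟨ cong₂ ℚ._+_ (ℚ.∣p*q∣≡∣p∣*∣q∣ a (b ℚ.- d)) (ℚ.∣p*q∣≡∣p∣*∣q∣ d (a ℚ.- c)) ⟩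
    ℚ.∣ a ∣ ℚ.* ℚ.∣ b ℚ.- d ∣ ℚ.+ ℚ.∣ d ∣ ℚ.* ℚ.∣ a ℚ.- c ∣
      ≤⟨ ℚ.+-mono-≤ (*-monoʳ (ℚ.0≤∣p∣ (b ℚ.- d)) a≤A) (*-monoʳ (ℚ.0≤∣p∣ (a ℚ.- c)) d≤B) ⟩
    A ℚ.* ℚ.∣ b ℚ.- d ∣ ℚ.+ B ℚ.* ℚ.∣ a ℚ.- c ∣
      <⟨ ℚ.+-mono-< (ℚ.*-monoʳ-<-pos A {{positive 0<A}} b-d) (ℚ.*-monoʳ-<-pos B {{positive 0<B}} a-c) ⟩
    A ℚ.* δ ℚ.+ B ℚ.* δ
      ≡⟨ ≡ε ⟩
    ε ∎

  split : ∀ A B ε → 0ℚ ℚ.< A → 0ℚ ℚ.< B → 0ℚ ℚ.< ε →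
    ∃ λ δ → 0ℚ ℚ.< δ × A ℚ.* δ ℚ.+ B ℚ.* δ ≡ ε
  split A B ε 0<A 0<B 0<ε = ε ℚ.* ℚ.1/ C
    , *-mono-0< 0<ε (ℚ.positive⁻¹ (ℚ.1/ C) {{ℚ.1/pos⇒pos C}})
    , trans (solve 4 (λ a b e i → a :* (e :* i) :+ b :* (e :* i) := e :* (i :* (a :+ b))) refl A B ε (ℚ.1/ C))
     (trans (cong (ε ℚ.*_) (ℚ.*-inverseˡ C)) (ℚ.*-identityʳ ε))
    where
    C : ℚ
    C = A ℚ.+ B
    instance
      C-positive : ℚ.Positive C
      C-positive = positive (ℚ.+-mono-< 0<A 0<B)
      C-nonZero : ℚ.NonZero C
      C-nonZero = ℚ.pos⇒nonZero C

  *-cauchy : ∀ {x y} → IsCauchy x → IsCauchy y → IsCauchy (λ n → x n ℚ.* y n)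
  *-cauchy {x} {y} cx cy ε 0<ε =
    let A , 0<A , K , x≤A = bounded cx
        B , 0<B , L , y≤B = bounded cy
        δ , 0<δ , ≡ε      = split A B ε 0<A 0<B 0<ε
        M , hx            = cx δ 0<δ
        N , hy            = cy δ 0<δ
        K+L≤ : ∀ {i} → (K ℕ.+ L) ℕ.+ (M ℕ.+ N) ℕ.≤ i → K ℕ.+ L ℕ.≤ i
        K+L≤ = ℕ.m+n≤o⇒m≤o (K ℕ.+ L)
        M+N≤ : ∀ {i} → (K ℕ.+ L) ℕ.+ (M ℕ.+ N) ℕ.≤ i → M ℕ.+ N ℕ.≤ i
        M+N≤ = ℕ.m+n≤o⇒n≤o (K ℕ.+ L)
    in (K ℕ.+ L) ℕ.+ (M ℕ.+ N) , λ m n m≥ n≥ →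
      *-close {A} {B} {δ} {ε} (x m) (y m) (x n) (y n) 0<A 0<B ≡ε
        (x≤A m (ℕ.m+n≤o⇒m≤o K (K+L≤ m≥)))
        (y≤B n (ℕ.m+n≤o⇒n≤o K (K+L≤ n≥)))
        (hy m n (ℕ.m+n≤o⇒n≤o M (M+N≤ m≥))
                (ℕ.m+n≤o⇒n≤o M (M+N≤ n≥)))
        (hx m n (ℕ.m+n≤o⇒m≤o M (M+N≤ m≥)) (ℕ.m+n≤o⇒m≤o M (M+N≤ n≥)))

open CauchyLemmas

fromℚ : ℚ → ℝ
fromℚ q = real (λ _ → q) (const-cauchy q)

infixl 6 _+_
_+_ : ℝ → ℝ → ℝ
x + y = real (λ n → approx x n ℚ.+ approx y n) (+-cauchy {approx x} {approx y} (cauchy x) (cauchy y))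

infixl 7 _*_
_*_ : ℝ → ℝ → ℝ
x * y = real (λ n → approx x n ℚ.* approx y n) (*-cauchy {approx x} {approx y} (cauchy x) (cauchy y))

infix 8 -_
-_ : ℝ → ℝ
- x = real (λ n → ℚ.- approx x n) (neg-cauchy {approx x} (cauchy x))

ℝ-rawRing : RawRing 0ℓ 0ℓ
ℝ-rawRing = record
  { Carrier = ℝ ; _≈_ = _≈_ ; _+_ = _+_ ; _*_ = _*_ ; -_ = -_ ; 0# = fromℚ 0ℚ ; 1# = fromℚ 1ℚ }

open Finite ℝ-rawRing public using (∑; ∏; _^_)

-- The polynomial ring ℝ[X]: lists of coefficients, constant term first,
-- identified when they agree up to trailing zeros

ℝ[X] : Set
ℝ[X] = List ℝ

coeff : ℝ[X] → ℕ → ℝ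
coeff []      _       = fromℚ 0ℚ
coeff (c ∷ p) zero    = c
coeff (c ∷ p) (suc i) = coeff p i

infix 4 _≈ₚ_
_≈ₚ_ : ℝ[X] → ℝ[X] → Set
p ≈ₚ q = ∀ i → coeff p i ≈ coeff q i

const : ℝ → ℝ[X]
const c = c ∷ []

X : ℝ[X]
X = fromℚ 0ℚ ∷ fromℚ 1ℚ ∷ []

infixl 6 _+ₚ_ _-ₚ_
_+ₚ_ : ℝ[X] → ℝ[X] → ℝ[X]
[]      +ₚ q       = q
(c ∷ p) +ₚ []      = c ∷ p
(c ∷ p) +ₚ (d ∷ q) = c + d ∷ p +ₚ q

infixl 7 _*ₚ_
_*ₚ_ : ℝ[X] → ℝ[X] → ℝ[X]
[]      *ₚ q = []
(c ∷ p) *ₚ q = map (c *_) q +ₚ (fromℚ 0ℚ ∷ p *ₚ q)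

ℝ[X]-rawRing : RawRing 0ℓ 0ℓ
ℝ[X]-rawRing = record
  { Carrier = ℝ[X] ; _≈_ = _≈ₚ_ ; _+_ = _+ₚ_ ; _*_ = _*ₚ_ ; -_ = map -_
  ; 0# = [] ; 1# = const (fromℚ 1ℚ) }

open Finite ℝ[X]-rawRing public using () renaming (∑ to ∑ₚ; _^_ to _^ₚ_)

_-ₚ_ : ℝ[X] → ℝ[X] → ℝ[X]
p -ₚ q = p +ₚ map -_ q

Part : ℕ → Set
Part b = ∃ λ k → b ℕ.< k

-- A nonempty index whose first entry is greater than b: Index 0 is the type
-- of all nonempty indices, Index 1 that of admissible indices
Index : ℕ → Set
Index b = Part b × List (Part 0)

entries : ∀ {b} → Index b → List ℕ
entries (k , ks) = proj₁ k ∷ map proj₁ ks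

dep : ∀ {b} → Index b → ℕ
dep 𝐤 = length (entries 𝐤)

-- The integers in (b , w]
parts : ∀ b → ℕ → List (Part b)
parts b w = map (λ i → suc (b ℕ.+ i) , s≤s (ℕ.m≤m+n b i)) (upTo (w ∸ b))

-- The n-tuples of integers greater than b with sum w
tuples : ∀ b → ℕ → ℕ → List (List (Part b))
tuples b zero    zero    = [] ∷ []
tuples b (suc w) zero    = []
tuples b w       (suc n) =
  concatMap (λ k → map (k ∷_) (tuples b (w ∸ proj₁ k) n)) (parts b w)

I₀ : ℕ → ℕ → List (Index 1)
I₀ k zero    = []
I₀ k (suc n) = concatMap (λ k₁ → map (k₁ ,_) (tuples 0 (k ∸ proj₁ k₁) n)) (parts 1 k)

-- All (n , (n₁ , … , nₘ)) with nᵢ ≥ 2 and n + n₁ + ⋯ + nₘ = w; necessarily m ≤ w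
solutions : ℕ → List (ℕ × List (Part 1))
solutions w = concatMap (λ n → concatMap (λ m → map (n ,_) (tuples 1 (w ∸ n) m)) (upTo (suc w))) (upTo (suc w))

_⊕_ : ∀ {b} → Part b → Part 0 → Part b
(k , b<k) ⊕ (l , _) = k ℕ.+ l , ℕ.≤-trans b<k (ℕ.m≤m+n k l)

-- All ways of replacing the boxes in (k □ l₁ □ ⋯ □ lₙ) by a comma or a plus
contractions : ∀ {b} → Part b → List (Part 0) → List (Index b)
contractions k []       = (k , []) ∷ []
contractions k (l ∷ ls) =
  map (λ (h , t) → k , h ∷ t) (contractions l ls) ++ contractions (k ⊕ l) ls

-- The sum of 1 / (m₁^k₁ ⋯ mₙ^kₙ) over M ≥ m₁ > ⋯ > mₙ > 0 with all mᵢ ≡ a mod N,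
-- the congruence being N ∣ |mᵢ - a|; the summation variable j stands for m₁ = j + 1
tPartial : (N a M : ℕ) → List ℕ → ℚ
tPartial N a M []       = 1ℚ
tPartial N a M (k ∷ ks) =
  ∑ℚ (filter (λ j → N ∣? ℕ.∣ suc j - a ∣) (upTo M)) λ j →
    ((+ 1 / suc j) ^ℚ k) ℚ.* tPartial N a j ks

log2Partial : ℕ → ℚ
log2Partial M = ∑ℚ (upTo M) λ i → + 1 / suc (M ℕ.+ i)

-- Convergence is proved by comparing increments with those of a null sequence
module Convergence where
  open +-*-Solver

  telescope : ∀ {s u : ℕ → ℚ} →
    (∀ n → s n ℚ.≤ s (suc n)) → (∀ n → s (suc n) ℚ.+ u (suc n) ℚ.≤ s n ℚ.+ u n) →
    (∀ n → 0ℚ ℚ.≤ u n) → (∀ ε → 0ℚ ℚ.< ε → ∃ λ N → u N ℚ.< ε) → IsCauchy s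
  telescope {s} {u} s↑ s+u↓ 0≤u u→0 ε 0<ε =
    let N , uN<ε = u→0 ε 0<ε in
    N , λ m n N≤m N≤n → ℚ.≤-<-trans
      (within (s N) (u N) (s m) (s n) (lower N m N≤m) (upper N m N≤m) (lower N n N≤n) (upper N n N≤n)) uN<ε
    where
    step : ∀ {P : ℕ → ℕ → Set} → (∀ n → P n n) → (∀ m n → P m n → P m (suc n)) →
           ∀ m n → m ℕ.≤ n → P m n
    step {P} r t m n m≤n = subst (P m) (ℕ.m+[n∸m]≡n m≤n) (go (n ∸ m))
      where
      go : ∀ d → P m (m ℕ.+ d)
      go zero    = subst (P m) (sym (ℕ.+-identityʳ m)) (r m)
      go (suc d) = subst (P m) (sym (ℕ.+-suc m d)) (t m (m ℕ.+ d) (go d))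
    lower : ∀ m n → m ℕ.≤ n → s m ℚ.≤ s n
    lower = step (λ _ → ℚ.≤-refl) (λ _ n p → ℚ.≤-trans p (s↑ n))
    upper : ∀ m n → m ℕ.≤ n → s n ℚ.≤ s m ℚ.+ u m
    upper m n m≤n = ℚ.≤-trans (≤-by (u n) (0≤u n) refl)
      (step {λ m n → s n ℚ.+ u n ℚ.≤ s m ℚ.+ u m} (λ _ → ℚ.≤-refl) (λ _ n p → ℚ.≤-trans (s+u↓ n) p) m n m≤n)
    difference : ∀ a b x y → a ℚ.≤ y → x ℚ.≤ a ℚ.+ b → x ℚ.- y ℚ.≤ b
    difference a b x y a≤y x≤a+b = subst (x ℚ.- y ℚ.≤_)
      (solve 2 (λ a b → a :+ b :- a := b) refl a b)
      (ℚ.+-mono-≤ x≤a+b (ℚ.neg-antimono-≤ a≤y))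
    within : ∀ a b x y → a ℚ.≤ x → x ℚ.≤ a ℚ.+ b → a ℚ.≤ y → y ℚ.≤ a ℚ.+ b → ℚ.∣ x ℚ.- y ∣ ℚ.≤ b
    within a b x y a≤x x≤ a≤y y≤ with ℚ.∣p∣≡p∨∣p∣≡-p (x ℚ.- y)
    ... | inj₁ eq = subst (ℚ._≤ b) (sym eq) (difference a b x y a≤y x≤)
    ... | inj₂ eq = subst (ℚ._≤ b)
      (sym (trans eq (solve 2 (λ x y → :- (x :- y) := y :- x) refl x y))) (difference a b y x a≤x y≤)

  ι : ℕ → ℚ
  ι n = + n / 1

  w : ℕ → ℚ
  w n = + 1 / suc n

  w*ι : ∀ n → w n ℚ.* ι (suc n) ≡ 1ℚ
  w*ι n = ℚ.toℚᵘ-injective (ℚᵘ.≃-trans (ℚ.toℚᵘ-homo-* (w n) (ι (suc n)))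
    (ℚᵘ.≃-trans (ℚᵘ.*-cong (ℚ.toℚᵘ-fromℚᵘ (mkℚᵘ (+ 1) n)) (ℚ.toℚᵘ-fromℚᵘ (mkℚᵘ (+ suc n) 0)))
    (*≡* (cong +_ (trans (ℕ.*-identityʳ (1 ℕ.* suc n)) (trans (ℕ.*-identityˡ (suc n))
      (sym (trans (ℕ.*-identityˡ (suc n ℕ.* 1)) (ℕ.*-identityʳ (suc n))))))))))

  ι-suc : ∀ n → ι (suc n) ≡ 1ℚ ℚ.+ ι n
  ι-suc n = ℚ.toℚᵘ-injective (ℚᵘ.≃-trans (ℚ.toℚᵘ-fromℚᵘ (mkℚᵘ (+ suc n) 0))
    (ℚᵘ.≃-sym (ℚᵘ.≃-trans (ℚ.toℚᵘ-homo-+ 1ℚ (ι n))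
    (ℚᵘ.≃-trans (ℚᵘ.+-congʳ (toℚᵘ 1ℚ) (ℚ.toℚᵘ-fromℚᵘ (mkℚᵘ (+ n) 0)))
    (*≡* (cong (ℤ._* + 1) (cong (ℤ._+_ (+ 1)) (ℤ.*-identityʳ (+ n)))))))))

  0<w : ∀ n → 0ℚ ℚ.< w n
  0<w n = ℚ.positive⁻¹ (w n) {{ℚ.normalize-pos 1 (suc n)}}

  0≤w : ∀ n → 0ℚ ℚ.≤ w n
  0≤w n = ℚ.<⇒≤ (0<w n)

  0≤ι : ∀ n → 0ℚ ℚ.≤ ι n
  0≤ι n = ℚ.nonNegative⁻¹ (ι n) {{ℚ.normalize-nonNeg n 1}}

  1≡w+wι : ∀ n → 1ℚ ≡ w n ℚ.+ w n ℚ.* ι n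
  1≡w+wι n = trans (sym (w*ι n)) (trans (cong (w n ℚ.*_) (ι-suc n))
    (trans (ℚ.*-distribˡ-+ (w n) 1ℚ (ι n)) (cong (ℚ._+ w n ℚ.* ι n) (ℚ.*-identityʳ (w n)))))

  w≤1 : ∀ n → w n ℚ.≤ 1ℚ
  w≤1 n = ≤-by _ (*-mono-0≤ (0≤w n) (0≤ι n)) (1≡w+wι n)

  w-step : ∀ n → w n ≡ w (suc n) ℚ.+ w n ℚ.* w (suc n)
  w-step n = begin
    w n                                            ≡⟨ sym (ℚ.*-identityʳ (w n)) ⟩
    w n ℚ.* 1ℚ                                     ≡⟨ cong (w n ℚ.*_) (1≡w+wι (suc n)) ⟩
    w n ℚ.* (v ℚ.+ v ℚ.* ι (suc n))                ≡⟨ solve 3 (λ a v i → a :* (v :+ v :* i) := v :* (a :* i) :+ a :* v) refl (w n) v (ι (suc n)) ⟩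
    v ℚ.* (w n ℚ.* ι (suc n)) ℚ.+ w n ℚ.* v        ≡⟨ cong (λ z → v ℚ.* z ℚ.+ w n ℚ.* v) (w*ι n) ⟩
    v ℚ.* 1ℚ ℚ.+ w n ℚ.* v                         ≡⟨ cong (ℚ._+ w n ℚ.* v) (ℚ.*-identityʳ v) ⟩
    v ℚ.+ w n ℚ.* v                                ∎
    where
    open ≡-Reasoning
    v = w (suc n)

  w≤2w : ∀ n → w n ℚ.≤ w (suc n) ℚ.+ w (suc n)
  w≤2w n = subst (ℚ._≤ v ℚ.+ v) (sym (w-step n)) (ℚ.+-monoʳ-≤ v
    (subst (w n ℚ.* v ℚ.≤_) (ℚ.*-identityˡ v) (*-monoʳ (0≤w (suc n)) (w≤1 n))))
    where v = w (suc n)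

  w↓ : ∀ n → w (suc n) ℚ.≤ w n
  w↓ n = ≤-by _ (*-mono-0≤ (0≤w n) (0≤w (suc n))) (w-step n)

  w→0 : ∀ ε → 0ℚ ℚ.< ε → ∃ λ N → w N ℚ.< ε
  w→0 ε 0<ε with ℚ.positive 0<ε
  w→0 (mkℚ +[1+ n ] d c) _ | _ = suc d , ℚ.<-≤-trans
    (subst (w (suc d) ℚ.<_) (sym (w-step d)) (subst (ℚ._< w (suc d) ℚ.+ w d ℚ.* w (suc d))
      (ℚ.+-identityʳ (w (suc d))) (ℚ.+-monoʳ-< (w (suc d)) (*-mono-0< (0<w d) (0<w (suc d))))))
    (ℚ.toℚᵘ-cancel-≤ (ℚᵘ.≤-trans (ℚᵘ.≤-reflexive (ℚ.toℚᵘ-fromℚᵘ (mkℚᵘ (+ 1) d)))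
      (*≤* (ℤ.*-monoʳ-≤-nonNeg (+ suc d) {+ 1} {+[1+ n ]} (ℤ.+≤+ (s≤s z≤n))))))

  cw→0 : ∀ C ε → 0ℚ ℚ.< C → 0ℚ ℚ.< ε → ∃ λ N → C ℚ.* w N ℚ.< ε
  cw→0 C ε 0<C 0<ε =
    let N , wN<δ = w→0 (ε ℚ.* ℚ.1/ C) (*-mono-0< 0<ε (ℚ.positive⁻¹ (ℚ.1/ C) {{ℚ.1/pos⇒pos C}}))
    in N , subst (C ℚ.* w N ℚ.<_)
      (trans (solve 3 (λ c e i → c :* (e :* i) := e :* (i :* c)) refl C ε (ℚ.1/ C))
        (trans (cong (ε ℚ.*_) (ℚ.*-inverseˡ C)) (ℚ.*-identityʳ ε)))
      (ℚ.*-monoʳ-<-pos C wN<δ)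
    where
    instance
      C-positive : ℚ.Positive C
      C-positive = positive 0<C
      C-nonZero : ℚ.NonZero C
      C-nonZero = ℚ.pos⇒nonZero C

  -- P n = ∏_{i ≤ n} (1 + 1/(2i)) grows like √n
  P : ℕ → ℚ
  P zero    = 1ℚ
  P (suc n) = P n ℚ.* (1ℚ ℚ.+ ½ ℚ.* w n)

  0≤½w : ∀ n → 0ℚ ℚ.≤ ½ ℚ.* w n
  0≤½w n = *-mono-0≤ (ℚ.<⇒≤ 0<½) (0≤w n)

  0≤1 : 0ℚ ℚ.≤ 1ℚ
  0≤1 = ℚ.nonNegative⁻¹ 1ℚ

  0≤P : ∀ n → 0ℚ ℚ.≤ P n
  0≤P zero    = 0≤1
  0≤P (suc n) = *-mono-0≤ (0≤P n) (ℚ.+-mono-≤ 0≤1 (0≤½w n))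

  1≤P : ∀ n → 1ℚ ℚ.≤ P n
  1≤P zero    = ℚ.≤-refl
  1≤P (suc n) = ℚ.≤-trans (1≤P n) (≤-by (P n ℚ.* (½ ℚ.* w n)) (*-mono-0≤ (0≤P n) (0≤½w n))
    (trans (ℚ.*-distribˡ-+ (P n) 1ℚ (½ ℚ.* w n)) (cong (ℚ._+ P n ℚ.* (½ ℚ.* w n)) (ℚ.*-identityʳ (P n)))))

  P²≤ : ∀ n → P n ℚ.* P n ℚ.≤ 1ℚ ℚ.+ (ι n ℚ.+ ι n)
  P²≤ zero    = ℚ.≤-refl
  P²≤ (suc n) = subst₂ ℚ._≤_
    (sym (solve 2 (λ p h → (p :* h) :* (p :* h) := (p :* p) :* (h :* h)) refl (P n) h))
    (sym (cong (λ z → 1ℚ ℚ.+ (z ℚ.+ z)) (ι-suc n)))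
    (ℚ.≤-trans (*-monoʳ (*-mono-0≤ 0≤h 0≤h) (P²≤ n))
      (≤-by (½ ℚ.* v ℚ.+ (½ ℚ.* v) ℚ.* (½ ℚ.* v)) (ℚ.+-mono-≤ (0≤½w n) (*-mono-0≤ (0≤½w n) (0≤½w n)))
        (trans (lemma i v)
          (trans (cong (λ z → main ℚ.+ (1ℚ ℚ.+ 1ℚ ℚ.+ ½ ℚ.* v) ℚ.* (z ℚ.- (v ℚ.+ v ℚ.* i))) (1≡w+wι n))
          (trans (cong (λ z → main ℚ.+ (1ℚ ℚ.+ 1ℚ ℚ.+ ½ ℚ.* v) ℚ.* z) (ℚ.+-inverseʳ (v ℚ.+ v ℚ.* i)))
          (trans (cong (main ℚ.+_) (ℚ.*-zeroʳ (1ℚ ℚ.+ 1ℚ ℚ.+ ½ ℚ.* v))) (ℚ.+-identityʳ main)))))))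
    where
    i = ι n
    v = w n
    h = 1ℚ ℚ.+ ½ ℚ.* v
    0≤h = ℚ.+-mono-≤ 0≤1 (0≤½w n)
    main = (1ℚ ℚ.+ (i ℚ.+ i)) ℚ.* (h ℚ.* h) ℚ.+ (½ ℚ.* v ℚ.+ (½ ℚ.* v) ℚ.* (½ ℚ.* v))
    lemma : ∀ i v → 1ℚ ℚ.+ ((1ℚ ℚ.+ i) ℚ.+ (1ℚ ℚ.+ i)) ≡
      (1ℚ ℚ.+ (i ℚ.+ i)) ℚ.* ((1ℚ ℚ.+ ½ ℚ.* v) ℚ.* (1ℚ ℚ.+ ½ ℚ.* v)) ℚ.+ (½ ℚ.* v ℚ.+ (½ ℚ.* v) ℚ.* (½ ℚ.* v))
        ℚ.+ (1ℚ ℚ.+ 1ℚ ℚ.+ ½ ℚ.* v) ℚ.* (1ℚ ℚ.- (v ℚ.+ v ℚ.* i))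
    lemma = solve 2 (λ i v → con 1ℚ :+ ((con 1ℚ :+ i) :+ (con 1ℚ :+ i)) :=
      (con 1ℚ :+ (i :+ i)) :* ((con 1ℚ :+ con ½ :* v) :* (con 1ℚ :+ con ½ :* v)) :+ (con ½ :* v :+ (con ½ :* v) :* (con ½ :* v))
        :+ (con 1ℚ :+ con 1ℚ :+ con ½ :* v) :* (con 1ℚ :- (v :+ v :* i))) refl

  u : ℕ → ℚ
  u n = P n ℚ.* w n

  0≤u : ∀ n → 0ℚ ℚ.≤ u n
  0≤u n = *-mono-0≤ (0≤P n) (0≤w n)

  u²≤ : ∀ n → u n ℚ.* u n ℚ.≤ w n ℚ.+ w n
  u²≤ n = subst (ℚ._≤ v ℚ.+ v) (solve 2 (λ p v → (p :* p) :* (v :* v) := (p :* v) :* (p :* v)) refl (P n) v)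
    (ℚ.≤-trans (*-monoʳ (*-mono-0≤ (0≤w n) (0≤w n)) (P²≤ n))
      (≤-by (v ℚ.* v) (*-mono-0≤ (0≤w n) (0≤w n))
        (trans (cong₂ ℚ._+_ (sym (ℚ.*-identityʳ v)) (sym (ℚ.*-identityʳ v)))
        (trans (cong (λ z → v ℚ.* z ℚ.+ v ℚ.* z) (1≡w+wι n))
          (solve 2 (λ v i → v :* (v :+ v :* i) :+ v :* (v :+ v :* i) := (con 1ℚ :+ (i :+ i)) :* (v :* v) :+ v :* v) refl v (ι n))))))
    where v = w n

  cu→0 : ∀ c → 0ℚ ℚ.≤ c → ∀ ε → 0ℚ ℚ.< ε → ∃ λ N → c ℚ.* u N ℚ.< ε
  cu→0 c 0≤c ε 0<ε =
    let N , CwN<ε² = cw→0 C (ε ℚ.* ε) 0<C (*-mono-0< 0<ε 0<ε) in N , below N CwN<ε²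
    where
    C = c ℚ.* c ℚ.+ c ℚ.* c ℚ.+ 1ℚ
    0≤c² = *-mono-0≤ 0≤c 0≤c
    0<C : 0ℚ ℚ.< C
    0<C = ℚ.+-mono-≤-< (ℚ.+-mono-≤ 0≤c² 0≤c²) (ℚ.positive⁻¹ 1ℚ)
    below : ∀ N → C ℚ.* w N ℚ.< ε ℚ.* ε → c ℚ.* u N ℚ.< ε
    below N CwN<ε² with ℚ._<?_ (c ℚ.* u N) ε
    ... | yes p = p
    ... | no ¬p = ⊥-elim (ℚ.<-irrefl refl (ℚ.≤-<-trans ε²≤ CwN<ε²))
      where
      open ℚ.≤-Reasoning
      ε≤ : ε ℚ.≤ c ℚ.* u N
      ε≤ = ℚ.≮⇒≥ ¬p
      ε²≤ : ε ℚ.* ε ℚ.≤ C ℚ.* w N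
      ε²≤ = begin
        ε ℚ.* ε                              ≤⟨ *-monoˡ (ℚ.<⇒≤ 0<ε) ε≤ ⟩
        ε ℚ.* (c ℚ.* u N)                    ≤⟨ *-monoʳ (*-mono-0≤ 0≤c (0≤u N)) ε≤ ⟩
        (c ℚ.* u N) ℚ.* (c ℚ.* u N)          ≡⟨ solve 2 (λ c u → (c :* u) :* (c :* u) := (c :* c) :* (u :* u)) refl c (u N) ⟩
        (c ℚ.* c) ℚ.* (u N ℚ.* u N)          ≤⟨ *-monoˡ 0≤c² (u²≤ N) ⟩
        (c ℚ.* c) ℚ.* (w N ℚ.+ w N)          ≤⟨ ≤-by (w N) (0≤w N) (solve 2 (λ c v → (c :* c :+ c :* c :+ con 1ℚ) :* v := (c :* c) :* (v :+ v) :+ v) refl c (w N)) ⟩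
        C ℚ.* w N                            ∎

  w^≤1 : ∀ n k → w n ^ℚ k ℚ.≤ 1ℚ
  0≤w^ : ∀ n k → 0ℚ ℚ.≤ w n ^ℚ k
  w^≤1 n zero    = ℚ.≤-refl
  w^≤1 n (suc k) = ℚ.≤-trans (*-monoˡ (0≤w n) (w^≤1 n k))
    (subst (ℚ._≤ 1ℚ) (sym (ℚ.*-identityʳ (w n))) (w≤1 n))
  0≤w^ n zero    = 0≤1
  0≤w^ n (suc k) = *-mono-0≤ (0≤w n) (0≤w^ n k)

  w^≤w : ∀ n k → 0 ℕ.< k → w n ^ℚ k ℚ.≤ w n
  w^≤w n (suc k) _ = subst (w n ^ℚ suc k ℚ.≤_) (ℚ.*-identityʳ (w n)) (*-monoˡ (0≤w n) (w^≤1 n k))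

  w^≤w² : ∀ n k → 1 ℕ.< k → w n ^ℚ k ℚ.≤ w n ℚ.* w n
  w^≤w² n (suc k) (s≤s 0<k) = *-monoˡ (0≤w n) (w^≤w n k 0<k)

  ∑-++ : ∀ xs ys (f : ℕ → ℚ) → ∑ℚ (xs ++ ys) f ≡ ∑ℚ xs f ℚ.+ ∑ℚ ys f
  ∑-++ []       ys f = sym (ℚ.+-identityˡ _)
  ∑-++ (x ∷ xs) ys f = trans (cong (f x ℚ.+_) (∑-++ xs ys f)) (sym (ℚ.+-assoc (f x) _ _))

  module _ (N a : ℕ) where
    T = tPartial N a

    term : ℕ → List ℕ → ℕ → ℚ
    term k ks j = w j ^ℚ k ℚ.* T j ks

    last : ℕ → List ℕ → ℕ → ℚ
    last k ks M = ∑ℚ (filter (λ j → N ∣? ℕ.∣ suc j - a ∣) (M ∷ [])) (term k ks)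

    T-step : ∀ k ks M → T (suc M) (k ∷ ks) ≡ T M (k ∷ ks) ℚ.+ last k ks M
    T-step k ks M = trans
      (cong (λ xs → ∑ℚ (filter Q? xs) (term k ks)) (sym (List.upTo-∷ʳ M)))
      (trans (cong (λ xs → ∑ℚ xs (term k ks)) (List.filter-++ Q? (upTo M) (M ∷ [])))
        (∑-++ (filter Q? (upTo M)) (filter Q? (M ∷ [])) (term k ks)))
      where Q? = λ j → N ∣? ℕ.∣ suc j - a ∣

    last-bounds : ∀ k ks M → 0ℚ ℚ.≤ term k ks M → 0ℚ ℚ.≤ last k ks M × last k ks M ℚ.≤ term k ks M
    last-bounds k ks M 0≤t with N ∣? ℕ.∣ suc M - a ∣
    ... | yes _ = subst (0ℚ ℚ.≤_) (sym (ℚ.+-identityʳ _)) 0≤t , ℚ.≤-reflexive (ℚ.+-identityʳ _)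
    ... | no  _ = ℚ.≤-refl , 0≤t

    0≤T : ∀ ks M → 0ℚ ℚ.≤ T M ks
    0≤term : ∀ k ks M → 0ℚ ℚ.≤ term k ks M
    0≤T []       M       = 0≤1
    0≤T (k ∷ ks) zero    = ℚ.≤-refl
    0≤T (k ∷ ks) (suc M) = subst (0ℚ ℚ.≤_) (sym (T-step k ks M))
      (ℚ.+-mono-≤ (0≤T (k ∷ ks) M) (proj₁ (last-bounds k ks M (0≤term k ks M))))
    0≤term k ks M = *-mono-0≤ (0≤w^ M k) (0≤T ks M)

    T↑ : ∀ k ks M → T M (k ∷ ks) ℚ.≤ T (suc M) (k ∷ ks)
    T↑ k ks M = ≤-by (last k ks M) (proj₁ (last-bounds k ks M (0≤term k ks M))) (T-step k ks M)

    T-suc≤ : ∀ k ks M → T (suc M) (k ∷ ks) ℚ.≤ T M (k ∷ ks) ℚ.+ term k ks M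
    T-suc≤ k ks M = subst (ℚ._≤ T M (k ∷ ks) ℚ.+ term k ks M) (sym (T-step k ks M))
      (ℚ.+-monoʳ-≤ (T M (k ∷ ks)) (proj₂ (last-bounds k ks M (0≤term k ks M))))

    c : List (Part 0) → ℚ
    c []       = 1ℚ
    c (_ ∷ ks) = c ks ℚ.+ c ks

    0≤c : ∀ ks → 0ℚ ℚ.≤ c ks
    0≤c []       = 0≤1
    0≤c (_ ∷ ks) = ℚ.+-mono-≤ (0≤c ks) (0≤c ks)

    T≤cP : ∀ ks M → T M (map proj₁ ks) ℚ.≤ c ks ℚ.* P M
    T≤cP []       M    = subst (1ℚ ℚ.≤_) (sym (ℚ.*-identityˡ (P M))) (1≤P M)
    T≤cP (k ∷ ks) zero = *-mono-0≤ (0≤c (k ∷ ks)) (0≤P 0)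
    T≤cP ((k , 0<k) ∷ ks) (suc M) = begin
      T (suc M) (k ∷ map proj₁ ks)                              ≤⟨ T-suc≤ k (map proj₁ ks) M ⟩
      T M (k ∷ map proj₁ ks) ℚ.+ term k (map proj₁ ks) M        ≤⟨ ℚ.+-mono-≤ (T≤cP ((k , 0<k) ∷ ks) M) term≤ ⟩
      (c ks ℚ.+ c ks) ℚ.* P M ℚ.+ w M ℚ.* (c ks ℚ.* P M)        ≡⟨ solve 3 (λ c p v → (c :+ c) :* p :+ v :* (c :* p) := (c :+ c) :* (p :* (con 1ℚ :+ con ½ :* v))) refl (c ks) (P M) (w M) ⟩
      (c ks ℚ.+ c ks) ℚ.* P (suc M)                             ∎
      where
      open ℚ.≤-Reasoning
      term≤ = ℚ.≤-trans (*-monoʳ (0≤T (map proj₁ ks) M) (w^≤w M k 0<k)) (*-monoˡ (0≤w M) (T≤cP ks M))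

    -- 4 c (u M - u (M + 1)) = 2 c P M w M w (M + 1) dominates the increment of T
    T-cauchy : (𝐤 : Index 1) → IsCauchy (λ M → T M (entries 𝐤))
    T-cauchy ((k , 1<k) , ks) = telescope (T↑ k ks′) decreases
      (λ M → *-mono-0≤ 0≤4c (0≤u M)) (cu→0 4c 0≤4c)
      where
      ks′ = map proj₁ ks
      2c = c ks ℚ.+ c ks
      4c = 2c ℚ.+ 2c
      0≤2c = ℚ.+-mono-≤ (0≤c ks) (0≤c ks)
      0≤4c = ℚ.+-mono-≤ 0≤2c 0≤2c
      open ℚ.≤-Reasoning
      decreases : ∀ M → T (suc M) (k ∷ ks′) ℚ.+ 4c ℚ.* u (suc M) ℚ.≤ T M (k ∷ ks′) ℚ.+ 4c ℚ.* u M
      decreases M = begin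
        T (suc M) (k ∷ ks′) ℚ.+ 4c ℚ.* u (suc M)
          ≤⟨ ℚ.+-monoˡ-≤ (4c ℚ.* u (suc M)) (T-suc≤ k ks′ M) ⟩
        (T M (k ∷ ks′) ℚ.+ term k ks′ M) ℚ.+ 4c ℚ.* u (suc M)
          ≤⟨ ℚ.+-monoˡ-≤ (4c ℚ.* u (suc M)) (ℚ.+-monoʳ-≤ (T M (k ∷ ks′)) term≤) ⟩
        (T M (k ∷ ks′) ℚ.+ (w M ℚ.* (v ℚ.+ v)) ℚ.* (c ks ℚ.* P M)) ℚ.+ 4c ℚ.* u (suc M)
          ≡⟨ solve 5 (λ t c p x v →
               (t :+ (x :* (v :+ v)) :* (c :* p)) :+ ((c :+ c) :+ (c :+ c)) :* ((p :* (con 1ℚ :+ con ½ :* x)) :* v) :=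
               t :+ ((c :+ c) :+ (c :+ c)) :* (p :* (v :+ x :* v))) refl (T M (k ∷ ks′)) (c ks) (P M) (w M) v ⟩
        T M (k ∷ ks′) ℚ.+ 4c ℚ.* (P M ℚ.* (v ℚ.+ w M ℚ.* v))
          ≡⟨ cong (λ z → T M (k ∷ ks′) ℚ.+ 4c ℚ.* (P M ℚ.* z)) (sym (w-step M)) ⟩
        T M (k ∷ ks′) ℚ.+ 4c ℚ.* u M ∎
        where
        v = w (suc M)
        term≤ : term k ks′ M ℚ.≤ (w M ℚ.* (v ℚ.+ v)) ℚ.* (c ks ℚ.* P M)
        term≤ = ℚ.≤-trans (*-monoʳ (0≤T ks′ M) (ℚ.≤-trans (w^≤w² M k 1<k) (*-monoˡ (0≤w M) (w≤2w M))))
          (*-monoˡ (*-mono-0≤ (0≤w M) (ℚ.+-mono-≤ (0≤w (suc M)) (0≤w (suc M)))) (T≤cP ks M))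

  ι-+ : ∀ m n → ι (m ℕ.+ n) ≡ ι m ℚ.+ ι n
  ι-+ zero    n = sym (ℚ.+-identityˡ (ι n))
  ι-+ (suc m) n = trans (ι-suc (m ℕ.+ n)) (trans (cong (1ℚ ℚ.+_) (ι-+ m n))
    (trans (sym (ℚ.+-assoc 1ℚ (ι m) (ι n))) (cong (ℚ._+ ι n) (sym (ι-suc m)))))

  w-double : ∀ M → w M ≡ w (M ℕ.+ suc M) ℚ.+ w (M ℕ.+ suc M)
  w-double M = begin
    w M                                        ≡⟨ sym (ℚ.*-identityʳ (w M)) ⟩
    w M ℚ.* 1ℚ                                 ≡⟨ cong (w M ℚ.*_) (sym (w*ι (M ℕ.+ suc M))) ⟩
    w M ℚ.* (v ℚ.* ι (suc M ℕ.+ suc M))        ≡⟨ cong (λ z → w M ℚ.* (v ℚ.* z)) (ι-+ (suc M) (suc M)) ⟩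
    w M ℚ.* (v ℚ.* (ι (suc M) ℚ.+ ι (suc M)))  ≡⟨ solve 3 (λ a v i → a :* (v :* (i :+ i)) := (v :+ v) :* (a :* i)) refl (w M) v (ι (suc M)) ⟩
    (v ℚ.+ v) ℚ.* (w M ℚ.* ι (suc M))          ≡⟨ cong ((v ℚ.+ v) ℚ.*_) (w*ι M) ⟩
    (v ℚ.+ v) ℚ.* 1ℚ                           ≡⟨ ℚ.*-identityʳ (v ℚ.+ v) ⟩
    v ℚ.+ v                                    ∎
    where
    open ≡-Reasoning
    v = w (M ℕ.+ suc M)

  D : ℕ → ℕ → ℚ
  D m n = ∑ℚ (upTo n) λ i → w (m ℕ.+ i)

  D-last : ∀ m n → D m (suc n) ≡ D m n ℚ.+ w (m ℕ.+ n)
  D-last m n = trans (cong (λ xs → ∑ℚ xs (λ i → w (m ℕ.+ i))) (sym (List.upTo-∷ʳ n)))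
    (trans (∑-++ (upTo n) (n ∷ []) (λ i → w (m ℕ.+ i))) (cong (D m n ℚ.+_) (ℚ.+-identityʳ (w (m ℕ.+ n)))))

  D-first : ∀ m n → D m (suc n) ≡ w m ℚ.+ D (suc m) n
  D-first m n = cong₂ ℚ._+_ (cong w (ℕ.+-identityʳ m)) (cong (foldr ℚ._+_ 0ℚ)
    (trans (cong (map (λ i → w (m ℕ.+ i))) (sym (List.map-upTo suc n)))
      (trans (sym (List.map-∘ (upTo n))) (List.map-cong (λ i → cong w (ℕ.+-suc m i)) (upTo n)))))

  log2-step : ∀ M → log2Partial (suc M) ℚ.+ w (M ℕ.+ suc M) ≡ log2Partial M ℚ.+ w (M ℕ.+ M)
  log2-step M = begin
    D (suc M) (suc M) ℚ.+ v                           ≡⟨ solve 3 (λ d v a → d :+ v := ((a :+ d) :+ v) :- a) refl (D (suc M) (suc M)) v (w M) ⟩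
    ((w M ℚ.+ D (suc M) (suc M)) ℚ.+ v) ℚ.- w M       ≡⟨ cong₂ (λ x y → (x ℚ.+ v) ℚ.- y) (sym (D-first M (suc M))) (w-double M) ⟩
    (D M (suc (suc M)) ℚ.+ v) ℚ.- (v ℚ.+ v)           ≡⟨ cong (λ x → (x ℚ.+ v) ℚ.- (v ℚ.+ v)) (trans (D-last M (suc M)) (cong (ℚ._+ v) (D-last M M))) ⟩
    (D M M ℚ.+ w (M ℕ.+ M) ℚ.+ v ℚ.+ v) ℚ.- (v ℚ.+ v) ≡⟨ solve 3 (λ d a v → (d :+ a :+ v :+ v) :- (v :+ v) := d :+ a) refl (D M M) (w (M ℕ.+ M)) v ⟩
    D M M ℚ.+ w (M ℕ.+ M)                             ∎
    where
    open ≡-Reasoning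
    v = w (M ℕ.+ suc M)

  log2-cauchy : IsCauchy log2Partial
  log2-cauchy = telescope increases decreases (λ M → 0≤w (M ℕ.+ M)) vanishes
    where
    w-+≤ : ∀ m d → w (m ℕ.+ d) ℚ.≤ w m
    w-+≤ m zero    = ℚ.≤-reflexive (cong w (ℕ.+-identityʳ m))
    w-+≤ m (suc d) = ℚ.≤-trans (subst (λ i → w i ℚ.≤ w (m ℕ.+ d)) (sym (ℕ.+-suc m d)) (w↓ (m ℕ.+ d))) (w-+≤ m d)
    vanishes : ∀ ε → 0ℚ ℚ.< ε → ∃ λ N → w (N ℕ.+ N) ℚ.< ε
    vanishes ε 0<ε = let N , wN<ε = w→0 ε 0<ε in N , ℚ.≤-<-trans (w-+≤ N N) wN<ε
    decreases : ∀ M → log2Partial (suc M) ℚ.+ w (suc M ℕ.+ suc M) ℚ.≤ log2Partial M ℚ.+ w (M ℕ.+ M)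
    decreases M = subst (log2Partial (suc M) ℚ.+ w (suc M ℕ.+ suc M) ℚ.≤_) (log2-step M)
      (ℚ.+-monoʳ-≤ (log2Partial (suc M)) (w↓ (M ℕ.+ suc M)))
    increases : ∀ M → log2Partial M ℚ.≤ log2Partial (suc M)
    increases M = ≤-by (w (M ℕ.+ M) ℚ.* w (suc (M ℕ.+ M)))
      (*-mono-0≤ (0≤w (M ℕ.+ M)) (0≤w (suc (M ℕ.+ M)))) (begin
      log2Partial (suc M)                        ≡⟨ solve 2 (λ d v → d := (d :+ v) :- v) refl (log2Partial (suc M)) v ⟩
      (log2Partial (suc M) ℚ.+ v) ℚ.- v          ≡⟨ cong (ℚ._- v) (log2-step M) ⟩
      (log2Partial M ℚ.+ x) ℚ.- v                ≡⟨ cong (λ i → (log2Partial M ℚ.+ x) ℚ.- w i) (ℕ.+-suc M M) ⟩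
      (log2Partial M ℚ.+ x) ℚ.- y                ≡⟨ cong (λ z → (log2Partial M ℚ.+ z) ℚ.- y) (w-step (M ℕ.+ M)) ⟩
      (log2Partial M ℚ.+ (y ℚ.+ x ℚ.* y)) ℚ.- y  ≡⟨ solve 3 (λ d y p → (d :+ (y :+ p)) :- y := d :+ p) refl (log2Partial M) y (x ℚ.* y) ⟩
      log2Partial M ℚ.+ x ℚ.* y                  ∎)
      where
      open ≡-Reasoning
      v = w (M ℕ.+ suc M)
      x = w (M ℕ.+ M)
      y = w (suc (M ℕ.+ M))

t : (N a : ℕ) → Index 1 → ℝ
t N a 𝐤 = real (λ M → tPartial N a M (entries 𝐤)) (Convergence.T-cauchy N a 𝐤)

-- The interpolated value, as a polynomial in the variable r = X
tʳ : (N a : ℕ) → Index 1 → ℝ[X]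
tʳ N a 𝐤@(k , ks) = ∑ₚ (contractions k ks) λ 𝐩 → X ^ₚ (dep 𝐤 ∸ dep 𝐩) *ₚ const (t N a 𝐩)

-- t(n) = ∑ 1 / mⁿ over odd m > 0
t₁ : Part 1 → ℝ
t₁ n = t 2 1 (n , [])

-- log 2 = ∫₁² dx/x, the limit of its right Riemann sums
-- ∑_{1 ≤ i ≤ M} (1/M) · 1 / (1 + i/M) = ∑_{1 ≤ i ≤ M} 1 / (M + i)
log2 : ℝ
log2 = real log2Partial Convergence.log2-cauchy

num : ℕ → List (Part 1) → ℕ
num n ns = 2 ℕ.^ (n ℕ.+ 2 ℕ.* length ns) ℕ.* product (map (λ (j , _) → 2 ℕ.^ (j ∸ 1) ∸ 1) ns)

den : (a k n : ℕ) → List (Part 1) → ℕ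
den a k n ns = a ℕ.^ k ℕ.* n ! ℕ.* length ns ! ℕ.* product (map (λ (j , _) → j ℕ.* (2 ℕ.^ j ∸ 1)) ns)

den≢0 : ∀ a .{{_ : NonZero a}} k n ns → NonZero (den a k n ns)
den≢0 a k n ns =
  ℕ.m*n≢0 _ _ {{ℕ.m*n≢0 _ _ {{ℕ.m*n≢0 _ _ {{ℕ.m^n≢0 a k}} {{n ℕ.!≢0}}}} {{length ns ℕ.!≢0}}}}
              {{ℕ.product≢0 (factors≢0 ns)}}
  where
  factors≢0 : ∀ ns → All NonZero (map (λ ((j , _) : Part 1) → j ℕ.* (2 ℕ.^ j ∸ 1)) ns)
  factors≢0 []               = []
  factors≢0 ((j , 1<j) ∷ ns) =
    ℕ.m*n≢0 j _ {{ℕ.>-nonZero (ℕ.≤-trans (s≤s z≤n) 1<j)}}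
                {{ℕ.>-nonZero (ℕ.m<n⇒0<n∸m (ℕ.^-monoʳ-≤ 2 {1} {j} (ℕ.≤-trans (s≤s z≤n) 1<j)))}} ∷ factors≢0 ns

-- The factor of a term of the right-hand side other than t(2) t(n₁) ⋯ t(nₘ) logⁿ(2)
coefficient : (a : ℕ) .{{_ : NonZero a}} (k n : ℕ) → List (Part 1) → ℚ
coefficient a k n ns = (+ num n ns / den a k n ns) {{den≢0 a k n ns}}

{-# OPTIONS --safe #-}

-- Weighting an index of weight k and depth n by s^(k-n-1) 2^(n-1) with s = 1 - 2r, summing over
-- all indices and letting z mark the weight turns each summation variable m into the factor
-- (m + z) / (m - z), in which r no longer occurs. After rescaling by a⁻ᵏ the left-hand sides have
-- the generating function ∑ 1/(m (m - z)) ∏_{m' < m} (m' + z)/(m' - z) over odd m and m'.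
-- This is a well-poised series summable by Dixon's theorem, to t(2) times the limit of
-- ∏ (1 - z/2i)² / (1 - z/(2i-1))². Dixon's theorem is proved by raising the parameter 1 of
-- the well-poised series by 1 (a Wilf–Zeilberger pair) until only the first term survives; all error
-- terms have nonnegative coefficients, so they are bounded by their values at z = 1/4.
-- The logarithmic derivative of the product gives the right-hand side as an exponential.

module Submission where

open import Algebra.Bundles using (CommutativeRing)
import Algebra.Construct.Pointwise as Pointwise
import Algebra.Properties.Semiring.Exp as Exp
import Algebra.Solver.Ring as RingSolver
open import Algebra.Solver.Ring.AlmostCommutativeRing using (fromCommutativeRing; _-Raw-AlmostCommutative⟶_)
open import Algebra.Structures using (IsCommutativeRing)
open import Data.Integer.Base using (+_)
import Data.Integer.Base as ℤ
import Data.Integer.Properties as ℤ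
open import Data.List.Base using (List; []; _∷_; _++_; map; concatMap; upTo; length; applyUpTo)
import Data.List.Properties as List
open import Data.List.Relation.Unary.All as All using (All; []; _∷_)
import Data.List.Relation.Unary.All.Properties as All
open import Data.Maybe.Base using (Maybe; just; nothing)
open import Data.Nat.Base as ℕ using (ℕ; zero; suc; NonZero; _∸_; _≤_; z≤n; s≤s) renaming (_*_ to _*ℕ_)
open import Data.Nat.Divisibility using (_∣_; _∣?_; divides; n∣m*n; 1∣_)
open import Data.Nat.DivMod using (_%_; [m+kn]%n≡m%n; m<n⇒m%n≡m)
open import Data.Nat.ListAction using (product)
import Data.Nat.Properties as ℕ
open import Data.Nat.Solver using () renaming (module +-*-Solver to ℕ-Solver)
open import Data.Product.Base using (_,_; _×_; proj₁; proj₂; ∃)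
open import Data.Rational.Base as ℚ using (ℚ; 0ℚ; 1ℚ; ½; _/_)
import Data.Rational.Properties as ℚ
open import Data.Rational.Solver using () renaming (module +-*-Solver to ℚ-Solver)
open import Data.Rational.Unnormalised.Base using (mkℚᵘ; *≡*)
import Data.Rational.Unnormalised.Properties as ℚᵘ
open import Data.Sum.Base using (inj₁; inj₂)
open import Function.Base using (_∘_)
open import Level using (0ℓ)
open import Relation.Binary.PropositionalEquality as ≡ using (_≡_; cong; cong₂; subst)
import Relation.Binary.Reasoning.Setoid as SetoidReasoning
open import Relation.Binary.Structures using (IsEquivalence)
open import Relation.Nullary using (yes; no; ¬_; contradiction)

open import Defs using (module Convergence; module CauchyLemmas; module Finite)
open CauchyLemmas using (*-mono-0≤; *-mono-0<; *-monoˡ; *-monoʳ; ≤-by; 0<½; halves)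
open Convergence using (ι; w; w*ι; ι-suc; ι-+; 0≤ι; 0≤w; 0≤1; 0≤w^; w^≤w; w-double; log2-step)

-- All algebra takes place at finite truncations. At each truncation the weighted left side is
-- exactly a constant polynomial in r, so only its constant coefficient needs a limit. By the Cauchy
-- property it is enough to truncate at multiples of 2a. The obstacle is the limit in Dixon's
-- theorem, which is required for each coefficient in z separately. A series f with nonnegative
-- coefficients satisfies fₙ ≤ 4ⁿ f(1/4), so a single rational estimate controls every coefficient.
-- The slowest boundary term, after L summands, is of order L^(z - 1). An evaluation point below 1/2
-- leaves room for an elementary comparison with a Wallis quotient of order L^(-1/2), and 1/4 is
-- such a point. All later boundary terms are of order at most 1/L², so letting the number of shifts
-- grow together with L keeps their sum of order 1/L.

module PowerSeries where
  open ℚ-Solver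
  open ≡ using (refl; sym; trans)

  -- Formal power series over ℚ as a commutative ring

  PS : Set
  PS = ℕ → ℚ

  infix 4 _≋_
  _≋_ : PS → PS → Set
  f ≋ g = ∀ n → f n ≡ g n

  C : ℚ → PS
  C q zero    = q
  C q (suc n) = 0ℚ

  tail : PS → PS
  tail f n = f (suc n)

  infixl 6 _⊞_
  infixl 7 _⊛_
  _⊞_ : PS → PS → PS
  (f ⊞ g) n = f n ℚ.+ g n

  ⊟_ : PS → PS
  (⊟ f) n = ℚ.- f n

  -- Recursion on head and tail of the first factor makes the ring laws inductions on the index of
  -- the coefficient. The usual convolution sum is recovered in `⊛-∑`.
  _⊛_ : PS → PS → PS
  (f ⊛ g) zero    = f 0 ℚ.* g 0
  (f ⊛ g) (suc n) = f 0 ℚ.* g (suc n) ℚ.+ (tail f ⊛ g) n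

  ⊛-cong : ∀ {f f′ g g′} → f ≋ f′ → g ≋ g′ → f ⊛ g ≋ f′ ⊛ g′
  ⊛-cong p q zero    = cong₂ ℚ._*_ (p 0) (q 0)
  ⊛-cong p q (suc n) = cong₂ ℚ._+_ (cong₂ ℚ._*_ (p 0) (q (suc n))) (⊛-cong (p ∘ suc) q n)

  ⊛-last : ∀ f g n → (f ⊛ g) (suc n) ≡ (f ⊛ tail g) n ℚ.+ f (suc n) ℚ.* g 0
  ⊛-last f g zero    = refl
  ⊛-last f g (suc n) = trans (cong (f 0 ℚ.* g (suc (suc n)) ℚ.+_) (⊛-last (tail f) g n))
    (sym (ℚ.+-assoc (f 0 ℚ.* g (suc (suc n))) _ _))

  ⊛-comm : ∀ f g → f ⊛ g ≋ g ⊛ f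
  ⊛-comm f g zero    = ℚ.*-comm (f 0) (g 0)
  ⊛-comm f g (suc n) = trans (cong (f 0 ℚ.* g (suc n) ℚ.+_) (⊛-comm (tail f) g n))
    (trans (solve 3 (λ a b c → a :* b :+ c := c :+ b :* a) refl (f 0) (g (suc n)) _)
      (sym (⊛-last g f n)))

  ⊛-scale : ∀ c f g → (λ n → c ℚ.* f n) ⊛ g ≋ (λ n → c ℚ.* (f ⊛ g) n)
  ⊛-scale c f g zero    = ℚ.*-assoc c (f 0) (g 0)
  ⊛-scale c f g (suc n) = trans (cong (c ℚ.* f 0 ℚ.* g (suc n) ℚ.+_) (⊛-scale c (tail f) g n))
    (solve 4 (λ c a b d → c :* a :* b :+ c :* d := c :* (a :* b :+ d)) refl c (f 0) (g (suc n)) _)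

  ⊛-distribʳ : ∀ h f g → (f ⊞ g) ⊛ h ≋ f ⊛ h ⊞ g ⊛ h
  ⊛-distribʳ h f g zero    = ℚ.*-distribʳ-+ (h 0) (f 0) (g 0)
  ⊛-distribʳ h f g (suc n) = trans
    (cong ((f 0 ℚ.+ g 0) ℚ.* h (suc n) ℚ.+_) (⊛-distribʳ h (tail f) (tail g) n))
    (solve 5 (λ a b c d e → (a :+ b) :* c :+ (d :+ e) := a :* c :+ d :+ (b :* c :+ e)) refl
      (f 0) (g 0) (h (suc n)) _ _)

  ⊛-distribˡ : ∀ h f g → h ⊛ (f ⊞ g) ≋ h ⊛ f ⊞ h ⊛ g
  ⊛-distribˡ h f g n = trans (⊛-comm h (f ⊞ g) n)
    (trans (⊛-distribʳ h f g n) (cong₂ ℚ._+_ (⊛-comm f h n) (⊛-comm g h n)))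

  ⊛-assoc : ∀ f g h → (f ⊛ g) ⊛ h ≋ f ⊛ (g ⊛ h)
  ⊛-assoc f g h zero    = ℚ.*-assoc (f 0) (g 0) (h 0)
  ⊛-assoc f g h (suc n) = trans
    (cong (f 0 ℚ.* g 0 ℚ.* h (suc n) ℚ.+_) (trans (⊛-distribʳ h (λ i → f 0 ℚ.* g (suc i)) (tail f ⊛ g) n)
      (cong₂ ℚ._+_ (⊛-scale (f 0) (tail g) h n) (⊛-assoc (tail f) g h n))))
    (solve 5 (λ a b c d e → a :* b :* c :+ (a :* d :+ e) := a :* (b :* c :+ d) :+ e) refl
      (f 0) (g 0) (h (suc n)) _ _)

  0⊛ : ∀ f → C 0ℚ ⊛ f ≋ C 0ℚ
  0⊛ f zero    = ℚ.*-zeroˡ (f 0)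
  0⊛ f (suc n) = trans (cong₂ ℚ._+_ (ℚ.*-zeroˡ (f (suc n)))
    (trans (⊛-cong {tail (C 0ℚ)} {C 0ℚ} {f} (λ { zero → refl ; (suc _) → refl }) (λ _ → refl) n) (0⊛ f n)))
    (C0+0 n)
    where
    C0+0 : ∀ n → 0ℚ ℚ.+ C 0ℚ n ≡ 0ℚ
    C0+0 zero    = refl
    C0+0 (suc n) = refl

  C0 : ∀ n → C 0ℚ n ≡ 0ℚ
  C0 zero    = refl
  C0 (suc n) = refl

  C⊛ : ∀ c f n → (C c ⊛ f) n ≡ c ℚ.* f n
  C⊛ c f zero    = refl
  C⊛ c f (suc n) = trans (cong (c ℚ.* f (suc n) ℚ.+_)
    (trans (⊛-cong {tail (C c)} {C 0ℚ} {f} (sym ∘ C0) (λ _ → refl) n) (trans (0⊛ f n) (C0 n))))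
    (ℚ.+-identityʳ _)

  private
    module ℚ+ = IsCommutativeRing ℚ.+-*-isCommutativeRing

  ring : CommutativeRing 0ℓ 0ℓ
  ring = record
    { Carrier = PS ; _≈_ = _≋_ ; _+_ = _⊞_ ; _*_ = _⊛_ ; -_ = ⊟_ ; 0# = λ _ → 0ℚ ; 1# = C 1ℚ
    ; isCommutativeRing = record
      { isRing = record
        { +-isAbelianGroup = Pointwise.isAbelianGroup ℕ ℚ+.+-isAbelianGroup
        ; *-cong = ⊛-cong
        ; *-assoc = ⊛-assoc
        ; *-identity = (λ f n → trans (C⊛ 1ℚ f n) (ℚ.*-identityˡ (f n)))
                     , (λ f n → trans (⊛-comm f (C 1ℚ) n) (trans (C⊛ 1ℚ f n) (ℚ.*-identityˡ (f n))))
        ; distrib = ⊛-distribˡ , ⊛-distribʳ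
        }
      ; *-comm = ⊛-comm
      }
    }

  C-homomorphism : ℚ.+-*-rawRing -Raw-AlmostCommutative⟶ fromCommutativeRing ring
  C-homomorphism = record
    { ⟦_⟧    = C
    ; +-homo = λ { p q zero → refl ; p q (suc n) → refl }
    ; *-homo = λ { p q zero → refl ; p q (suc n) → sym (trans (C⊛ p (C q) (suc n)) (ℚ.*-zeroʳ p)) }
    ; -‿homo = λ { p zero → refl ; p (suc n) → refl }
    ; 0-homo = C0
    ; 1-homo = λ _ → refl
    }

-- Power series enter the ring solver only through an abstract ℚ-algebra: on the concrete
-- type, comparing normal forms would unfold products into their coefficients
module ℚ-Algebra (R : CommutativeRing 0ℓ 0ℓ) (h : ℚ.+-*-rawRing -Raw-AlmostCommutative⟶ fromCommutativeRing R) where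
  open CommutativeRing R public hiding (zero)
  open _-Raw-AlmostCommutative⟶_ h public using () renaming (⟦_⟧ to κ; +-homo to κ-+; *-homo to κ-*; 0-homo to κ-0; 1-homo to κ-1)
  private
    _≟κ_ : ∀ p q → Maybe (κ p ≈ κ q)
    p ≟κ q with p ℚ.≟ q
    ... | yes ≡.refl = just refl
    ... | no  _    = nothing
  module Solver = RingSolver ℚ.+-*-rawRing (fromCommutativeRing R) h _≟κ_

-- The intended model is `𝕟 n` = n, `𝕨 n` = 1/(n + 1) and `inv m` = 1/(m + 1 - z). Reciprocals are
-- atoms with a cancellation law, so each rational identity below is a polynomial identity combined
-- with cancellations.
record DixonParameters (R : CommutativeRing 0ℓ 0ℓ) (h : ℚ.+-*-rawRing -Raw-AlmostCommutative⟶ fromCommutativeRing R) : Set where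
  open ℚ-Algebra R h
  field
    𝕟 𝕨     : ℕ → Carrier
    𝕟-zero  : 𝕟 0 ≈ κ 0ℚ
    𝕟-suc   : ∀ n → 𝕟 (suc n) ≈ κ 1ℚ + 𝕟 n
    𝕟*𝕨     : ∀ n → 𝕟 (suc n) * 𝕨 n ≈ 1#
    z       : Carrier
    inv     : ℕ → Carrier
    inv-law : ∀ m → (𝕟 (suc m) - z) * inv m ≈ 1#

-- Dixon's theorem: shifting the parameter of a well-poised series

module Dixon (R : CommutativeRing 0ℓ 0ℓ) (h : ℚ.+-*-rawRing -Raw-AlmostCommutative⟶ fromCommutativeRing R)
  (parameters : DixonParameters R h) where
  open ℚ-Algebra R h
  open DixonParameters parameters
  open Solver

  𝕟-+ : ∀ m n → 𝕟 (m ℕ.+ n) ≈ 𝕟 m + 𝕟 n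
  𝕟-+ zero    n = sym (trans (+-congʳ (trans 𝕟-zero κ-0)) (+-identityˡ _))
  𝕟-+ (suc m) n = trans (𝕟-suc (m ℕ.+ n)) (trans (+-congˡ (𝕟-+ m n))
    (trans (sym (+-assoc (κ 1ℚ) (𝕟 m) (𝕟 n))) (+-congʳ (sym (𝕟-suc m)))))

  drop : ∀ {a} x → a ≈ 1# → x * a ≈ x
  drop x a≈1 = trans (*-congˡ a≈1) (*-identityʳ x)

  -- One less than 2i + 2j + 3, because `𝕨` and `inv` at m have the denominators m + 1 and m + 1 -
  -- z.
  d : ℕ → ℕ → ℕ
  d i j = suc (suc ((j ℕ.+ j) ℕ.+ (i ℕ.+ i)))

  d-suc : ∀ i j → d i (suc j) ≡ d (suc i) j
  d-suc i j = cong (λ n → suc (suc n)) (≡.trans (cong (λ n → suc n ℕ.+ (i ℕ.+ i)) (ℕ.+-suc j j))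
    (≡.sym (≡.trans (cong (λ n → j ℕ.+ j ℕ.+ suc n) (ℕ.+-suc i i))
      (≡.trans (ℕ.+-suc (j ℕ.+ j) (suc (i ℕ.+ i))) (cong suc (ℕ.+-suc (j ℕ.+ j) (i ℕ.+ i)))))))

  square : Carrier → Carrier
  square x = x * x

  -- The term ratio (i+j+1)(2j+1)²(2j+1+z) / ((j+1)(2i+2j+3)²(2i+2j+3-z)) of the hypergeometric
  -- series without its very-well-poised factor i + 1 + 2j. That factor is added in `t`.
  ratio : ℕ → ℕ → Carrier
  ratio i j = 𝕟 (suc (i ℕ.+ j)) * square (𝕟 (suc (j ℕ.+ j))) * 𝕨 j * square (𝕨 (d i j))
    * (𝕟 (suc (j ℕ.+ j)) + z) * inv (d i j)

  s : ℕ → ℕ → Carrier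
  s i zero    = 𝕨 i
  s i (suc j) = s i j * ratio i j

  -- The terms of the well-poised series 5F4 with a = i + 1, 1 + a/2, 1/2, 1/2, (1 + z)/2
  t : ℕ → ℕ → Carrier
  t i j = 𝕟 (suc (i ℕ.+ (j ℕ.+ j))) * s i j

  -- The mate of `t` in the Wilf-Zeilberger pair, s j (2j + 4i + 3 - z)/(2i + 1 - z). Its factor j
  -- makes it vanish at j = 0, so that summing the certificate over j leaves one boundary term only.
  H : ℕ → ℕ → Carrier
  H i j = s i j * 𝕟 j * (𝕟 ((j ℕ.+ j) ℕ.+ (suc (i ℕ.+ i) ℕ.+ suc (suc (i ℕ.+ i)))) - z) * inv (i ℕ.+ i)

  -- The expected quotient of the full sums for i and i + 1. It is the Wallis factor
  -- (2i+2)(2i+4)/(2i+3)² times (2i+2-z)²/((2i+1-z)(2i+3-z)).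
  σ : ℕ → Carrier
  σ i = κ (+ 4 / 1) * 𝕟 (suc i) * 𝕟 (suc (suc i)) * square (𝕨 (suc (suc (i ℕ.+ i))))
    * square (𝕟 (suc (suc (i ℕ.+ i))) - z) * inv (i ℕ.+ i) * inv (suc (suc (i ℕ.+ i)))

  -- Separated from `shift` so that i + j and `d i j` can be replaced along equalities of natural
  -- numbers.
  shift′ : ℕ → ℕ → ℕ → Carrier
  shift′ i k m = 𝕟 (suc k) * 𝕨 (suc i) * square (𝕟 (suc (suc (suc (i ℕ.+ i))))) * square (𝕨 m)
    * (𝕟 (suc (suc (suc (i ℕ.+ i)))) - z) * inv m

  shift : ℕ → ℕ → Carrier
  shift i j = shift′ i (i ℕ.+ j) (d i j)

  -- Each Pochhammer symbol in s changes by the quotient of its last and first factors when i grows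
  -- by 1. The induction step only compares the two ways around a square: `shift` then `ratio`, or
  -- `ratio` then `shift`.
  s-shift : ∀ i j → s (suc i) j ≈ s i j * shift i j
  s-shift i zero = begin
    𝕨 (suc i)                        ≈⟨ drop (𝕨 (suc i)) one ⟨
    𝕨 (suc i) * (𝕟 (suc i) * 𝕨 i * (square (𝕟 (suc n)) * square (𝕨 n)) * ((𝕟 (suc n) - z) * inv n))
      ≈⟨ solve 6 (λ a b c e f g → a :* (b :* c :* (e :* e :* (f :* f)) :* g) :=
           c :* (b :* a :* (e :* e) :* (f :* f) :* con 1ℚ :* g)) refl (𝕨 (suc i)) (𝕟 (suc i)) (𝕨 i) (𝕟 (suc n)) (𝕨 n) _ ⟩
    𝕨 i * (𝕟 (suc i) * 𝕨 (suc i) * square (𝕟 (suc n)) * square (𝕨 n) * κ 1ℚ * ((𝕟 (suc n) - z) * inv n))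
      ≈⟨ *-congˡ (solve 4 (λ a e g k → a :* con 1ℚ :* (g :* k) := a :* g :* k) refl _ (𝕨 n) (𝕟 (suc n) - z) (inv n)) ⟩
    𝕨 i * (𝕟 (suc i) * 𝕨 (suc i) * square (𝕟 (suc n)) * square (𝕨 n) * (𝕟 (suc n) - z) * inv n)
      ≡⟨ cong (λ m → 𝕨 i * shift′ i m n) (≡.sym (ℕ.+-identityʳ i)) ⟩
    𝕨 i * shift i zero ∎
    where
    open SetoidReasoning setoid
    n = suc (suc (i ℕ.+ i))
    one : 𝕟 (suc i) * 𝕨 i * (square (𝕟 (suc n)) * square (𝕨 n)) * ((𝕟 (suc n) - z) * inv n) ≈ 1#
    one = trans (drop _ (inv-law n)) (trans (*-cong (𝕟*𝕨 i)
      (trans (solve 2 (λ a b → a :* a :* (b :* b) := a :* b :* (a :* b)) refl (𝕟 (suc n)) (𝕨 n))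
        (trans (drop _ (𝕟*𝕨 n)) (𝕟*𝕨 n)))) (*-identityʳ 1#))
  s-shift i (suc j) = begin
    s (suc i) j * ratio (suc i) j          ≈⟨ *-congʳ (s-shift i j) ⟩
    s i j * shift i j * ratio (suc i) j    ≈⟨ *-assoc _ _ _ ⟩
    s i j * (shift i j * ratio (suc i) j)  ≈⟨ *-congˡ exchange ⟩
    s i j * (ratio i j * shift i (suc j))  ≈⟨ *-assoc _ _ _ ⟨
    s i j * ratio i j * shift i (suc j)    ∎
    where
    open SetoidReasoning setoid
    exchange : shift i j * ratio (suc i) j ≈ ratio i j * shift i (suc j)
    exchange = trans (rearrange (𝕟 (suc (i ℕ.+ j))) (𝕨 (suc i)) (𝕟 (suc (suc (suc (i ℕ.+ i))))) (𝕨 (d i j))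
      (𝕟 (suc (suc (suc (i ℕ.+ i)))) - z) (inv (d i j))
      (𝕟 (suc (suc (i ℕ.+ j)))) (𝕟 (suc (j ℕ.+ j))) (𝕨 (d (suc i) j)) (𝕨 j) (𝕟 (suc (j ℕ.+ j)) + z) (inv (d (suc i) j)))
      (*-congˡ (reflexive (cong₂ (shift′ i) (≡.sym (ℕ.+-suc i j)) (≡.sym (d-suc i j)))))
      where
      rearrange = solve 12
        (λ a v q e q-z k b o f y o+z l →
          (a :* v :* (q :* q) :* (e :* e) :* q-z :* k) :* (b :* (o :* o) :* y :* (f :* f) :* o+z :* l) :=
          (a :* (o :* o) :* y :* (e :* e) :* o+z :* k) :* (b :* v :* (q :* q) :* (f :* f) :* q-z :* l)) refl

  lin : ℕ → ℕ → Carrier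
  lin i j = 𝕟 (suc (i ℕ.+ (j ℕ.+ j)))

  -- The certificate with i and j as free variables: s is divided out and the denominators (2i + 1 -
  -- z)(e - z)e² are cleared, where `e` is 2i + 2j + 3.
  certificate-identity : ∀ i j z →
    let 2′ = κ (+ 2 / 1) ; 3′ = κ (+ 3 / 1) ; 4′ = κ (+ 4 / 1) ; 5′ = κ (+ 5 / 1) ; 1′ = κ 1ℚ
        e = 2′ * i + 3′ + 2′ * j in
    (i + 1′ + 2′ * j) * ((2′ * i + 1′ - z) * ((e - z) * (e * e)))
      + (i + 1′ + j) * ((2′ * j + 1′) * (2′ * j + 1′)) * (2′ * j + 1′ + z) * (2′ * j + 4′ * i + 5′ - z)
    ≈ j * (2′ * j + 4′ * i + 3′ - z) * ((e - z) * (e * e))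
      + 4′ * (i + 1′) * (i + 1′ + j) * (i + 2′ + 2′ * j) * ((2′ * i + 2′ - z) * (2′ * i + 2′ - z))
  certificate-identity = solve 3 (λ i j z →
    let 2′ = con (+ 2 / 1) ; 3′ = con (+ 3 / 1) ; 4′ = con (+ 4 / 1) ; 5′ = con (+ 5 / 1) ; 1′ = con 1ℚ
        e = 2′ :* i :+ 3′ :+ 2′ :* j in
    (i :+ 1′ :+ 2′ :* j) :* ((2′ :* i :+ 1′ :- z) :* ((e :- z) :* (e :* e)))
      :+ (i :+ 1′ :+ j) :* ((2′ :* j :+ 1′) :* (2′ :* j :+ 1′)) :* (2′ :* j :+ 1′ :+ z) :* (2′ :* j :+ 4′ :* i :+ 5′ :- z)
    := j :* (2′ :* j :+ 4′ :* i :+ 3′ :- z) :* ((e :- z) :* (e :* e))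
      :+ 4′ :* (i :+ 1′) :* (i :+ 1′ :+ j) :* (i :+ 2′ :+ 2′ :* j) :* ((2′ :* i :+ 2′ :- z) :* (2′ :* i :+ 2′ :- z))) refl

  module _ (i j : ℕ) where
    private
      I = 𝕟 i
      J = 𝕟 j
      2′ = κ (+ 2 / 1)
      1′ = κ 1ℚ
      3′ = κ (+ 3 / 1)
      4′ = κ (+ 4 / 1)
      5′ = κ (+ 5 / 1)
      e = 2′ * I + 3′ + 2′ * J
      A D A⁻ D⁻ B⁻ E W V U u : Carrier
      A  = 2′ * I + 1′ - z
      D  = e - z
      A⁻ = inv (i ℕ.+ i)
      D⁻ = inv (d i j)
      B⁻ = inv (suc (suc (i ℕ.+ i)))
      E  = 𝕨 (d i j)
      W  = 𝕨 j
      V  = 𝕨 (suc i)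
      U  = 𝕨 (suc (suc (i ℕ.+ i)))
      -- The common factor: each of the four terms of the certificate is a polynomial in `I`, `J`,
      -- `z` times `u`.
      u  = A⁻ * (D⁻ * (E * E)) * s i j

      𝕟-suc₂ : ∀ n → 𝕟 (suc (suc n)) ≈ 2′ + 𝕟 n
      𝕟-suc₂ n = trans (𝕟-suc _) (trans (+-congˡ (𝕟-suc n))
        (solve 1 (λ n → con 1ℚ :+ (con 1ℚ :+ n) := con (+ 2 / 1) :+ n) refl (𝕟 n)))

      𝕟-double : ∀ n → 𝕟 (n ℕ.+ n) ≈ 2′ * 𝕟 n
      𝕟-double n = trans (𝕟-+ n n) (solve 1 (λ n → n :+ n := con (+ 2 / 1) :* n) refl (𝕟 n))

      i+i+1≈ : 𝕟 (suc (i ℕ.+ i)) ≈ 2′ * I + 1′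
      i+i+1≈ = trans (𝕟-suc _) (trans (+-comm _ _) (+-congʳ (𝕟-double i)))

      i+i+2≈ : 𝕟 (suc (suc (i ℕ.+ i))) ≈ 2′ * I + 2′
      i+i+2≈ = trans (𝕟-suc₂ _) (trans (+-comm _ _) (+-congʳ (𝕟-double i)))

      j+j+1≈ : 𝕟 (suc (j ℕ.+ j)) ≈ 2′ * J + 1′
      j+j+1≈ = trans (𝕟-suc _) (trans (+-comm _ _) (+-congʳ (𝕟-double j)))

      d+1≈ : 𝕟 (suc (d i j)) ≈ e
      d+1≈ = trans (𝕟-suc₂ _) (trans (+-congˡ (trans (𝕟-suc _) (+-congˡ (trans (𝕟-+ _ _) (+-cong (𝕟-double j) (𝕟-double i))))))
        (solve 2 (λ i j → con (+ 2 / 1) :+ (con 1ℚ :+ (con (+ 2 / 1) :* j :+ con (+ 2 / 1) :* i)) :=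
          con (+ 2 / 1) :* i :+ con (+ 3 / 1) :+ con (+ 2 / 1) :* j) refl I J))

      i+j+1≈ : 𝕟 (suc (i ℕ.+ j)) ≈ I + 1′ + J
      i+j+1≈ = trans (𝕟-suc _) (trans (+-congˡ (𝕟-+ i j))
        (solve 2 (λ i j → con 1ℚ :+ (i :+ j) := i :+ con 1ℚ :+ j) refl I J))

      lin≈ : lin i j ≈ I + 1′ + 2′ * J
      lin≈ = trans (𝕟-suc _) (trans (+-congˡ (trans (𝕟-+ _ _) (+-congˡ (𝕟-double j))))
        (solve 2 (λ i j → con 1ℚ :+ (i :+ con (+ 2 / 1) :* j) := i :+ con 1ℚ :+ con (+ 2 / 1) :* j) refl I J))

      lin-suc≈ : lin (suc i) j ≈ I + 2′ + 2′ * J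
      lin-suc≈ = trans (𝕟-suc _) (trans (+-congˡ lin≈)
        (solve 2 (λ i j → con 1ℚ :+ (i :+ con 1ℚ :+ con (+ 2 / 1) :* j) := i :+ con (+ 2 / 1) :+ con (+ 2 / 1) :* j) refl I J))

      c≈ : ∀ k → 𝕟 ((k ℕ.+ k) ℕ.+ (suc (i ℕ.+ i) ℕ.+ suc (suc (i ℕ.+ i)))) ≈ 2′ * 𝕟 k + 4′ * I + 3′
      c≈ k = trans (𝕟-+ (k ℕ.+ k) _) (trans (+-cong (𝕟-double k) (trans (𝕟-+ (suc (i ℕ.+ i)) _) (+-cong i+i+1≈ i+i+2≈)))
        (solve 2 (λ i k → con (+ 2 / 1) :* k :+ (con (+ 2 / 1) :* i :+ con 1ℚ :+ (con (+ 2 / 1) :* i :+ con (+ 2 / 1))) :=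
          con (+ 2 / 1) :* k :+ con (+ 4 / 1) :* i :+ con (+ 3 / 1)) refl I (𝕟 k)))

      A*A⁻ : A * A⁻ ≈ 1#
      A*A⁻ = trans (*-congʳ (+-congʳ (sym i+i+1≈))) (inv-law (i ℕ.+ i))

      D*D⁻ : D * D⁻ ≈ 1#
      D*D⁻ = trans (*-congʳ (+-congʳ (sym d+1≈))) (inv-law (d i j))

      e*E : e * E ≈ 1#
      e*E = trans (*-congʳ (sym d+1≈)) (𝕟*𝕨 (d i j))

      term₁ : t i j ≈ (I + 1′ + 2′ * J) * (A * (D * (e * e))) * u
      term₁ = begin
        lin i j * s i j                             ≈⟨ *-congʳ lin≈ ⟩
        (I + 1′ + 2′ * J) * s i j                   ≈⟨ drop _ A*A⁻ ⟨
        (I + 1′ + 2′ * J) * s i j * (A * A⁻)        ≈⟨ drop _ D*D⁻ ⟨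
        (I + 1′ + 2′ * J) * s i j * (A * A⁻) * (D * D⁻) ≈⟨ drop _ e*E ⟨
        (I + 1′ + 2′ * J) * s i j * (A * A⁻) * (D * D⁻) * (e * E) ≈⟨ drop _ e*E ⟨
        (I + 1′ + 2′ * J) * s i j * (A * A⁻) * (D * D⁻) * (e * E) * (e * E)
          ≈⟨ solve 8 (λ l s a a′ d d′ e f → l :* s :* (a :* a′) :* (d :* d′) :* (e :* f) :* (e :* f) :=
               l :* (a :* (d :* (e :* e))) :* (a′ :* (d′ :* (f :* f)) :* s)) refl (I + 1′ + 2′ * J) (s i j) A A⁻ D D⁻ e E ⟩
        (I + 1′ + 2′ * J) * (A * (D * (e * e))) * u ∎
        where open SetoidReasoning setoid

      term₂ : H i (suc j) ≈ (I + 1′ + J) * ((2′ * J + 1′) * (2′ * J + 1′)) * (2′ * J + 1′ + z) * (2′ * J + 4′ * I + 5′ - z) * u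
      term₂ = begin
        s i j * ratio i j * 𝕟 (suc j) * (c - z) * A⁻
          ≈⟨ solve 10 (λ s a b w f l k n c a′ → s :* (a :* (b :* b) :* w :* (f :* f) :* l :* k) :* n :* c :* a′ :=
               a :* (b :* b) :* l :* c :* (a′ :* (k :* (f :* f)) :* s) :* (n :* w)) refl
               (s i j) (𝕟 (suc (i ℕ.+ j))) (𝕟 (suc (j ℕ.+ j))) W E (𝕟 (suc (j ℕ.+ j)) + z) D⁻ (𝕟 (suc j)) (c - z) A⁻ ⟩
        𝕟 (suc (i ℕ.+ j)) * square (𝕟 (suc (j ℕ.+ j))) * (𝕟 (suc (j ℕ.+ j)) + z) * (c - z) * u * (𝕟 (suc j) * W)
          ≈⟨ drop _ (𝕟*𝕨 j) ⟩
        𝕟 (suc (i ℕ.+ j)) * square (𝕟 (suc (j ℕ.+ j))) * (𝕟 (suc (j ℕ.+ j)) + z) * (c - z) * u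
          ≈⟨ *-congʳ (*-cong (*-cong (*-cong i+j+1≈ (*-cong j+j+1≈ j+j+1≈)) (+-congʳ j+j+1≈)) (+-congʳ c+2≈)) ⟩
        (I + 1′ + J) * ((2′ * J + 1′) * (2′ * J + 1′)) * (2′ * J + 1′ + z) * (2′ * J + 4′ * I + 5′ - z) * u ∎
        where
        open SetoidReasoning setoid
        c = 𝕟 ((suc j ℕ.+ suc j) ℕ.+ (suc (i ℕ.+ i) ℕ.+ suc (suc (i ℕ.+ i))))
        c+2≈ : c ≈ 2′ * J + 4′ * I + 5′
        c+2≈ = trans (c≈ (suc j)) (trans (+-congʳ (+-congʳ (*-congˡ (𝕟-suc j))))
          (solve 2 (λ i j → con (+ 2 / 1) :* (con 1ℚ :+ j) :+ con (+ 4 / 1) :* i :+ con (+ 3 / 1) :=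
            con (+ 2 / 1) :* j :+ con (+ 4 / 1) :* i :+ con (+ 5 / 1)) refl I J))

      term₃ : H i j ≈ J * (2′ * J + 4′ * I + 3′ - z) * (D * (e * e)) * u
      term₃ = begin
        H i j                                ≈⟨ *-congʳ (*-congˡ (+-congʳ (c≈ j))) ⟩
        s i j * J * C * A⁻                   ≈⟨ drop _ D*D⁻ ⟨
        s i j * J * C * A⁻ * (D * D⁻)        ≈⟨ drop _ e*E ⟨
        s i j * J * C * A⁻ * (D * D⁻) * (e * E) ≈⟨ drop _ e*E ⟨
        s i j * J * C * A⁻ * (D * D⁻) * (e * E) * (e * E)
          ≈⟨ solve 8 (λ s j c a′ d d′ e f → s :* j :* c :* a′ :* (d :* d′) :* (e :* f) :* (e :* f) :=
               j :* c :* (d :* (e :* e)) :* (a′ :* (d′ :* (f :* f)) :* s)) refl (s i j) J C A⁻ D D⁻ e E ⟩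
        J * C * (D * (e * e)) * u ∎
        where
        open SetoidReasoning setoid
        C = 2′ * J + 4′ * I + 3′ - z

      term₄ : σ i * t (suc i) j ≈
        4′ * (I + 1′) * (I + 1′ + J) * (I + 2′ + 2′ * J) * ((2′ * I + 2′ - z) * (2′ * I + 2′ - z)) * u
      term₄ = begin
        σ i * (lin (suc i) j * s (suc i) j)
          ≈⟨ *-congˡ (*-congˡ (s-shift i j)) ⟩
        σ i * (lin (suc i) j * (s i j * shift i j))
          ≈⟨ solve 15 (λ n₁ n₂ U m A⁻ B⁻ l s p V q E b D⁻ f →
               (f :* n₁ :* n₂ :* (U :* U) :* (m :* m) :* A⁻ :* B⁻) :*
                 (l :* (s :* (p :* V :* (q :* q) :* (E :* E) :* b :* D⁻))) :=
               f :* n₁ :* p :* l :* (m :* m) :* (A⁻ :* (D⁻ :* (E :* E)) :* s) :*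
                 (n₂ :* V) :* (q :* U) :* (q :* U) :* (b :* B⁻)) refl
               (𝕟 (suc i)) (𝕟 (suc (suc i))) U M A⁻ B⁻ (lin (suc i) j) (s i j) (𝕟 (suc (i ℕ.+ j))) V
               Q E (Q - z) D⁻ 4′ ⟩
        4′ * 𝕟 (suc i) * 𝕟 (suc (i ℕ.+ j)) * lin (suc i) j * (M * M) * u * (𝕟 (suc (suc i)) * V) * (Q * U) * (Q * U) * ((Q - z) * B⁻)
          ≈⟨ trans (drop _ (inv-law _)) (trans (drop _ (𝕟*𝕨 _)) (trans (drop _ (𝕟*𝕨 _)) (drop _ (𝕟*𝕨 (suc i))))) ⟩
        4′ * 𝕟 (suc i) * 𝕟 (suc (i ℕ.+ j)) * lin (suc i) j * (M * M) * u
          ≈⟨ *-congʳ (*-cong (*-cong (*-cong (*-congˡ (trans (𝕟-suc i) (+-comm _ _))) i+j+1≈) lin-suc≈) (*-cong M≈ M≈)) ⟩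
        4′ * (I + 1′) * (I + 1′ + J) * (I + 2′ + 2′ * J) * ((2′ * I + 2′ - z) * (2′ * I + 2′ - z)) * u ∎
        where
        open SetoidReasoning setoid
        Q = 𝕟 (suc (suc (suc (i ℕ.+ i))))
        M = 𝕟 (suc (suc (i ℕ.+ i))) - z
        M≈ : M ≈ 2′ * I + 2′ - z
        M≈ = +-congʳ i+i+2≈

    -- Summed over j, this becomes S(i) = σᵢ S(i + 1) for the sums S(i) of the terms `t i j`, up to
    -- a boundary term.
    certificate : t i j + H i (suc j) ≈ H i j + σ i * t (suc i) j
    certificate = trans (+-cong term₁ term₂) (trans (sym (distribʳ u _ _))
      (trans (*-congʳ (certificate-identity I J z)) (trans (distribʳ u _ _) (sym (+-cong term₃ term₄)))))

  ∑t : ℕ → ℕ → Carrier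
  ∑t i zero    = 0#
  ∑t i (suc L) = ∑t i L + t i L

  ∏σ : ℕ → Carrier
  ∏σ zero    = 1#
  ∏σ (suc N) = ∏σ N * σ N

  -- The boundary terms of N successive shifts, each multiplied by the factors σ that were split off
  -- before it.
  error : ℕ → ℕ → Carrier
  error zero    L = 0#
  error (suc N) L = error N L + ∏σ N * H N L

  ∑t-shift : ∀ i L → ∑t i L + H i L ≈ σ i * ∑t (suc i) L
  ∑t-shift i zero = trans (+-identityˡ _) (trans (*-congʳ (*-congʳ (*-congˡ 𝕟-zero)))
    (trans (solve 3 (λ s c v → s :* con 0ℚ :* c :* v := con 0ℚ) refl (s i 0) _ (inv (i ℕ.+ i))) (trans κ-0 (sym (zeroʳ _)))))
  ∑t-shift i (suc L) = begin
    ∑t i L + t i L + H i (suc L)         ≈⟨ +-assoc _ _ _ ⟩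
    ∑t i L + (t i L + H i (suc L))       ≈⟨ +-congˡ (certificate i L) ⟩
    ∑t i L + (H i L + σ i * t (suc i) L) ≈⟨ +-assoc _ _ _ ⟨
    ∑t i L + H i L + σ i * t (suc i) L   ≈⟨ +-congʳ (∑t-shift i L) ⟩
    σ i * ∑t (suc i) L + σ i * t (suc i) L ≈⟨ distribˡ (σ i) _ _ ⟨
    σ i * ∑t (suc i) (suc L)             ∎
    where open SetoidReasoning setoid

  ∑t+error : ∀ N L → ∑t 0 L + error N L ≈ ∏σ N * ∑t N L
  ∑t+error zero    L = trans (+-identityʳ _) (sym (*-identityˡ _))
  ∑t+error (suc N) L = begin
    ∑t 0 L + (error N L + ∏σ N * H N L)  ≈⟨ +-assoc _ _ _ ⟨
    ∑t 0 L + error N L + ∏σ N * H N L    ≈⟨ +-congʳ (∑t+error N L) ⟩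
    ∏σ N * ∑t N L + ∏σ N * H N L         ≈⟨ distribˡ (∏σ N) _ _ ⟨
    ∏σ N * (∑t N L + H N L)              ≈⟨ *-congˡ (∑t-shift N L) ⟩
    ∏σ N * (σ N * ∑t (suc N) L)          ≈⟨ *-assoc _ _ _ ⟨
    ∏σ N * σ N * ∑t (suc N) L            ∎
    where open SetoidReasoning setoid

  k : ℕ → ℕ → ℕ
  k i j = (j ℕ.+ j) ℕ.+ suc (suc (i ℕ.+ i))

  -- Since 2j + 4i + 3 - z is (2i + 1 - z) + (2j + 2i + 2), the only negative coefficient cancels
  -- against `inv (i ℕ.+ i)`. What remains has visibly nonnegative coefficients.
  H-split : ∀ i j → H i j ≈ s i j * 𝕟 j * (1# + 𝕟 (k i j) * inv (i ℕ.+ i))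
  H-split i j = begin
    s i j * 𝕟 j * (𝕟 ((j ℕ.+ j) ℕ.+ (n ℕ.+ suc n)) - z) * inv (i ℕ.+ i)
      ≡⟨ cong (λ m → s i j * 𝕟 j * (𝕟 m - z) * inv (i ℕ.+ i)) c≡ ⟩
    s i j * 𝕟 j * (𝕟 (n ℕ.+ k i j) - z) * inv (i ℕ.+ i)
      ≈⟨ *-congʳ (*-congˡ (+-congʳ (𝕟-+ n (k i j)))) ⟩
    s i j * 𝕟 j * (𝕟 n + 𝕟 (k i j) - z) * inv (i ℕ.+ i)
      ≈⟨ solve 5 (λ x a b z v → x :* (a :+ b :- z) :* v := x :* ((a :- z) :* v :+ b :* v)) refl
           (s i j * 𝕟 j) (𝕟 n) (𝕟 (k i j)) z (inv (i ℕ.+ i)) ⟩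
    s i j * 𝕟 j * ((𝕟 n - z) * inv (i ℕ.+ i) + 𝕟 (k i j) * inv (i ℕ.+ i))
      ≈⟨ *-congˡ (+-congʳ (inv-law (i ℕ.+ i))) ⟩
    s i j * 𝕟 j * (1# + 𝕟 (k i j) * inv (i ℕ.+ i)) ∎
    where
    open SetoidReasoning setoid
    n = suc (i ℕ.+ i)
    c≡ : (j ℕ.+ j) ℕ.+ (n ℕ.+ suc n) ≡ n ℕ.+ ((j ℕ.+ j) ℕ.+ suc n)
    c≡ = ≡.trans (≡.sym (ℕ.+-assoc (j ℕ.+ j) n (suc n)))
      (≡.trans (cong (ℕ._+ suc n) (ℕ.+-comm (j ℕ.+ j) n)) (ℕ.+-assoc n (j ℕ.+ j) (suc n)))

  -- With M = 2i + 2, (M - z)² is (M - 1 - z)(M + 1 - z) + 1. This again removes every negative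
  -- coefficient.
  σ-split : ∀ i → σ i ≈ κ (+ 4 / 1) * 𝕟 (suc i) * 𝕟 (suc (suc i)) * square (𝕨 (suc (suc (i ℕ.+ i))))
    * (1# + inv (i ℕ.+ i) * inv (suc (suc (i ℕ.+ i))))
  σ-split i = begin
    q * square (M - z) * A⁻ * B⁻                        ≈⟨ solve 4 (λ q m a b → q :* (m :* m) :* a :* b := q :* (m :* m :* a :* b)) refl q (M - z) A⁻ B⁻ ⟩
    q * (square (M - z) * A⁻ * B⁻)                      ≈⟨ *-congˡ (*-congʳ (*-congʳ (*-cong (+-congʳ (𝕟-suc _)) (+-congʳ (𝕟-suc _))))) ⟩
    q * (square (κ 1ℚ + A - z) * A⁻ * B⁻)               ≈⟨ *-congˡ (solve 4 (λ a z u v → (con 1ℚ :+ a :- z) :* (con 1ℚ :+ a :- z) :* u :* v :=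
                                                            (a :- z) :* u :* ((con 1ℚ :+ (con 1ℚ :+ a) :- z) :* v) :+ con 1ℚ :* (u :* v)) refl A z A⁻ B⁻) ⟩
    q * ((A - z) * A⁻ * ((κ 1ℚ + (κ 1ℚ + A) - z) * B⁻) + κ 1ℚ * (A⁻ * B⁻))
      ≈⟨ *-congˡ (+-cong (*-cong (inv-law _) (trans (*-congʳ (+-congʳ (sym (trans (𝕟-suc _) (+-congˡ (𝕟-suc _)))))) (inv-law _)))
           (trans (*-congʳ κ-1) (*-identityˡ _))) ⟩
    q * (1# * 1# + A⁻ * B⁻)                             ≈⟨ *-congˡ (+-congʳ (*-identityˡ 1#)) ⟩
    q * (1# + A⁻ * B⁻)                                  ∎
    where
    open SetoidReasoning setoid
    q = κ (+ 4 / 1) * 𝕟 (suc i) * 𝕟 (suc (suc i)) * square (𝕨 (suc (suc (i ℕ.+ i))))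
    M = 𝕟 (suc (suc (i ℕ.+ i)))
    A = 𝕟 (suc (i ℕ.+ i))
    A⁻ = inv (i ℕ.+ i)
    B⁻ = inv (suc (suc (i ℕ.+ i)))

  rest : ℕ → ℕ → Carrier
  rest i zero    = 0#
  rest i (suc L) = rest i L + t i (suc L)

  ∑t-rest : ∀ i L → ∑t i (suc L) ≈ 1# + rest i L
  ∑t-rest i zero    = trans (+-identityˡ _) (trans (*-congʳ (reflexive (cong (λ n → 𝕟 (suc n)) (ℕ.+-identityʳ i))))
    (trans (𝕟*𝕨 i) (sym (+-identityʳ 1#))))
  ∑t-rest i (suc L) = trans (+-congʳ (∑t-rest i L)) (+-assoc _ _ _)

  -- Taking as many shifts as summands makes both the remainder on the left and the error on the
  -- right tend to 0. The factor `inv 0` = 1/(1 - z) converts the terms with i = 0 into those of the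
  -- generating function, see `inv*t`.
  balance : ∀ n → inv 0 * ∏σ (suc n) + inv 0 * (∏σ (suc n) * rest (suc n) n)
    ≈ inv 0 * ∑t 0 (suc n) + inv 0 * error (suc n) (suc n)
  balance n = begin
    inv 0 * ∏σ N + inv 0 * (∏σ N * rest N n)     ≈⟨ +-congʳ (*-congˡ (*-identityʳ (∏σ N))) ⟨
    inv 0 * (∏σ N * 1#) + inv 0 * (∏σ N * rest N n) ≈⟨ distribˡ (inv 0) _ _ ⟨
    inv 0 * (∏σ N * 1# + ∏σ N * rest N n)        ≈⟨ *-congˡ (distribˡ (∏σ N) _ _) ⟨
    inv 0 * (∏σ N * (1# + rest N n))             ≈⟨ *-congˡ (*-congˡ (∑t-rest N n)) ⟨
    inv 0 * (∏σ N * ∑t N N)                      ≈⟨ *-congˡ (∑t+error N N) ⟨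
    inv 0 * (∑t 0 N + error N N)                 ≈⟨ distribˡ (inv 0) _ _ ⟩
    inv 0 * ∑t 0 N + inv 0 * error N N           ∎
    where
    open SetoidReasoning setoid
    N = suc n

  Π : ℕ → Carrier
  Π zero    = 1#
  Π (suc j) = Π j * ((𝕟 (suc (j ℕ.+ j)) + z) * inv (j ℕ.+ j))

  -- For i = 0 the quotient (i+j+1)/(j+1) is 1 and the squares telescope to 1/(2j+1)². This leaves
  -- 1/(m (m - z)) ∏ (m′ + z)/(m′ - z) with m = 2j + 1 and m′ odd below m.
  inv*t : ∀ j → inv 0 * t 0 j ≈ 𝕨 (j ℕ.+ j) * inv (j ℕ.+ j) * Π j
  inv*t zero    = trans (*-congˡ (𝕟*𝕨 0)) (trans (drop _ refl) (sym (trans (drop _ refl) (trans (*-congʳ 𝕨0≈1) (*-identityˡ _)))))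
    where
    𝕨0≈1 : 𝕨 0 ≈ 1#
    𝕨0≈1 = trans (sym (*-identityˡ _)) (trans (*-congʳ (sym (trans (𝕟-suc 0) (trans (+-cong κ-1 (trans 𝕟-zero κ-0)) (+-identityʳ 1#))))) (𝕟*𝕨 0))
  inv*t (suc j) = begin
    inv 0 * (𝕟 (suc (suc j ℕ.+ suc j)) * (s 0 j * ratio 0 j))
      ≡⟨ cong₂ (λ m n → inv 0 * (𝕟 (suc m) * (s 0 j * (𝕟 (suc j) * square O * 𝕨 j * square (𝕨 n) * (O + z) * inv n)))) j+j+2≡ d≡ ⟩
    inv 0 * (𝕟 (suc m) * (s 0 j * (𝕟 (suc j) * square O * 𝕨 j * square (𝕨 m) * (O + z) * inv m)))
      ≈⟨ solve 9 (λ v q s b o y f o+z v′ → v :* (q :* (s :* (b :* (o :* o) :* y :* (f :* f) :* o+z :* v′))) :=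
           v :* (o :* s) :* (o :* f :* o+z :* v′) :* (b :* y) :* (q :* f)) refl
           (inv 0) (𝕟 (suc m)) (s 0 j) (𝕟 (suc j)) O (𝕨 j) (𝕨 m) (O + z) (inv m) ⟩
    inv 0 * (O * s 0 j) * (O * 𝕨 m * (O + z) * inv m) * (𝕟 (suc j) * 𝕨 j) * (𝕟 (suc m) * 𝕨 m)
      ≈⟨ trans (drop _ (𝕟*𝕨 m)) (drop _ (𝕟*𝕨 j)) ⟩
    inv 0 * (O * s 0 j) * (O * 𝕨 m * (O + z) * inv m)
      ≈⟨ *-congʳ (inv*t j) ⟩
    𝕨 (j ℕ.+ j) * inv (j ℕ.+ j) * Π j * (O * 𝕨 m * (O + z) * inv m)
      ≈⟨ solve 7 (λ u v p o f o+z v′ → u :* v :* p :* (o :* f :* o+z :* v′) := f :* v′ :* (p :* (o+z :* v)) :* (o :* u)) refl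
           (𝕨 (j ℕ.+ j)) (inv (j ℕ.+ j)) (Π j) O (𝕨 m) (O + z) (inv m) ⟩
    𝕨 m * inv m * (Π j * ((O + z) * inv (j ℕ.+ j))) * (O * 𝕨 (j ℕ.+ j))
      ≈⟨ drop _ (𝕟*𝕨 (j ℕ.+ j)) ⟩
    𝕨 m * inv m * Π (suc j)
      ≡⟨ cong (λ m → 𝕨 m * inv m * Π (suc j)) j+j+2≡ ⟨
    𝕨 (suc j ℕ.+ suc j) * inv (suc j ℕ.+ suc j) * Π (suc j) ∎
    where
    open SetoidReasoning setoid
    O = 𝕟 (suc (j ℕ.+ j))
    m = suc (suc (j ℕ.+ j))
    j+j+2≡ : suc j ℕ.+ suc j ≡ m
    j+j+2≡ = cong suc (ℕ.+-suc j j)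
    d≡ : d 0 j ≡ m
    d≡ = cong (λ n → suc (suc n)) (ℕ.+-identityʳ (j ℕ.+ j))

open PowerSeries

ι-* : ∀ m n → ι (m ℕ.* n) ≡ ι m ℚ.* ι n
ι-* zero    n = ≡.sym (ℚ.*-zeroˡ (ι n))
ι-* (suc m) n = ≡.trans (ι-+ n (m ℕ.* n)) (≡.trans (cong (ι n ℚ.+_) (ι-* m n))
  (≡.trans (solve 2 (λ m n → n :+ m :* n := (con 1ℚ :+ m) :* n) ≡.refl (ι m) (ι n))
    (cong (ℚ._* ι n) (≡.sym (ι-suc m)))))
  where open ℚ-Solver

ι-mono : ∀ {m n} → m ℕ.≤ n → ι m ℚ.≤ ι n
ι-mono {m} {n} m≤n = ≤-by (ι (n ℕ.∸ m)) (0≤ι (n ℕ.∸ m))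
  (≡.trans (cong ι (≡.sym (ℕ.m+[n∸m]≡n m≤n))) (ι-+ m (n ℕ.∸ m)))

0<ι-suc : ∀ n → 0ℚ ℚ.< ι (suc n)
0<ι-suc n = ℚ.<-≤-trans (ℚ.positive⁻¹ 1ℚ) (≤-by (ι n) (0≤ι n) (ι-suc n))

*-cancel-≤ : ∀ {p q r} → 0ℚ ℚ.< r → p ℚ.* r ℚ.≤ q ℚ.* r → p ℚ.≤ q
*-cancel-≤ {r = r} 0<r = ℚ.*-cancelʳ-≤-pos r {{ℚ.positive 0<r}}

-- Majorants: evaluation of nonnegative power series at 1/4

module Evaluation where
  open ℚ-Solver

  ¼ : ℚ
  ¼ = + 1 / 4

  0≤¼ : 0ℚ ℚ.≤ ¼
  0≤¼ = ℚ.nonNegative⁻¹ ¼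

  -- The partial sum of n terms at z = 1/4. A bound on f(1/4) is expressed as a bound on all partial
  -- sums.
  ev : ℕ → PS → ℚ
  ev zero    f = 0ℚ
  ev (suc n) f = f 0 ℚ.+ ¼ ℚ.* ev n (tail f)

  Nonneg : PS → Set
  Nonneg f = ∀ n → 0ℚ ℚ.≤ f n

  ev-cong : ∀ n {f g} → f ≋ g → ev n f ≡ ev n g
  ev-cong zero    f≋g = ≡.refl
  ev-cong (suc n) f≋g = cong₂ (λ x y → x ℚ.+ ¼ ℚ.* y) (f≋g 0) (ev-cong n (f≋g ∘ suc))

  ev-+ : ∀ n f g → ev n (f ⊞ g) ≡ ev n f ℚ.+ ev n g
  ev-+ zero    f g = ≡.refl
  ev-+ (suc n) f g = ≡.trans (cong (λ y → f 0 ℚ.+ g 0 ℚ.+ ¼ ℚ.* y) (ev-+ n (tail f) (tail g)))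
    (solve 5 (λ a b c d x → a :+ b :+ x :* (c :+ d) := a :+ x :* c :+ (b :+ x :* d)) ≡.refl (f 0) (g 0) (ev n (tail f)) (ev n (tail g)) ¼)

  ev-scale : ∀ n c f → ev n (λ i → c ℚ.* f i) ≡ c ℚ.* ev n f
  ev-scale zero    c f = ≡.sym (ℚ.*-zeroʳ c)
  ev-scale (suc n) c f = ≡.trans (cong (λ y → c ℚ.* f 0 ℚ.+ ¼ ℚ.* y) (ev-scale n c (tail f)))
    (solve 4 (λ c a b x → c :* a :+ x :* (c :* b) := c :* (a :+ x :* b)) ≡.refl c (f 0) (ev n (tail f)) ¼)

  ⊛-nonneg : ∀ {f g} → Nonneg f → Nonneg g → Nonneg (f ⊛ g)
  ⊛-nonneg 0≤f 0≤g zero    = *-mono-0≤ (0≤f 0) (0≤g 0)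
  ⊛-nonneg 0≤f 0≤g (suc n) = ℚ.+-mono-≤ (*-mono-0≤ (0≤f 0) (0≤g (suc n))) (⊛-nonneg (0≤f ∘ suc) 0≤g n)

  ev-nonneg : ∀ n {f} → Nonneg f → 0ℚ ℚ.≤ ev n f
  ev-nonneg zero    0≤f = ℚ.≤-refl
  ev-nonneg (suc n) 0≤f = ℚ.+-mono-≤ (0≤f 0) (*-mono-0≤ 0≤¼ (ev-nonneg n (0≤f ∘ suc)))

  -- Truncating the product discards nonnegative terms of the product of the truncations. The bound
  -- on g is assumed for all lengths because the length left for g depends on the coefficient of f;
  -- `b` and `G` are its cleared denominator and its numerator.
  ev-* : ∀ n f g {b G} → Nonneg f → Nonneg g → (∀ n → ev n g ℚ.* b ℚ.≤ G) → ev n (f ⊛ g) ℚ.* b ℚ.≤ ev n f ℚ.* G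
  ev-* zero    f g {b} {G} 0≤f 0≤g g≤G = ℚ.≤-reflexive (≡.trans (ℚ.*-zeroˡ b) (≡.sym (ℚ.*-zeroˡ G)))
  ev-* (suc n) f g {b} {G} 0≤f 0≤g g≤G = begin
    (f 0 ℚ.* g 0 ℚ.+ ¼ ℚ.* ev n (tail (f ⊛ g))) ℚ.* b
      ≡⟨ cong (λ y → (f 0 ℚ.* g 0 ℚ.+ ¼ ℚ.* y) ℚ.* b)
           (≡.trans (ev-+ n (λ i → f 0 ℚ.* g (suc i)) (tail f ⊛ g)) (cong (ℚ._+ ev n (tail f ⊛ g)) (ev-scale n (f 0) (tail g)))) ⟩
    (f 0 ℚ.* g 0 ℚ.+ ¼ ℚ.* (f 0 ℚ.* ev n (tail g) ℚ.+ ev n (tail f ⊛ g))) ℚ.* b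
      ≡⟨ solve 6 (λ a c x d e b → (a :* c :+ x :* (a :* d :+ e)) :* b := a :* ((c :+ x :* d) :* b) :+ x :* (e :* b))
           ≡.refl (f 0) (g 0) ¼ (ev n (tail g)) (ev n (tail f ⊛ g)) b ⟩
    f 0 ℚ.* (ev (suc n) g ℚ.* b) ℚ.+ ¼ ℚ.* (ev n (tail f ⊛ g) ℚ.* b)
      ≤⟨ ℚ.+-mono-≤ (*-monoˡ (0≤f 0) (g≤G (suc n))) (*-monoˡ 0≤¼ (ev-* n (tail f) g (0≤f ∘ suc) 0≤g g≤G)) ⟩
    f 0 ℚ.* G ℚ.+ ¼ ℚ.* (ev n (tail f) ℚ.* G)
      ≡⟨ solve 4 (λ a G x e → a :* G :+ x :* (e :* G) := (a :+ x :* e) :* G) ≡.refl (f 0) G ¼ (ev n (tail f)) ⟩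
    (f 0 ℚ.+ ¼ ℚ.* ev n (tail f)) ℚ.* G ∎
    where open ℚ.≤-Reasoning

  -- f has nonnegative coefficients and f(1/4) ≤ a/b
  infix 4 _≲_÷_
  record _≲_÷_ (f : PS) (a b : ℕ) : Set where
    constructor bound
    field
      nonneg  : Nonneg f
      nonzero : ℕ.NonZero b
      bounded : ∀ n → ev n f ℚ.* ι b ℚ.≤ ι a
  open _≲_÷_ public

  ≲-cong : ∀ {f g a b} → f ≋ g → f ≲ a ÷ b → g ≲ a ÷ b
  ≲-cong {b = b} f≋g (bound p b≢0 q) = bound (λ n → subst (0ℚ ℚ.≤_) (f≋g n) (p n)) b≢0 (λ n → subst (λ e → e ℚ.* ι b ℚ.≤ _) (ev-cong n f≋g) (q n))

  ≲-weaken : ∀ {f a b c d} .{{_ : ℕ.NonZero d}} → f ≲ a ÷ b → a ℕ.* d ℕ.≤ c ℕ.* b → f ≲ c ÷ d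
  ≲-weaken {f} {a} {suc b} {c} {d} {{d≢0}} (bound p _ q) ad≤cb = bound p (ℕ.≢-nonZero (ℕ.≢-nonZero⁻¹ d)) λ n → *-cancel-≤ (0<ι-suc b) (begin
    ev n f ℚ.* ι d ℚ.* ι (suc b)    ≡⟨ solve 3 (λ e d b → e :* d :* b := e :* b :* d) ≡.refl (ev n f) (ι d) (ι (suc b)) ⟩
    ev n f ℚ.* ι (suc b) ℚ.* ι d    ≤⟨ *-monoʳ (0≤ι d) (q n) ⟩
    ι a ℚ.* ι d                     ≡⟨ ι-* a d ⟨
    ι (a ℕ.* d)                     ≤⟨ ι-mono ad≤cb ⟩
    ι (c ℕ.* suc b)                 ≡⟨ ι-* c (suc b) ⟩
    ι c ℚ.* ι (suc b)               ∎)
    where open ℚ.≤-Reasoning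

  ≲-* : ∀ {f g a b c d} → f ≲ a ÷ b → g ≲ c ÷ d → f ⊛ g ≲ a ℕ.* c ÷ (b ℕ.* d)
  ≲-* {f} {g} {a} {b} {c} {d} (bound p b≢0 q) (bound p′ d≢0 q′) = bound (⊛-nonneg p p′) (ℕ.m*n≢0 b d {{b≢0}} {{d≢0}}) λ n → begin
    ev n (f ⊛ g) ℚ.* ι (b ℕ.* d)      ≡⟨ cong (ev n (f ⊛ g) ℚ.*_) (ι-* b d) ⟩
    ev n (f ⊛ g) ℚ.* (ι b ℚ.* ι d)    ≡⟨ solve 3 (λ e b d → e :* (b :* d) := e :* d :* b) ≡.refl (ev n (f ⊛ g)) (ι b) (ι d) ⟩
    ev n (f ⊛ g) ℚ.* ι d ℚ.* ι b      ≤⟨ *-monoʳ (0≤ι b) (ev-* n f g p p′ q′) ⟩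
    ev n f ℚ.* ι c ℚ.* ι b            ≡⟨ solve 3 (λ e c b → e :* c :* b := e :* b :* c) ≡.refl (ev n f) (ι c) (ι b) ⟩
    ev n f ℚ.* ι b ℚ.* ι c            ≤⟨ *-monoʳ (0≤ι c) (q n) ⟩
    ι a ℚ.* ι c                       ≡⟨ ι-* a c ⟨
    ι (a ℕ.* c)                       ∎
    where open ℚ.≤-Reasoning

  ≲-+ : ∀ {f g a b c d} → f ≲ a ÷ b → g ≲ c ÷ d → f ⊞ g ≲ a ℕ.* d ℕ.+ c ℕ.* b ÷ (b ℕ.* d)
  ≲-+ {f} {g} {a} {b} {c} {d} (bound p b≢0 q) (bound p′ d≢0 q′) = bound (λ n → ℚ.+-mono-≤ (p n) (p′ n)) (ℕ.m*n≢0 b d {{b≢0}} {{d≢0}}) λ n → begin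
    ev n (f ⊞ g) ℚ.* ι (b ℕ.* d)                        ≡⟨ cong₂ ℚ._*_ (ev-+ n f g) (ι-* b d) ⟩
    (ev n f ℚ.+ ev n g) ℚ.* (ι b ℚ.* ι d)               ≡⟨ solve 4 (λ e e′ b d → (e :+ e′) :* (b :* d) := e :* b :* d :+ e′ :* d :* b) ≡.refl (ev n f) (ev n g) (ι b) (ι d) ⟩
    ev n f ℚ.* ι b ℚ.* ι d ℚ.+ ev n g ℚ.* ι d ℚ.* ι b   ≤⟨ ℚ.+-mono-≤ (*-monoʳ (0≤ι d) (q n)) (*-monoʳ (0≤ι b) (q′ n)) ⟩
    ι a ℚ.* ι d ℚ.+ ι c ℚ.* ι b                         ≡⟨ cong₂ ℚ._+_ (ι-* a d) (ι-* c b) ⟨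
    ι (a ℕ.* d) ℚ.+ ι (c ℕ.* b)                         ≡⟨ ι-+ (a ℕ.* d) (c ℕ.* b) ⟨
    ι (a ℕ.* d ℕ.+ c ℕ.* b)                             ∎
    where open ℚ.≤-Reasoning

  ev-0 : ∀ n → ev n (λ _ → 0ℚ) ≡ 0ℚ
  ev-0 zero    = ≡.refl
  ev-0 (suc n) = cong (λ y → 0ℚ ℚ.+ ¼ ℚ.* y) (ev-0 n)

  ev-C≤ : ∀ n {q} → 0ℚ ℚ.≤ q → ev n (C q) ℚ.≤ q
  ev-C≤ zero    0≤q = 0≤q
  ev-C≤ (suc n) {q} 0≤q = ℚ.≤-reflexive (≡.trans (cong (λ y → q ℚ.+ ¼ ℚ.* y) (ev-0 n)) (ℚ.+-identityʳ q))

  ≲-C : ∀ {q a b} .{{_ : ℕ.NonZero b}} → 0ℚ ℚ.≤ q → q ℚ.* ι b ≡ ι a → C q ≲ a ÷ b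
  ≲-C {b = b} 0≤q eq = bound (λ { zero → 0≤q ; (suc n) → ℚ.≤-refl }) (ℕ.≢-nonZero (ℕ.≢-nonZero⁻¹ b))
    λ n → ℚ.≤-trans (*-monoʳ (0≤ι b) (ev-C≤ n 0≤q)) (ℚ.≤-reflexive eq)

  ≲-ι : ∀ n → C (ι n) ≲ n ÷ 1
  ≲-ι n = ≲-C (0≤ι n) (ℚ.*-identityʳ (ι n))

  ≲-w : ∀ n → C (w n) ≲ 1 ÷ suc n
  ≲-w n = ≲-C (0≤w n) (w*ι n)

  ≲-0 : (λ _ → 0ℚ) ≲ 0 ÷ 1
  ≲-0 = bound (λ _ → ℚ.≤-refl) _ λ n → ℚ.≤-reflexive (cong (ℚ._* 1ℚ) (ev-0 n))

  z : PS
  z 1 = 1ℚ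
  z _ = 0ℚ

  ≲-z : z ≲ 1 ÷ 4
  ≲-z = bound (λ { 0 → ℚ.≤-refl ; 1 → 0≤1 ; (suc (suc n)) → ℚ.≤-refl }) _ λ n →
    ℚ.≤-trans (*-monoʳ (0≤ι 4) (ev-z n)) (ℚ.≤-reflexive ≡.refl)
    where
    ev-z : ∀ n → ev n z ℚ.≤ ¼
    ev-z 0 = 0≤¼
    ev-z 1 = 0≤¼
    ev-z (suc (suc n)) = ℚ.≤-reflexive (cong (λ y → 0ℚ ℚ.+ ¼ ℚ.* (1ℚ ℚ.+ ¼ ℚ.* y)) (ev-0 n))

  -- 4⁻ⁿ fₙ is one of the nonnegative summands of f(1/4).
  coefficient-≤ : ∀ {f a b} → f ≲ a ÷ b → ∀ n → f n ℚ.* ι b ℚ.≤ ι (4 ℕ.^ n ℕ.* a)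
  coefficient-≤ {f} {a} {b} (bound p _ q) n = begin
    f n ℚ.* ι b                           ≤⟨ *-monoʳ (0≤ι b) (f≤ n p) ⟩
    ι (4 ℕ.^ n) ℚ.* ev (suc n) f ℚ.* ι b  ≡⟨ ℚ.*-assoc (ι (4 ℕ.^ n)) (ev (suc n) f) (ι b) ⟩
    ι (4 ℕ.^ n) ℚ.* (ev (suc n) f ℚ.* ι b) ≤⟨ *-monoˡ (0≤ι (4 ℕ.^ n)) (q (suc n)) ⟩
    ι (4 ℕ.^ n) ℚ.* ι a                   ≡⟨ ι-* (4 ℕ.^ n) a ⟨
    ι (4 ℕ.^ n ℕ.* a)                     ∎
    where
    open ℚ.≤-Reasoning
    f≤ : ∀ n {f} → Nonneg f → f n ℚ.≤ ι (4 ℕ.^ n) ℚ.* ev (suc n) f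
    f≤ zero    {f} p = ℚ.≤-reflexive (solve 1 (λ a → a := con 1ℚ :* (a :+ con ¼ :* con 0ℚ)) ≡.refl (f 0))
    f≤ (suc n) {f} p = ℚ.≤-trans (f≤ n (p ∘ suc)) (≤-by (ι (4 ℕ.^ suc n) ℚ.* f 0) (*-mono-0≤ (0≤ι (4 ℕ.^ suc n)) (p 0))
      (≡.trans (cong (ℚ._* ev (2 ℕ.+ n) f) (ι-* 4 (4 ℕ.^ n)))
        (≡.trans (solve 3 (λ k a e → con (+ 4 / 1) :* k :* (a :+ con ¼ :* e) := k :* e :+ con (+ 4 / 1) :* k :* a) ≡.refl
          (ι (4 ℕ.^ n)) (f 0) (ev (suc n) (tail f)))
          (cong (λ y → ι (4 ℕ.^ n) ℚ.* ev (suc n) (tail f) ℚ.+ y ℚ.* f 0) (≡.sym (ι-* 4 (4 ℕ.^ n)))))))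

  -- 1 / (m + 1 - z)
  inv : ℕ → PS
  inv m zero    = w m
  inv m (suc n) = w m ℚ.* inv m n

  -- 4/(4m + 3) is the value of 1/(m + 1 - z) at z = 1/4.
  ≲-inv : ∀ m → inv m ≲ 4 ÷ (3 ℕ.+ 4 ℕ.* m)
  ≲-inv m = bound nonneg-inv _ ev≤
    where
    nonneg-inv : Nonneg (inv m)
    nonneg-inv zero    = 0≤w m
    nonneg-inv (suc n) = *-mono-0≤ (0≤w m) (nonneg-inv n)
    open ℚ.≤-Reasoning
    b = ι (3 ℕ.+ 4 ℕ.* m)
    ev≤ : ∀ n → ev n (inv m) ℚ.* b ℚ.≤ ι 4
    ev≤ zero    = ℚ.≤-trans (ℚ.≤-reflexive (ℚ.*-zeroˡ b)) (0≤ι 4)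
    ev≤ (suc n) = begin
      (w m ℚ.+ ¼ ℚ.* ev n (tail (inv m))) ℚ.* b
        ≡⟨ cong (λ y → (w m ℚ.+ ¼ ℚ.* y) ℚ.* b) (ev-scale n (w m) (inv m)) ⟩
      (w m ℚ.+ ¼ ℚ.* (w m ℚ.* ev n (inv m))) ℚ.* b
        ≡⟨ solve 4 (λ v x e b → (v :+ x :* (v :* e)) :* b := v :* b :+ x :* v :* (e :* b)) ≡.refl (w m) ¼ (ev n (inv m)) b ⟩
      w m ℚ.* b ℚ.+ ¼ ℚ.* w m ℚ.* (ev n (inv m) ℚ.* b)
        ≤⟨ ℚ.+-monoʳ-≤ (w m ℚ.* b) (*-monoˡ (*-mono-0≤ 0≤¼ (0≤w m)) (ev≤ n)) ⟩
      w m ℚ.* b ℚ.+ ¼ ℚ.* w m ℚ.* ι 4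
        ≡⟨ cong (λ y → w m ℚ.* y ℚ.+ ¼ ℚ.* w m ℚ.* ι 4) (≡.trans (ι-+ 3 (4 ℕ.* m)) (cong (ι 3 ℚ.+_) (ι-* 4 m))) ⟩
      w m ℚ.* (ι 3 ℚ.+ ι 4 ℚ.* ι m) ℚ.+ ¼ ℚ.* w m ℚ.* ι 4
        ≡⟨ solve 2 (λ v m → v :* (con (+ 3 / 1) :+ con (+ 4 / 1) :* m) :+ con ¼ :* v :* con (+ 4 / 1) :=
             con (+ 4 / 1) :* (v :* (con 1ℚ :+ m))) ≡.refl (w m) (ι m) ⟩
      ι 4 ℚ.* (w m ℚ.* (1ℚ ℚ.+ ι m))
        ≡⟨ cong (λ y → ι 4 ℚ.* (w m ℚ.* y)) (ι-suc m) ⟨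
      ι 4 ℚ.* (w m ℚ.* ι (suc m))
        ≡⟨ cong (ι 4 ℚ.*_) (w*ι m) ⟩
      ι 4 ℚ.* 1ℚ ≡⟨ ℚ.*-identityʳ (ι 4) ⟩
      ι 4 ∎

open Evaluation

ι*w : ∀ n → ι (suc n) ℚ.* w n ≡ 1ℚ
ι*w n = ≡.trans (ℚ.*-comm (ι (suc n)) (w n)) (w*ι n)

C-cong : ∀ {p q} → p ≡ q → C p ≋ C q
C-cong ≡.refl n = ≡.refl

inv-law : ∀ m → (C (ι (suc m)) ⊞ ⊟ z) ⊛ inv m ≋ C 1ℚ
inv-law m zero    = ≡.trans (cong (ℚ._* w m) (ℚ.+-identityʳ (ι (suc m)))) (ι*w m)
inv-law m (suc n) = begin
  (ι (suc m) ℚ.+ ℚ.- 0ℚ) ℚ.* (w m ℚ.* inv m n) ℚ.+ (tail (C (ι (suc m)) ⊞ ⊟ z) ⊛ inv m) n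
    ≡⟨ cong₂ (λ x y → x ℚ.* (w m ℚ.* inv m n) ℚ.+ y) (ℚ.+-identityʳ (ι (suc m)))
         (≡.trans (⊛-cong {g = inv m} tail≋ (λ _ → ≡.refl) n) (C⊛ (ℚ.- 1ℚ) (inv m) n)) ⟩
  ι (suc m) ℚ.* (w m ℚ.* inv m n) ℚ.+ ℚ.- 1ℚ ℚ.* inv m n
    ≡⟨ solve 3 (λ i v x → i :* (v :* x) :+ con (ℚ.- 1ℚ) :* x := (v :* i :- con 1ℚ) :* x) ≡.refl (ι (suc m)) (w m) (inv m n) ⟩
  (w m ℚ.* ι (suc m) ℚ.- 1ℚ) ℚ.* inv m n
    ≡⟨ cong (λ x → (x ℚ.- 1ℚ) ℚ.* inv m n) (w*ι m) ⟩
  (1ℚ ℚ.- 1ℚ) ℚ.* inv m n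
    ≡⟨ ℚ.*-zeroˡ (inv m n) ⟩
  0ℚ ∎
  where
  open ≡.≡-Reasoning
  open ℚ-Solver
  tail≋ : tail (C (ι (suc m)) ⊞ ⊟ z) ≋ C (ℚ.- 1ℚ)
  tail≋ zero    = ≡.refl
  tail≋ (suc n) = ≡.refl

open module C-homo = _-Raw-AlmostCommutative⟶_ C-homomorphism public using () renaming (+-homo to C-+; *-homo to C-*)

dixonParameters : DixonParameters PowerSeries.ring C-homomorphism
dixonParameters = record
  { 𝕟       = C ∘ ι
  ; 𝕨       = C ∘ w
  ; 𝕟-zero  = λ _ → ≡.refl
  ; 𝕟-suc   = λ n k → ≡.trans (C-cong (ι-suc n) k) (C-+ 1ℚ (ι n) k)
  ; 𝕟*𝕨     = λ n k → ≡.trans (≡.sym (C-* (ι (suc n)) (w n) k)) (C-cong (ι*w n) k)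
  ; z       = z
  ; inv     = inv
  ; inv-law = inv-law
  }

module D = Dixon PowerSeries.ring C-homomorphism dixonParameters

-- Explicit bounds for the boundary terms and the remainder

module Bounds where
  open D
  open ℕ-Solver

  ≤-by-difference : ∀ {a b} c → b ≡ a ℕ.+ c → a ℕ.≤ b
  ≤-by-difference {a} c ≡.refl = ℕ.m≤m+n a c

  ≲-ratio : ∀ i j → ratio i j ≲ _ ÷ _
  ≲-ratio i j = ≲-* (≲-* (≲-* (≲-* (≲-* (≲-ι (suc (i ℕ.+ j))) (≲-* (≲-ι (suc (j ℕ.+ j))) (≲-ι (suc (j ℕ.+ j)))))
    (≲-w j)) (≲-* (≲-w (d i j)) (≲-w (d i j)))) (≲-+ (≲-ι (suc (j ℕ.+ j))) ≲-z)) (≲-inv (d i j))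

  private
    -- Syntactic copies of the numerators and denominators produced by `≲-*` and `≲-+`. An
    -- inequality a/b ≤ c/d becomes the polynomial identity c b = a d + e over ℕ; the witness e, in
    -- Horner form, is its proof because its coefficients are natural numbers.
    Fraction : ℕ → Set
    Fraction n = Polynomial n × Polynomial n

    _⊗_ _⊕_ : ∀ {n} → Fraction n → Fraction n → Fraction n
    (a , b) ⊗ (c , d) = a :* c , b :* d
    (a , b) ⊕ (c , d) = a :* d :+ c :* b , b :* d

    ιᶠ wᶠ invᶠ : ∀ {n} → Polynomial n → Fraction n
    ιᶠ a   = a , con 1
    wᶠ a   = con 1 , con 1 :+ a
    invᶠ m = con 4 , con 3 :+ con 4 :* m

    zᶠ : ∀ {n} → Fraction n
    zᶠ = con 1 , con 4

    ratioᶠ : ∀ {n} → Polynomial n → Polynomial n → Fraction n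
    ratioᶠ i j = ((((ιᶠ (con 1 :+ (i :+ j)) ⊗ (o ⊗ o)) ⊗ wᶠ j) ⊗ (wᶠ m ⊗ wᶠ m)) ⊗ (o ⊕ zᶠ)) ⊗ invᶠ m
      where
      o = ιᶠ (con 1 :+ (j :+ j))
      m = con 2 :+ ((j :+ j) :+ (i :+ i))

    difference : ∀ {n} → Fraction n → Fraction n → Polynomial n → Polynomial n × Polynomial n
    difference (a , b) (c , d) e = c :* b := a :* d :+ e

    rising₄ : ℕ → ℕ
    rising₄ j = (1 ℕ.+ j) ℕ.* (2 ℕ.+ j) ℕ.* (3 ℕ.+ j) ℕ.* (4 ℕ.+ j)

    rising₄ᵖ : ∀ {n} → Polynomial n → Polynomial n
    rising₄ᵖ j = (con 1 :+ j) :* (con 2 :+ j) :* (con 3 :+ j) :* (con 4 :+ j)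

  -- For parameter i the ratio is about 1 - (2i + 3 - z)/j, hence below 1 - 4/j once i ≥ 1. The form
  -- (1 + j)/(5 + j) is chosen because its products telescope to `rising₄`.
  ratio-≲ : ∀ i j → ratio (suc i) j ≲ 1 ℕ.+ j ÷ (5 ℕ.+ j)
  ratio-≲ i j = ≲-weaken (≲-ratio (suc i) j) (≤-by-difference _ (solve 2 (λ i j →
    difference (ratioᶠ (con 1 :+ i) j) (con 1 :+ j , con 5 :+ j)
      (((((con 128 :* j :+ con 256) :* j :+ con 128) :* i :+ (((con 384 :* j :+ con 1712) :* j :+ con 2272) :* j :+ con 944)) :* i
        :+ ((((con 256 :* j :+ con 1808) :* j :+ con 5328) :* j :+ con 5948) :* j :+ con 2220)) :* i
        :+ ((((con 96 :* j :+ con 1488) :* j :+ con 4600) :* j :+ con 4860) :* j :+ con 1700))) ≡.refl i j))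

  -- For i = 0 the ratio is only about 1 - (3 - z)/j. At z = 1/4 this is below 1 - (5/2)/j: two
  -- powers telescope, and the half power is left to the quotients (3 + 2j)/(4 + 2j).
  ratio₀-≲ : ∀ j → ratio 0 j ≲ (1 ℕ.+ j) ℕ.* (3 ℕ.+ 2 ℕ.* j) ÷ ((3 ℕ.+ j) ℕ.* (4 ℕ.+ 2 ℕ.* j))
  ratio₀-≲ j = ≲-weaken (≲-ratio 0 j) (≤-by-difference _ (solve 1 (λ j →
    difference (ratioᶠ (con 0) j) ((con 1 :+ j) :* (con 3 :+ con 2 :* j) , (con 3 :+ j) :* (con 4 :+ con 2 :* j))
      (((((con 64 :* j :+ con 1040) :* j :+ con 3872) :* j :+ con 5780) :* j :+ con 3832) :* j :+ con 948)) ≡.refl j))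

  s-≲ : ∀ i j → s (suc i) j ≲ 24 ÷ rising₄ j
  s-≲ i zero    = ≲-weaken (≲-w (suc i)) (≤-by-difference _ (solve 1 (λ i →
    difference (wᶠ (con 1 :+ i)) (con 24 , rising₄ᵖ (con 0)) (con 24 :* i :+ con 24)) ≡.refl i))
  s-≲ i (suc j) = ≲-weaken (≲-* (s-≲ i j) (ratio-≲ i j)) (≤-by-difference _ (solve 1 (λ j →
    difference ((con 24 , rising₄ᵖ j) ⊗ (con 1 :+ j , con 5 :+ j)) (con 24 , rising₄ᵖ (con 1 :+ j)) (con 0)) ≡.refl j))

  -- Numerator and denominator of the Wallis quotient ∏ (2i + 3)/(2i + 4), which decays like
  -- j^(-1/2).
  odds evens : ℕ → ℕ
  odds  zero    = 1
  odds  (suc j) = odds j ℕ.* (3 ℕ.+ 2 ℕ.* j)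
  evens zero    = 1
  evens (suc j) = evens j ℕ.* (4 ℕ.+ 2 ℕ.* j)

  evens≢0 : ∀ j → ℕ.NonZero (evens j)
  evens≢0 zero    = _
  evens≢0 (suc j) = ℕ.m*n≢0 (evens j) _ {{evens≢0 j}}

  s₀-≲ : ∀ j → s 0 j ≲ 2 ℕ.* odds j ÷ ((1 ℕ.+ j) ℕ.* (2 ℕ.+ j) ℕ.* evens j)
  s₀-≲ zero    = ≲-weaken (≲-w 0) ℕ.≤-refl
  s₀-≲ (suc j) = ≲-weaken {{ℕ.m*n≢0 ((2 ℕ.+ j) ℕ.* (3 ℕ.+ j)) (evens (suc j)) {{_}} {{evens≢0 (suc j)}}}} (≲-* (s₀-≲ j) (ratio₀-≲ j))
    (≤-by-difference _ (solve 3 (λ j o e →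
      difference ((con 2 :* o , (con 1 :+ j) :* (con 2 :+ j) :* e) ⊗ ((con 1 :+ j) :* (con 3 :+ con 2 :* j) , (con 3 :+ j) :* (con 4 :+ con 2 :* j)))
        (con 2 :* (o :* (con 3 :+ con 2 :* j)) , (con 2 :+ j) :* (con 3 :+ j) :* (e :* (con 4 :+ con 2 :* j))) (con 0)) ≡.refl
      j (odds j) (evens j)))

  ≲-1 : C 1ℚ ≲ 1 ÷ 1
  ≲-1 = ≲-ι 1

  ≲-H : ∀ i j {a b} → s i j ≲ a ÷ b → H i j ≲ _ ÷ _
  ≲-H i j s≲ = ≲-cong (λ n → ≡.sym (H-split i j n))
    (≲-* (≲-* s≲ (≲-ι j)) (≲-+ ≲-1 (≲-* (≲-ι (k i j)) (≲-inv (i ℕ.+ i)))))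

  private
    Hᶠ : ∀ {n} → Polynomial n → Polynomial n → Fraction n → Fraction n
    Hᶠ i j s = (s ⊗ ιᶠ j) ⊗ (ιᶠ (con 1) ⊕ (ιᶠ ((j :+ j) :+ (con 2 :+ (i :+ i))) ⊗ invᶠ (i :+ i)))

  H₀-≲ : ∀ L → H 0 L ≲ 8 ℕ.* odds L ÷ evens L
  H₀-≲ L = ≲-weaken {{evens≢0 L}} (≲-H 0 L (s₀-≲ L)) (≤-by-difference _ (solve 3 (λ L o e →
    difference (Hᶠ (con 0) L (con 2 :* o , (con 1 :+ L) :* (con 2 :+ L) :* e)) (con 8 :* o , e)
      (((con 8 :* e :* o) :* L :+ con 50 :* e :* o) :* L :+ con 48 :* e :* o)) ≡.refl L (odds L) (evens L)))

  H-factor-≲ : ∀ i L → suc i ℕ.≤ L → C 1ℚ ⊞ C (ι (k (suc i) L)) ⊛ inv (suc i ℕ.+ suc i) ≲ 2 ℕ.+ 2 ℕ.* L ÷ 1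
  H-factor-≲ i L i<L with ℕ.m≤n⇒∃[o]m+o≡n i<L
  ... | e , ≡.refl = ≲-weaken (≲-+ ≲-1 (≲-* (≲-ι (k (suc i) (suc (i ℕ.+ e)))) (≲-inv (suc i ℕ.+ suc i)))) (≤-by-difference _ (solve 2 (λ i e →
    let L = con 1 :+ (i :+ e) ; I = con 1 :+ i in
    difference (ιᶠ (con 1) ⊕ (ιᶠ ((L :+ L) :+ (con 2 :+ (I :+ I))) ⊗ invᶠ (I :+ I))) (con 2 :+ con 2 :* L , con 1)
      ((con 16 :* i :+ (con 16 :* e :+ con 30)) :* i :+ (con 14 :* e :+ con 9))) ≡.refl i e))

  -- Order L⁻⁴ from `s`, order L from the factor j and order L from the last factor give L⁻². At
  -- most L such terms occur, so their sum is still of order 1/L.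
  H-≲ : ∀ i L → suc i ℕ.≤ L → H (suc i) L ≲ 48 ÷ ((1 ℕ.+ L) ℕ.* (1 ℕ.+ L))
  H-≲ i L i<L = ≲-weaken (≲-cong (λ n → ≡.sym (H-split (suc i) L n)) (≲-* (≲-* (s-≲ i L) (≲-ι L)) (H-factor-≲ i L i<L)))
    (≤-by-difference _ (solve 1 (λ L →
      difference (((con 24 , rising₄ᵖ L) ⊗ ιᶠ L) ⊗ (con 2 :+ con 2 :* L , con 1)) (con 48 , (con 1 :+ L) :* (con 1 :+ L))
        (((con 336 :* L :+ con 1536) :* L :+ con 2352) :* L :+ con 1152)) ≡.refl L))

  -- The product of the σᵢ(1/4) stays below 2 - 1/(N + 1)
  ∏σ-≲ : ∀ N → ∏σ N ≲ 1 ℕ.+ 2 ℕ.* N ÷ (1 ℕ.+ N)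
  ∏σ-≲ zero    = ≲-1
  ∏σ-≲ (suc n) = ≲-weaken (≲-* (∏σ-≲ n) (≲-cong (λ k → ≡.sym (σ-split n k))
    (≲-* (≲-* (≲-* (≲-* (≲-ι 4) (≲-ι (suc n))) (≲-ι (suc (suc n)))) (≲-* (≲-w (suc (suc (n ℕ.+ n)))) (≲-w (suc (suc (n ℕ.+ n))))))
      (≲-+ ≲-1 (≲-* (≲-inv (n ℕ.+ n)) (≲-inv (suc (suc (n ℕ.+ n)))))))))
    (≤-by-difference _ (solve 1 (λ n → let m = n :+ n in
      difference ((con 1 :+ con 2 :* n , con 1 :+ n) ⊗
        ((((ιᶠ (con 4) ⊗ ιᶠ (con 1 :+ n)) ⊗ ιᶠ (con 2 :+ n)) ⊗ (wᶠ (con 2 :+ m) ⊗ wᶠ (con 2 :+ m))) ⊗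
          (ιᶠ (con 1) ⊕ (invᶠ m ⊗ invᶠ (con 2 :+ m)))))
        (con 1 :+ con 2 :* (con 1 :+ n) , con 2 :+ n)
        ((((con 256 :* n :+ con 1056) :* n :+ con 1462) :* n :+ con 769) :* n :+ con 107)) ≡.refl n))

  ∏σ-≲2 : ∀ N → ∏σ N ≲ 2 ÷ 1
  ∏σ-≲2 N = ≲-weaken (∏σ-≲ N) (≤-by-difference _ (solve 1 (λ n →
    difference (con 1 :+ con 2 :* n , con 1 :+ n) (con 2 , con 1) (con 1)) ≡.refl N))

  -- One factor 1/n comes from j = 0 and two more from the first ratio. All later ratios are below
  -- 1.
  s-suc-≲ : ∀ n j → s (suc n) (suc j) ≲ 1 ÷ (3 ℕ.* ((2 ℕ.+ n) ℕ.* (2 ℕ.+ n) ℕ.* (2 ℕ.+ n)))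
  s-suc-≲ n zero    = ≲-weaken (≲-* (≲-w (suc n)) (≲-ratio (suc n) 0)) (≤-by-difference _ (solve 1 (λ n →
    difference (wᶠ (con 1 :+ n) ⊗ ratioᶠ (con 1 :+ n) (con 0)) (con 1 , con 3 :* ((con 2 :+ n) :* (con 2 :+ n) :* (con 2 :+ n)))
      ((((con 68 :* n :+ con 720) :* n :+ con 2768) :* n :+ con 4620) :* n :+ con 2840)) ≡.refl n))
  s-suc-≲ n (suc j) = ≲-weaken (≲-* (s-suc-≲ n j) (ratio-≲ n (suc j))) (≤-by-difference _ (solve 2 (λ n j →
    let b = con 3 :* ((con 2 :+ n) :* (con 2 :+ n) :* (con 2 :+ n)) in
    difference ((con 1 , b) ⊗ (con 2 :+ j , con 6 :+ j)) (con 1 , b) (con 4 :* b)) ≡.refl n j))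

  lin-≲ : ∀ n j → j ℕ.≤ n → C (ι (suc (suc n ℕ.+ (suc j ℕ.+ suc j)))) ≲ 3 ℕ.* (2 ℕ.+ n) ÷ 1
  lin-≲ n j j≤n with ℕ.m≤n⇒∃[o]m+o≡n j≤n
  ... | e , ≡.refl = ≲-weaken (≲-ι (suc (suc (j ℕ.+ e) ℕ.+ (suc j ℕ.+ suc j)))) (≤-by-difference _ (solve 2 (λ j e →
    difference (ιᶠ (con 1 :+ ((con 1 :+ (j :+ e)) :+ ((con 1 :+ j) :+ (con 1 :+ j))))) (con 3 :* (con 2 :+ (j :+ e)) , con 1)
      (con 2 :* e :+ con 2)) ≡.refl j e))

  t-suc-≲ : ∀ n j → j ℕ.≤ n → t (suc n) (suc j) ≲ 1 ÷ ((2 ℕ.+ n) ℕ.* (2 ℕ.+ n))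
  t-suc-≲ n j j≤n = ≲-weaken (≲-* (lin-≲ n j j≤n) (s-suc-≲ n j)) (≤-by-difference _ (solve 1 (λ n → let N = con 2 :+ n in
    difference ((con 3 :* N , con 1) ⊗ (con 1 , con 3 :* (N :* N :* N))) (con 1 , N :* N) (con 0)) ≡.refl n))

  rest-≲ : ∀ n L → L ℕ.≤ suc n → rest (suc n) L ≲ L ÷ ((2 ℕ.+ n) ℕ.* (2 ℕ.+ n))
  rest-≲ n zero    _   = ≲-weaken ≲-0 ℕ.z≤n
  rest-≲ n (suc L) L≤n = ≲-weaken (≲-+ (rest-≲ n L (ℕ.≤-trans (ℕ.n≤1+n L) L≤n)) (t-suc-≲ n L (ℕ.≤-pred L≤n)))
    (≤-by-difference _ (solve 2 (λ n L → let b = (con 2 :+ n) :* (con 2 :+ n) in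
      difference ((L , b) ⊕ (con 1 , b)) (con 1 :+ L , b) (con 0)) ≡.refl n L))

  -- The boundary term for i = 0 contributes the Wallis quotient. Each of the other n contributes at
  -- most 2 · 48/(1 + L)², whence the constant 96.
  error-≲ : ∀ n L → n ℕ.≤ L → error (suc n) L ≲
    8 ℕ.* odds L ℕ.* ((1 ℕ.+ L) ℕ.* (1 ℕ.+ L)) ℕ.+ 96 ℕ.* n ℕ.* evens L ÷ (evens L ℕ.* ((1 ℕ.+ L) ℕ.* (1 ℕ.+ L)))
  error-≲ zero    L _   = ≲-weaken {{ℕ.m*n≢0 (evens L) _ {{evens≢0 L}}}} (≲-+ ≲-0 (≲-* ≲-1 (H₀-≲ L)))
    (≤-by-difference _ (solve 3 (λ L o e → let b = (con 1 :+ L) :* (con 1 :+ L) in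
      difference (ιᶠ (con 0) ⊕ (ιᶠ (con 1) ⊗ (con 8 :* o , e))) (con 8 :* o :* b :+ con 96 :* con 0 :* e , e :* b) (con 0))
      ≡.refl L (odds L) (evens L)))
  error-≲ (suc n) L n≤L = ≲-weaken {{ℕ.m*n≢0 (evens L) _ {{evens≢0 L}}}}
    (≲-+ (error-≲ n L (ℕ.≤-trans (ℕ.n≤1+n n) n≤L)) (≲-* (∏σ-≲2 (suc n)) (H-≲ n L n≤L)))
    (≤-by-difference _ (solve 4 (λ n L o e → let b = (con 1 :+ L) :* (con 1 :+ L) in
      difference ((con 8 :* o :* b :+ con 96 :* n :* e , e :* b) ⊕ ((con 2 , con 1) ⊗ (con 48 , b)))
        (con 8 :* o :* b :+ con 96 :* (con 1 :+ n) :* e , e :* b) (con 0)) ≡.refl n L (odds L) (evens L)))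

-- Null sequences and the limiting form of Dixon's theorem

record Null (x : ℕ → ℚ) : Set where
  constructor null
  field
    small : ∀ ε → 0ℚ ℚ.< ε → ∃ λ N → ∀ n → N ℕ.≤ n → ℚ.∣ x n ∣ ℚ.< ε
open Null public

module Limits where
  open Convergence using (w↓; w→0; w-step; P; 0≤P; u; 0≤u; cu→0)
  open ℚ-Solver
  open ℕ-Solver using () renaming (solve to solveℕ; _:*_ to _⊗_; _:+_ to _⊕_; con to 𝕜; _:=_ to _⊜_)

  p≤∣p∣ : ∀ p → p ℚ.≤ ℚ.∣ p ∣
  p≤∣p∣ p with ℚ.≤-total 0ℚ p
  ... | inj₁ 0≤p = ℚ.≤-reflexive (≡.sym (ℚ.0≤p⇒∣p∣≡p 0≤p))
  ... | inj₂ p≤0 = ℚ.≤-trans p≤0 (ℚ.0≤∣p∣ p)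

  Null-≤ : ∀ {x y} → (∀ n → ℚ.∣ x n ∣ ℚ.≤ ℚ.∣ y n ∣) → Null y → Null x
  Null-≤ x≤y y→0 = null λ ε 0<ε → let N , y<ε = small y→0 ε 0<ε in N , λ n n≥ → ℚ.≤-<-trans (x≤y n) (y<ε n n≥)

  Null-cong : ∀ {x y} → (∀ n → x n ≡ y n) → Null x → Null y
  Null-cong x≡y = Null-≤ (λ n → ℚ.≤-reflexive (cong ℚ.∣_∣ (≡.sym (x≡y n))))

  Null-0 : Null (λ _ → 0ℚ)
  Null-0 = null λ ε 0<ε → 0 , λ _ _ → 0<ε

  Null-+ : ∀ {x y} → Null x → Null y → Null (λ n → x n ℚ.+ y n)
  Null-+ {x} {y} x→0 y→0 = null λ ε 0<ε →
    let M , x<ε = small x→0 (½ ℚ.* ε) (*-mono-0< 0<½ 0<ε)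
        N , y<ε = small y→0 (½ ℚ.* ε) (*-mono-0< 0<½ 0<ε)
    in M ℕ.+ N , λ n n≥ → ℚ.≤-<-trans (ℚ.∣p+q∣≤∣p∣+∣q∣ (x n) (y n))
      (subst (ℚ.∣ x n ∣ ℚ.+ ℚ.∣ y n ∣ ℚ.<_) (≡.sym (halves ε))
        (ℚ.+-mono-< (x<ε n (ℕ.m+n≤o⇒m≤o M n≥)) (y<ε n (ℕ.m+n≤o⇒n≤o M n≥))))

  Null-neg : ∀ {x} → Null x → Null (λ n → ℚ.- x n)
  Null-neg {x} = Null-≤ (λ n → ℚ.≤-reflexive (ℚ.∣-p∣≡∣p∣ (x n)))

  Null-* : ∀ {x y : ℕ → ℚ} (B : ℚ) → (∃ λ N → ∀ n → N ℕ.≤ n → ℚ.∣ y n ∣ ℚ.≤ B) → Null x → Null (λ n → x n ℚ.* y n)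
  Null-* {x} {y} B (K , y≤B) x→0 = null λ ε 0<ε →
    let N , x<δ = small x→0 (ε ℚ.* ℚ.1/ B′) (*-mono-0< 0<ε (ℚ.positive⁻¹ (ℚ.1/ B′) {{ℚ.1/pos⇒pos B′}}))
    in K ℕ.+ N , λ n n≥ → ℚ.≤-<-trans (ℚ.≤-reflexive (ℚ.∣p*q∣≡∣p∣*∣q∣ (x n) (y n)))
      (ℚ.≤-<-trans (*-monoˡ (ℚ.0≤∣p∣ (x n)) (≤B′ n (ℕ.m+n≤o⇒m≤o K n≥)))
        (subst (ℚ.∣ x n ∣ ℚ.* B′ ℚ.<_)
          (≡.trans (ℚ.*-assoc ε (ℚ.1/ B′) B′) (≡.trans (cong (ε ℚ.*_) (ℚ.*-inverseˡ B′)) (ℚ.*-identityʳ ε)))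
          (ℚ.*-monoˡ-<-pos B′ (x<δ n (ℕ.m+n≤o⇒n≤o K n≥)))))
    where
    B′ : ℚ
    B′ = ℚ.∣ B ∣ ℚ.+ 1ℚ
    instance
      B′-positive : ℚ.Positive B′
      B′-positive = ℚ.positive (ℚ.+-mono-≤-< (ℚ.0≤∣p∣ B) (ℚ.positive⁻¹ 1ℚ))
      B′-nonZero : ℚ.NonZero B′
      B′-nonZero = ℚ.pos⇒nonZero B′
    ≤B′ : ∀ n → K ℕ.≤ n → ℚ.∣ y n ∣ ℚ.≤ B′
    ≤B′ n n≥ = ℚ.≤-trans (y≤B n n≥) (ℚ.≤-trans (p≤∣p∣ B) (≤-by 1ℚ 0≤1 ≡.refl))

  Null-scale : ∀ {x} c → Null x → Null (λ n → c ℚ.* x n)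
  Null-scale {x} c x→0 = Null-cong (λ n → ℚ.*-comm (x n) c) (Null-* ℚ.∣ c ∣ (0 , λ _ _ → ℚ.≤-refl) x→0)

  Null-∘ : ∀ {x} (f : ℕ → ℕ) → (∀ n → n ℕ.≤ f n) → Null x → Null (x ∘ f)
  Null-∘ f n≤f x→0 = null λ ε 0<ε → let N , x<ε = small x→0 ε 0<ε in N , λ n n≥ → x<ε (f n) (ℕ.≤-trans n≥ (n≤f n))

  Null-suc : ∀ {x} → Null (x ∘ suc) → Null x
  Null-suc {x} x→0 = null λ ε 0<ε → let N , x<ε = small x→0 ε 0<ε in suc N , λ { (suc n) (ℕ.s≤s n≥) → x<ε n n≥ }

  Null-antitone : ∀ {x} → (∀ n → 0ℚ ℚ.≤ x n) → (∀ n → x (suc n) ℚ.≤ x n) →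
    (∀ ε → 0ℚ ℚ.< ε → ∃ λ N → x N ℚ.< ε) → Null x
  Null-antitone {x} 0≤x x↓ x→0 = null λ ε 0<ε → let N , x<ε = x→0 ε 0<ε in N , λ n n≥ →
    subst (ℚ._< ε) (≡.sym (ℚ.0≤p⇒∣p∣≡p (0≤x n)))
      (ℚ.≤-<-trans (subst (λ m → x m ℚ.≤ x N) (ℕ.m+[n∸m]≡n n≥) (below N (n ℕ.∸ N))) x<ε)
    where
    below : ∀ N d → x (N ℕ.+ d) ℚ.≤ x N
    below N zero    = ℚ.≤-reflexive (cong x (ℕ.+-identityʳ N))
    below N (suc d) = ℚ.≤-trans (subst (λ m → x m ℚ.≤ x (N ℕ.+ d)) (≡.sym (ℕ.+-suc N d)) (x↓ (N ℕ.+ d))) (below N d)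

  w-Null : Null w
  w-Null = Null-antitone 0≤w w↓ w→0

  u↓ : ∀ n → u (suc n) ℚ.≤ u n
  u↓ n = ≤-by (½ ℚ.* (P n ℚ.* (w n ℚ.* w (suc n)))) (*-mono-0≤ (ℚ.<⇒≤ 0<½) (*-mono-0≤ (0≤P n) (*-mono-0≤ (0≤w n) (0≤w (suc n)))))
    (≡.trans (cong (P n ℚ.*_) (w-step n))
      (solve 3 (λ p x y → p :* (y :+ x :* y) := p :* (con 1ℚ :+ con ½ :* x) :* y :+ con ½ :* (p :* (x :* y))) ≡.refl (P n) (w n) (w (suc n))))

  u-Null : Null u
  u-Null = Null-antitone 0≤u u↓ λ ε 0<ε → let N , p = cu→0 1ℚ 0≤1 ε 0<ε in N , subst (ℚ._< ε) (ℚ.*-identityˡ (u N)) p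

  -- The Wallis quotient is the sequence `u` whose decay was established for the convergence of the
  -- t-values, so that estimate serves again.
  u*evens : ∀ n → u n ℚ.* ι (Bounds.evens n) ≡ ι (Bounds.odds n)
  u*evens zero    = ≡.refl
  u*evens (suc n) = begin
    P n ℚ.* (1ℚ ℚ.+ ½ ℚ.* w n) ℚ.* w (suc n) ℚ.* ι (E ℕ.* (4 ℕ.+ 2 ℕ.* n))
      ≡⟨ cong (P n ℚ.* (1ℚ ℚ.+ ½ ℚ.* w n) ℚ.* w (suc n) ℚ.*_) (≡.trans (ι-* E (4 ℕ.+ 2 ℕ.* n)) (cong (ι E ℚ.*_) 4+2n≡)) ⟩
    P n ℚ.* (1ℚ ℚ.+ ½ ℚ.* w n) ℚ.* w (suc n) ℚ.* (ι E ℚ.* (ι 2 ℚ.* ι (suc (suc n))))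
      ≡⟨ solve 5 (λ p x y e i → p :* (con 1ℚ :+ con ½ :* x) :* y :* (e :* (con (ι 2) :* i)) := p :* e :* ((con (ι 2) :+ x) :* (y :* i))) ≡.refl
           (P n) (w n) (w (suc n)) (ι E) (ι (suc (suc n))) ⟩
    P n ℚ.* ι E ℚ.* ((ι 2 ℚ.+ w n) ℚ.* (w (suc n) ℚ.* ι (suc (suc n))))
      ≡⟨ cong (λ y → P n ℚ.* ι E ℚ.* ((ι 2 ℚ.+ w n) ℚ.* y)) (w*ι (suc n)) ⟩
    P n ℚ.* ι E ℚ.* ((ι 2 ℚ.+ w n) ℚ.* 1ℚ)
      ≡⟨ cong (λ y → P n ℚ.* ι E ℚ.* y) (≡.trans (ℚ.*-identityʳ (ι 2 ℚ.+ w n)) 2+w≡) ⟩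
    P n ℚ.* ι E ℚ.* (w n ℚ.* ι (3 ℕ.+ 2 ℕ.* n))
      ≡⟨ solve 4 (λ p e x o → p :* e :* (x :* o) := p :* x :* e :* o) ≡.refl (P n) (ι E) (w n) (ι (3 ℕ.+ 2 ℕ.* n)) ⟩
    u n ℚ.* ι E ℚ.* ι (3 ℕ.+ 2 ℕ.* n)
      ≡⟨ cong (ℚ._* ι (3 ℕ.+ 2 ℕ.* n)) (u*evens n) ⟩
    ι (Bounds.odds n) ℚ.* ι (3 ℕ.+ 2 ℕ.* n)
      ≡⟨ ι-* (Bounds.odds n) (3 ℕ.+ 2 ℕ.* n) ⟨
    ι (Bounds.odds n ℕ.* (3 ℕ.+ 2 ℕ.* n)) ∎
    where
    open ≡.≡-Reasoning
    E = Bounds.evens n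
    4+2n≡ : ι (4 ℕ.+ 2 ℕ.* n) ≡ ι 2 ℚ.* ι (suc (suc n))
    4+2n≡ = ≡.trans (cong ι (solveℕ 1 (λ n → 𝕜 4 ⊕ 𝕜 2 ⊗ n ⊜ 𝕜 2 ⊗ (𝕜 2 ⊕ n)) ≡.refl n)) (ι-* 2 (suc (suc n)))
    2+w≡ : ι 2 ℚ.+ w n ≡ w n ℚ.* ι (3 ℕ.+ 2 ℕ.* n)
    2+w≡ = ≡.trans (cong (ℚ._+ w n) (≡.trans (≡.sym (ℚ.*-identityʳ (ι 2))) (cong (ι 2 ℚ.*_) (≡.sym (w*ι n)))))
      (≡.trans (cong (λ y → ι 2 ℚ.* (w n ℚ.* y) ℚ.+ w n) (ι-suc n))
      (≡.trans (solve 2 (λ x i → con (ι 2) :* (x :* (con 1ℚ :+ i)) :+ x := x :* (con (ι 3) :+ con (ι 2) :* i)) ≡.refl (w n) (ι n))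
        (cong (w n ℚ.*_) (≡.sym (≡.trans (ι-+ 3 (2 ℕ.* n)) (cong (ι 3 ℚ.+_) (ι-* 2 n)))))))

  coefficient-≤′ : ∀ {f a b} q → f ≲ a ÷ b → ι a ≡ q ℚ.* ι b → ∀ k → f k ℚ.≤ ι (4 ℕ.^ k) ℚ.* q
  coefficient-≤′ {f} {a} {suc b} q f≲ a≡ k = *-cancel-≤ (0<ι-suc b) (ℚ.≤-trans (coefficient-≤ f≲ k)
    (ℚ.≤-reflexive (≡.trans (ι-* (4 ℕ.^ k) a) (≡.trans (cong (ι (4 ℕ.^ k) ℚ.*_) a≡) (≡.sym (ℚ.*-assoc (ι (4 ℕ.^ k)) q (ι (suc b))))))))
  coefficient-≤′ {b = zero} q (bound _ () _)

  ∣nonneg∣≤ : ∀ {p q} → 0ℚ ℚ.≤ p → p ℚ.≤ q → ℚ.∣ p ∣ ℚ.≤ ℚ.∣ q ∣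
  ∣nonneg∣≤ {p} {q} 0≤p p≤q = subst (ℚ._≤ ℚ.∣ q ∣) (≡.sym (ℚ.0≤p⇒∣p∣≡p 0≤p)) (ℚ.≤-trans p≤q (p≤∣p∣ q))

  open D using (error; rest; ∏σ; ∑t; balance)
  open Bounds using (odds; evens; evens≢0; ≤-by-difference; error-≲; rest-≲; ∏σ-≲2)

  error-Null : ∀ k → Null (λ n → (inv 0 ⊛ error (suc n) (suc n)) k)
  error-Null k = Null-≤ (λ n → ∣nonneg∣≤ (nonneg (error-≲′ n) k) (coefficient-≤′ (q n) (error-≲′ n) (q≡ n) k))
    (Null-scale (ι (4 ℕ.^ k)) (Null-+ (Null-scale (ι 11) (Null-∘ suc ℕ.n≤1+n u-Null)) (Null-scale (ι 128) (Null-∘ suc ℕ.n≤1+n w-Null))))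
    where
    q : ℕ → ℚ
    q n = ι 11 ℚ.* u (suc n) ℚ.+ ι 128 ℚ.* w (suc n)
    -- At z = 1/4 the factor `inv 0` is 4/3. Here 4/3 · 8 is below 11, and 4/3 · 96 is 128.
    error-≲′ : ∀ n → inv 0 ⊛ error (suc n) (suc n) ≲
      11 ℕ.* odds (suc n) ℕ.* (2 ℕ.+ n) ℕ.+ 128 ℕ.* evens (suc n) ÷ (evens (suc n) ℕ.* (2 ℕ.+ n))
    error-≲′ n = ≲-weaken {{ℕ.m*n≢0 (evens (suc n)) _ {{evens≢0 (suc n)}}}} (≲-* (≲-inv 0) (error-≲ n (suc n) (ℕ.n≤1+n n)))
      (≤-by-difference _ (solveℕ 3 (λ n o e → let N = 𝕜 2 ⊕ n ; b = N ⊗ N in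
        (𝕜 11 ⊗ o ⊗ N ⊕ 𝕜 128 ⊗ e) ⊗ (𝕜 3 ⊗ (e ⊗ b)) ⊜
        𝕜 4 ⊗ (𝕜 8 ⊗ o ⊗ b ⊕ 𝕜 96 ⊗ n ⊗ e) ⊗ (e ⊗ N) ⊕ (o ⊗ e ⊗ N ⊗ N ⊗ N ⊕ 𝕜 768 ⊗ e ⊗ e ⊗ N)) ≡.refl n (odds (suc n)) (evens (suc n))))
    q≡ : ∀ n → ι (11 ℕ.* odds (suc n) ℕ.* (2 ℕ.+ n) ℕ.+ 128 ℕ.* evens (suc n)) ≡ q n ℚ.* ι (evens (suc n) ℕ.* (2 ℕ.+ n))
    q≡ n = begin
      ι (11 ℕ.* O ℕ.* N ℕ.+ 128 ℕ.* E)                       ≡⟨ ι-+ (11 ℕ.* O ℕ.* N) (128 ℕ.* E) ⟩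
      ι (11 ℕ.* O ℕ.* N) ℚ.+ ι (128 ℕ.* E)                   ≡⟨ cong₂ ℚ._+_ (≡.trans (ι-* (11 ℕ.* O) N) (cong (ℚ._* ι N) (ι-* 11 O))) (ι-* 128 E) ⟩
      ι 11 ℚ.* ι O ℚ.* ι N ℚ.+ ι 128 ℚ.* ι E                 ≡⟨ cong₂ (λ x y → ι 11 ℚ.* x ℚ.* ι N ℚ.+ ι 128 ℚ.* y) (≡.sym (u*evens (suc n)))
                                                                  (≡.trans (≡.sym (ℚ.*-identityʳ (ι E))) (cong (ι E ℚ.*_) (≡.sym (w*ι (suc n))))) ⟩
      ι 11 ℚ.* (u (suc n) ℚ.* ι E) ℚ.* ι N ℚ.+ ι 128 ℚ.* (ι E ℚ.* (w (suc n) ℚ.* ι N))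
        ≡⟨ solve 6 (λ c d u e n w → c :* (u :* e) :* n :+ d :* (e :* (w :* n)) := (c :* u :+ d :* w) :* (e :* n)) ≡.refl
             (ι 11) (ι 128) (u (suc n)) (ι E) (ι N) (w (suc n)) ⟩
      q n ℚ.* (ι E ℚ.* ι N)                                  ≡⟨ cong (q n ℚ.*_) (ι-* E N) ⟨
      q n ℚ.* ι (E ℕ.* N)                                    ∎
      where
      open ≡.≡-Reasoning
      O = odds (suc n)
      E = evens (suc n)
      N = 2 ℕ.+ n

  rest-Null : ∀ k → Null (λ n → (inv 0 ⊛ (∏σ (suc n) ⊛ rest (suc n) n)) k)
  rest-Null k = Null-≤ (λ n → ∣nonneg∣≤ (nonneg (rest-≲′ n) k) (coefficient-≤′ (ι 3 ℚ.* w (suc n)) (rest-≲′ n) (q≡ n) k))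
    (Null-scale (ι (4 ℕ.^ k)) (Null-scale (ι 3) (Null-∘ suc ℕ.n≤1+n w-Null)))
    where
    rest-≲′ : ∀ n → inv 0 ⊛ (∏σ (suc n) ⊛ rest (suc n) n) ≲ 3 ÷ (2 ℕ.+ n)
    rest-≲′ n = ≲-weaken (≲-* (≲-inv 0) (≲-* (∏σ-≲2 (suc n)) (rest-≲ n n (ℕ.n≤1+n n))))
      (≤-by-difference _ (solveℕ 1 (λ n → let N = 𝕜 2 ⊕ n in
        𝕜 3 ⊗ (𝕜 3 ⊗ (𝕜 1 ⊗ (N ⊗ N))) ⊜ 𝕜 4 ⊗ (𝕜 2 ⊗ n) ⊗ N ⊕ (n ⊕ 𝕜 18) ⊗ N) ≡.refl n))
    q≡ : ∀ n → ι 3 ≡ ι 3 ℚ.* w (suc n) ℚ.* ι (2 ℕ.+ n)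
    q≡ n = ≡.trans (≡.trans (≡.sym (ℚ.*-identityʳ (ι 3))) (cong (ι 3 ℚ.*_) (≡.sym (w*ι (suc n))))) (≡.sym (ℚ.*-assoc (ι 3) (w (suc n)) (ι (2 ℕ.+ n))))

  -- Dixon's summation for each coefficient. Product and truncated series are compared as sequences,
  -- since neither limit is known at this point.
  ∏σ-∑t-Null : ∀ k → Null (λ N → (inv 0 ⊛ ∏σ N) k ℚ.- (inv 0 ⊛ ∑t 0 N) k)
  ∏σ-∑t-Null k = Null-suc (Null-cong (λ n → ≡.sym (begin
    a n ℚ.- c n                       ≡⟨ solve 3 (λ a b c → a :- c := (a :+ b) :- b :- c) ≡.refl (a n) (b n) (c n) ⟩
    a n ℚ.+ b n ℚ.- b n ℚ.- c n       ≡⟨ cong (λ y → y ℚ.- b n ℚ.- c n) (balance n k) ⟩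
    c n ℚ.+ e n ℚ.- b n ℚ.- c n       ≡⟨ solve 3 (λ b c e → c :+ e :- b :- c := e :+ :- b) ≡.refl (b n) (c n) (e n) ⟩
    e n ℚ.+ ℚ.- b n                   ∎))
    (Null-+ (error-Null k) (Null-neg (rest-Null k))))
    where
    open ≡.≡-Reasoning
    a b c e : ℕ → ℚ
    a n = (inv 0 ⊛ ∏σ (suc n)) k
    b n = (inv 0 ⊛ (∏σ (suc n) ⊛ rest (suc n) n)) k
    c n = (inv 0 ⊛ ∑t 0 (suc n)) k
    e n = (inv 0 ⊛ error (suc n) (suc n)) k

-- Finite sums over lists in a commutative ring

module Sums (R : CommutativeRing 0ℓ 0ℓ) where
  open CommutativeRing R hiding (zero)
  open Finite rawRing public using (∑; ∏)

  ∑-cong : ∀ {A : Set} (xs : List A) {f g : A → Carrier} → (∀ x → f x ≈ g x) → ∑ xs f ≈ ∑ xs g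
  ∑-cong []       f≈g = refl
  ∑-cong (x ∷ xs) f≈g = +-cong (f≈g x) (∑-cong xs f≈g)

  ∑-++ : ∀ {A : Set} (xs ys : List A) (f : A → Carrier) → ∑ (xs ++ ys) f ≈ ∑ xs f + ∑ ys f
  ∑-++ []       ys f = sym (+-identityˡ _)
  ∑-++ (x ∷ xs) ys f = trans (+-congˡ (∑-++ xs ys f)) (sym (+-assoc _ _ _))

  ∑-map : ∀ {A B : Set} (h : A → B) (xs : List A) (f : B → Carrier) → ∑ (map h xs) f ≈ ∑ xs (f ∘ h)
  ∑-map h []       f = refl
  ∑-map h (x ∷ xs) f = +-congˡ (∑-map h xs f)

  ∑-concatMap : ∀ {A B : Set} (h : A → List B) (xs : List A) (f : B → Carrier) →
    ∑ (concatMap h xs) f ≈ ∑ xs (λ x → ∑ (h x) f)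
  ∑-concatMap h []       f = refl
  ∑-concatMap h (x ∷ xs) f = trans (∑-++ (h x) (concatMap h xs) f) (+-congˡ (∑-concatMap h xs f))

  ∑-*ˡ : ∀ {A : Set} c (xs : List A) (f : A → Carrier) → ∑ xs (λ x → c * f x) ≈ c * ∑ xs f
  ∑-*ˡ c []       f = sym (zeroʳ c)
  ∑-*ˡ c (x ∷ xs) f = trans (+-congˡ (∑-*ˡ c xs f)) (sym (distribˡ c _ _))

  ∑-+ : ∀ {A : Set} (xs : List A) (f g : A → Carrier) → ∑ xs (λ x → f x + g x) ≈ ∑ xs f + ∑ xs g
  ∑-+ []       f g = sym (+-identityˡ 0#)
  ∑-+ (x ∷ xs) f g = trans (+-congˡ (∑-+ xs f g)) (trans (+-assoc _ _ _)
    (trans (+-congˡ (trans (sym (+-assoc _ _ _)) (trans (+-congʳ (+-comm _ _)) (+-assoc _ _ _)))) (sym (+-assoc _ _ _))))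

  ∑-0 : ∀ {A : Set} (xs : List A) {f : A → Carrier} → (∀ x → f x ≈ 0#) → ∑ xs f ≈ 0#
  ∑-0 []       f≈0 = refl
  ∑-0 (x ∷ xs) f≈0 = trans (+-cong (f≈0 x) (∑-0 xs f≈0)) (+-identityˡ 0#)

  ∑-upTo-suc : ∀ n (f : ℕ → Carrier) → ∑ (upTo (suc n)) f ≈ f 0 + ∑ (upTo n) (f ∘ suc)
  ∑-upTo-suc n f = +-congˡ (trans (reflexive (cong (λ xs → ∑ xs f) (≡.sym (List.map-upTo suc n)))) (∑-map suc (upTo n) f))

  ∑-upTo-last : ∀ n (f : ℕ → Carrier) → ∑ (upTo (suc n)) f ≈ ∑ (upTo n) f + f n
  ∑-upTo-last n f = trans (reflexive (cong (λ xs → ∑ xs f) (≡.sym (List.upTo-∷ʳ n))))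
    (trans (∑-++ (upTo n) (n ∷ []) f) (+-congˡ (+-identityʳ (f n))))

  ∑-All : ∀ {A : Set} {xs : List A} {f g : A → Carrier} → All (λ x → f x ≈ g x) xs → ∑ xs f ≈ ∑ xs g
  ∑-All []           = refl
  ∑-All (f≈g ∷ f≈gs) = +-cong f≈g (∑-All f≈gs)

  ∑-swap : ∀ {A B : Set} (xs : List A) (ys : List B) (f : A → B → Carrier) →
    ∑ xs (λ x → ∑ ys (f x)) ≈ ∑ ys (λ y → ∑ xs (λ x → f x y))
  ∑-swap []       ys f = sym (∑-0 ys (λ _ → refl))
  ∑-swap (x ∷ xs) ys f = trans (+-congˡ (∑-swap xs ys f)) (sym (∑-+ ys (f x) (λ y → ∑ xs (λ x → f x y))))

-- Logarithmic derivatives of power series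

record DerivationOf (R : CommutativeRing 0ℓ 0ℓ) (h : ℚ.+-*-rawRing -Raw-AlmostCommutative⟶ fromCommutativeRing R) : Set where
  open ℚ-Algebra R h
  field
    θ      : Carrier → Carrier
    θ-cong : ∀ {x y} → x ≈ y → θ x ≈ θ y
    θ-+    : ∀ x y → θ (x + y) ≈ θ x + θ y
    θ-*    : ∀ x y → θ (x * y) ≈ θ x * y + x * θ y
    θ-κ    : ∀ c → θ (κ c) ≈ 0#

module Derivation (R : CommutativeRing 0ℓ 0ℓ) (h : ℚ.+-*-rawRing -Raw-AlmostCommutative⟶ fromCommutativeRing R)
  (derivation : DerivationOf R h) where
  open ℚ-Algebra R h
  open DerivationOf derivation
  open Solver

  infix 4 _HasLogDerivative_
  -- Stated without division, so that no inverse of x has to be constructed.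
  _HasLogDerivative_ : Carrier → Carrier → Set
  x HasLogDerivative p = θ x ≈ p * x

  *-logDerivative : ∀ {x y p q} → x HasLogDerivative p → y HasLogDerivative q → x * y HasLogDerivative p + q
  *-logDerivative {x} {y} {p} {q} dx dy = trans (θ-* x y) (trans (+-cong (*-congʳ dx) (*-congˡ dy))
    (solve 4 (λ x y p q → p :* x :* y :+ x :* (q :* y) := (p :+ q) :* (x :* y)) refl x y p q))

  κ-logDerivative : ∀ c → κ c HasLogDerivative 0#
  κ-logDerivative c = trans (θ-κ c) (sym (zeroˡ (κ c)))

  logDerivative-cong : ∀ {x p} q → x HasLogDerivative p → q ≈ p → x HasLogDerivative q
  logDerivative-cong q dx q≈p = trans dx (*-congʳ (sym q≈p))

  module _ {z c v : Carrier} (θz : θ z ≈ z) (θc : θ c ≈ 0#) (inverse : (c - z) * v ≈ 1#) where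
    θ[c-z] : θ (c - z) ≈ - z
    θ[c-z] = trans (θ-+ c (- z)) (trans (+-cong θc θ-neg) (+-identityˡ _))
      where
      θ-neg : θ (- z) ≈ - z
      θ-neg = trans (θ-cong (solve 1 (λ z → :- z := con (ℚ.- 1ℚ) :* z) refl z))
        (trans (θ-* (κ (ℚ.- 1ℚ)) z) (trans (+-cong (*-congʳ (θ-κ _)) (*-congˡ θz))
          (trans (+-congʳ (zeroˡ z)) (trans (+-identityˡ _) (solve 1 (λ z → con (ℚ.- 1ℚ) :* z := :- z) refl z)))))

    linear-logDerivative : c - z HasLogDerivative - (z * v)
    linear-logDerivative = trans θ[c-z] (sym (trans (solve 3 (λ c z v → :- (z :* v) :* (c :- z) := :- z :* ((c :- z) :* v)) refl c z v)
      (trans (*-congˡ inverse) (*-identityʳ _))))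

    inverse-logDerivative : v HasLogDerivative z * v
    inverse-logDerivative = begin
      θ v                                  ≈⟨ *-identityʳ _ ⟨
      θ v * 1#                             ≈⟨ *-congˡ inverse ⟨
      θ v * ((c - z) * v)                  ≈⟨ solve 3 (λ t a v → t :* (a :* v) := (:- (con 0ℚ) :+ a :* t) :* v) refl (θ v) (c - z) v ⟩
      -- Adding and subtracting z v completes the derivative of (c - z) v = 1, which vanishes.
      (- κ 0ℚ + (c - z) * θ v) * v         ≈⟨ solve 4 (λ t a v z → (:- con 0ℚ :+ a :* t) :* v := (:- z :* v :+ a :* t) :* v :+ z :* v :* v) refl (θ v) (c - z) v z ⟩
      (- z * v + (c - z) * θ v) * v + z * v * v ≈⟨ +-congʳ (*-congʳ zero′) ⟩
      0# * v + z * v * v                   ≈⟨ trans (+-congʳ (zeroˡ v)) (+-identityˡ _) ⟩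
      z * v * v                            ∎
      where
      open SetoidReasoning setoid
      zero′ : - z * v + (c - z) * θ v ≈ 0#
      zero′ = trans (+-congʳ (*-congʳ (sym θ[c-z]))) (trans (sym (θ-* (c - z) v)) (trans (θ-cong (trans inverse (sym κ-1))) (θ-κ 1ℚ)))

module θ-Derivation where
  open ℚ-Solver

  -- The derivation z d/dz. Unlike d/dz it keeps every coefficient at its index.
  θ : PS → PS
  θ f n = ι n ℚ.* f n

  θ-cong : ∀ {f g} → f ≋ g → θ f ≋ θ g
  θ-cong f≋g n = cong (ι n ℚ.*_) (f≋g n)

  θ-+ : ∀ f g → θ (f ⊞ g) ≋ θ f ⊞ θ g
  θ-+ f g n = ℚ.*-distribˡ-+ (ι n) (f n) (g n)

  tail-θ : ∀ f → tail (θ f) ≋ tail f ⊞ θ (tail f)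
  tail-θ f n = ≡.trans (cong (ℚ._* f (suc n)) (ι-suc n))
    (solve 2 (λ i x → (con 1ℚ :+ i) :* x := x :+ i :* x) ≡.refl (ι n) (f (suc n)))

  θ-* : ∀ f g → θ (f ⊛ g) ≋ θ f ⊛ g ⊞ f ⊛ θ g
  θ-* f g zero    = solve 2 (λ a b → con 0ℚ :* (a :* b) := con 0ℚ :* a :* b :+ a :* (con 0ℚ :* b)) ≡.refl (f 0) (g 0)
  θ-* f g (suc n) = begin
    ι (suc n) ℚ.* (f 0 ℚ.* g (suc n) ℚ.+ x)
      ≡⟨ cong (ℚ._* (f 0 ℚ.* g (suc n) ℚ.+ x)) (ι-suc n) ⟩
    (1ℚ ℚ.+ ι n) ℚ.* (f 0 ℚ.* g (suc n) ℚ.+ x)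
      ≡⟨ solve 4 (λ i a b x → (con 1ℚ :+ i) :* (a :* b :+ x) := con 0ℚ :* a :* b :+ x :+ (a :* ((con 1ℚ :+ i) :* b)) :+ i :* x) ≡.refl (ι n) (f 0) (g (suc n)) x ⟩
    0ℚ ℚ.* f 0 ℚ.* g (suc n) ℚ.+ x ℚ.+ f 0 ℚ.* ((1ℚ ℚ.+ ι n) ℚ.* g (suc n)) ℚ.+ ι n ℚ.* x
      ≡⟨ cong₂ (λ i y → 0ℚ ℚ.* f 0 ℚ.* g (suc n) ℚ.+ x ℚ.+ f 0 ℚ.* (i ℚ.* g (suc n)) ℚ.+ y) (≡.sym (ι-suc n)) (θ-* (tail f) g n) ⟩
    0ℚ ℚ.* f 0 ℚ.* g (suc n) ℚ.+ x ℚ.+ f 0 ℚ.* θ g (suc n) ℚ.+ (y₁ ℚ.+ y₂)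
      ≡⟨ solve 5 (λ a x b y₁ y₂ → a :+ x :+ b :+ (y₁ :+ y₂) := a :+ (x :+ y₁) :+ (b :+ y₂)) ≡.refl (0ℚ ℚ.* f 0 ℚ.* g (suc n)) x (f 0 ℚ.* θ g (suc n)) y₁ y₂ ⟩
    0ℚ ℚ.* f 0 ℚ.* g (suc n) ℚ.+ (x ℚ.+ y₁) ℚ.+ (f 0 ℚ.* θ g (suc n) ℚ.+ y₂)
      ≡⟨ cong (λ y → 0ℚ ℚ.* f 0 ℚ.* g (suc n) ℚ.+ y ℚ.+ (f 0 ℚ.* θ g (suc n) ℚ.+ y₂))
           (≡.trans (≡.sym (⊛-distribʳ g (tail f) (θ (tail f)) n)) (⊛-cong {g = g} (λ i → ≡.sym (tail-θ f i)) (λ _ → ≡.refl) n)) ⟩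
    0ℚ ℚ.* f 0 ℚ.* g (suc n) ℚ.+ (tail (θ f) ⊛ g) n ℚ.+ (f 0 ℚ.* θ g (suc n) ℚ.+ y₂) ∎
    where
    open ≡.≡-Reasoning
    x  = (tail f ⊛ g) n
    y₁ = (θ (tail f) ⊛ g) n
    y₂ = (tail f ⊛ θ g) n

  θ-C : ∀ c → θ (C c) ≋ (λ _ → 0ℚ)
  θ-C c zero    = ℚ.*-zeroˡ c
  θ-C c (suc n) = ℚ.*-zeroʳ (ι (suc n))

  θ-z : θ z ≋ z
  θ-z 0 = ≡.refl
  θ-z 1 = ≡.refl
  θ-z (suc (suc n)) = ℚ.*-zeroʳ (ι (suc (suc n)))

  z-d/dz : DerivationOf PowerSeries.ring C-homomorphism
  z-d/dz = record { θ = θ ; θ-cong = θ-cong ; θ-+ = θ-+ ; θ-* = θ-* ; θ-κ = θ-C }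

  open Derivation PowerSeries.ring C-homomorphism z-d/dz public

  ⊛-local : ∀ f {g g′} n → (∀ i → i ℕ.≤ n → g i ≡ g′ i) → (f ⊛ g) n ≡ (f ⊛ g′) n
  ⊛-local f zero    g≡ = cong (f 0 ℚ.*_) (g≡ 0 ℕ.z≤n)
  ⊛-local f (suc n) g≡ = cong₂ (λ x y → f 0 ℚ.* x ℚ.+ y) (g≡ (suc n) ℕ.≤-refl)
    (⊛-local (tail f) n (λ i i≤n → g≡ i (ℕ.≤-trans i≤n (ℕ.n≤1+n n))))

  ⊛-0 : ∀ f n → (f ⊛ (λ _ → 0ℚ)) n ≡ 0ℚ
  ⊛-0 f zero    = ℚ.*-zeroʳ (f 0)
  ⊛-0 f (suc n) = cong₂ ℚ._+_ (ℚ.*-zeroʳ (f 0)) (⊛-0 (tail f) n)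

  ι-suc-cancel : ∀ n {x y} → ι (suc n) ℚ.* x ≡ ι (suc n) ℚ.* y → x ≡ y
  ι-suc-cancel n {x} {y} eq = ≡.trans (≡.sym (undo x)) (≡.trans (cong (w n ℚ.*_) eq) (undo y))
    where
    undo : ∀ x → w n ℚ.* (ι (suc n) ℚ.* x) ≡ x
    undo x = ≡.trans (≡.sym (ℚ.*-assoc (w n) (ι (suc n)) x)) (≡.trans (cong (ℚ._* x) (w*ι n)) (ℚ.*-identityˡ x))

  -- As p has no constant term, θ f = p f is a recurrence: it gives (n + 1) fₙ₊₁ in terms of f₀,
  -- ..., fₙ. Hence f₀ determines f.
  logDerivative-unique : ∀ {f g p} → p 0 ≡ 0ℚ → f HasLogDerivative p → g HasLogDerivative p → f 0 ≡ g 0 → f ≋ g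
  logDerivative-unique {f} {g} {p} p0≡0 df dg f0≡g0 n = upTo≤ n n ℕ.≤-refl
    where
    recurrence : ∀ {f} → f HasLogDerivative p → ∀ n → ι (suc n) ℚ.* f (suc n) ≡ (tail p ⊛ f) n
    recurrence {f} df n = ≡.trans (df (suc n)) (≡.trans (cong (λ x → x ℚ.* f (suc n) ℚ.+ (tail p ⊛ f) n) p0≡0)
      (≡.trans (cong (ℚ._+ (tail p ⊛ f) n) (ℚ.*-zeroˡ (f (suc n)))) (ℚ.+-identityˡ _)))
    upTo≤ : ∀ n i → i ℕ.≤ n → f i ≡ g i
    upTo≤ n       zero    _           = f0≡g0
    upTo≤ (suc n) (suc i) (ℕ.s≤s i≤n) = ι-suc-cancel i (≡.trans (recurrence df i)
      (≡.trans (⊛-local (tail p) i (λ j j≤i → upTo≤ n j (ℕ.≤-trans j≤i i≤n))) (≡.sym (recurrence dg i))))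

module LogDerivativeOfProduct where
  open θ-Derivation
  open D using (σ; ∏σ)

  -- the power series ∑ (m + 1)⁻ⁿ zⁿ over n ≥ 1
  powers : ℕ → PS
  powers m = z ⊛ inv m

  -- The logarithmic derivative of `inv 0 ⊛ D.∏σ N`. Neighbouring σ share an odd denominator, so the
  -- terms z/(m - z) occur with sign + for odd m and - for even m, all twice except the last odd one
  -- m = 2N + 1.
  P : ℕ → PS
  P zero    = powers 0
  P (suc N) = P N ⊞ ((powers (N ℕ.+ N) ⊞ powers (suc (suc (N ℕ.+ N)))) ⊞ (⊟ powers (suc (N ℕ.+ N)) ⊞ ⊟ powers (suc (N ℕ.+ N))))

  private
    θ-ι : ∀ m → θ (C (ι (suc m))) ≋ (λ _ → 0ℚ)
    θ-ι m = θ-C (ι (suc m))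

  σ-logDerivative : ∀ i → σ i HasLogDerivative
    (powers (i ℕ.+ i) ⊞ powers (suc (suc (i ℕ.+ i)))) ⊞ (⊟ powers (suc (i ℕ.+ i)) ⊞ ⊟ powers (suc (i ℕ.+ i)))
  σ-logDerivative i = logDerivative-cong _
    (*-logDerivative (*-logDerivative (*-logDerivative (*-logDerivative (*-logDerivative (*-logDerivative
      (κ-logDerivative (ι 4)) (κ-logDerivative (ι (suc i)))) (κ-logDerivative (ι (suc (suc i)))))
      (*-logDerivative (κ-logDerivative (w (suc (suc (i ℕ.+ i))))) (κ-logDerivative (w (suc (suc (i ℕ.+ i)))))))
      (*-logDerivative (lin (suc (i ℕ.+ i))) (lin (suc (i ℕ.+ i))))) (inv′ (i ℕ.+ i))) (inv′ (suc (suc (i ℕ.+ i)))))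
    (λ n → solve 3 (λ a b c → (a :+ b) :+ (c :+ c) := con 0ℚ :+ con 0ℚ :+ con 0ℚ :+ (con 0ℚ :+ con 0ℚ) :+ (c :+ c) :+ a :+ b) ≡.refl
      (powers (i ℕ.+ i) n) (powers (suc (suc (i ℕ.+ i))) n) (ℚ.- powers (suc (i ℕ.+ i)) n))
    where
    open ℚ-Solver
    lin : ∀ m → (C (ι (suc m)) ⊞ ⊟ z) HasLogDerivative ⊟ powers m
    lin m = linear-logDerivative θ-z (θ-ι m) (inv-law m)
    inv′ : ∀ m → inv m HasLogDerivative powers m
    inv′ m = inverse-logDerivative θ-z (θ-ι m) (inv-law m)

  ∏σ-logDerivative : ∀ N → inv 0 ⊛ ∏σ N HasLogDerivative P N
  ∏σ-logDerivative zero    = logDerivative-cong _ (*-logDerivative (inverse-logDerivative θ-z (θ-ι 0) (inv-law 0)) (κ-logDerivative 1ℚ))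
    (λ n → ≡.sym (ℚ.+-identityʳ (powers 0 n)))
  ∏σ-logDerivative (suc N) = λ n → ≡.trans (θ-cong (λ k → ≡.sym (⊛-assoc (inv 0) (∏σ N) (σ N) k)) n)
    (≡.trans (*-logDerivative (∏σ-logDerivative N) (σ-logDerivative N) n)
      (⊛-cong {f = P (suc N)} (λ _ → ≡.refl) (⊛-assoc (inv 0) (∏σ N) (σ N)) n))

  P-0 : ∀ N → P N 0 ≡ 0ℚ
  P-0 zero    = ≡.refl
  P-0 (suc N) rewrite P-0 N | ℚ.*-zeroˡ (inv (N ℕ.+ N) 0) | ℚ.*-zeroˡ (inv (suc (suc (N ℕ.+ N))) 0)
    | ℚ.*-zeroˡ (inv (suc (N ℕ.+ N)) 0) = ≡.refl

  powers-suc : ∀ m i → powers m (suc i) ≡ inv m i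
  powers-suc m i = ≡.trans (cong₂ ℚ._+_ (ℚ.*-zeroˡ (inv m (suc i)))
    (≡.trans (⊛-cong {g = inv m} tail-z (λ _ → ≡.refl) i) (≡.trans (C⊛ 1ℚ (inv m) i) (ℚ.*-identityˡ (inv m i))))) (ℚ.+-identityˡ (inv m i))
    where
    tail-z : tail z ≋ C 1ℚ
    tail-z zero    = ≡.refl
    tail-z (suc n) = ≡.refl

  P-suc : ∀ N i → P (suc N) (suc i) ≡ P N (suc i) ℚ.+ ((inv (N ℕ.+ N) i ℚ.+ inv (suc (suc (N ℕ.+ N))) i) ℚ.+
    (ℚ.- inv (suc (N ℕ.+ N)) i ℚ.+ ℚ.- inv (suc (N ℕ.+ N)) i))
  P-suc N i = cong (P N (suc i) ℚ.+_) (cong₂ ℚ._+_ (cong₂ ℚ._+_ (powers-suc (N ℕ.+ N) i) (powers-suc (suc (suc (N ℕ.+ N))) i))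
    (cong₂ ℚ._+_ (cong ℚ.-_ (powers-suc (suc (N ℕ.+ N)) i)) (cong ℚ.-_ (powers-suc (suc (N ℕ.+ N)) i))))

open import Defs using (Part; parts; tuples; solutions; tPartial; Index; entries; dep; contractions; _⊕_; I₀)

module ℚF = Finite ℚ.+-*-rawRing
module ℚ-Sums = Sums ℚ.+-*-commutativeRing

-- Exponentials as sums over the tuples of the right-hand side

module Exponential where
  open ℚ-Solver
  open θ-Derivation
  open ℚ-Sums
  open ℚF using (_^_)

  ⊛-∑ : ∀ f g n → (f ⊛ g) n ≡ ∑ (upTo (suc n)) (λ i → f i ℚ.* g (n ∸ i))
  ⊛-∑ f g zero    = ≡.sym (ℚ.+-identityʳ (f 0 ℚ.* g 0))
  ⊛-∑ f g (suc n) = ≡.trans (cong (f 0 ℚ.* g (suc n) ℚ.+_) (⊛-∑ (tail f) g n))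
    (≡.sym (∑-upTo-suc (suc n) (λ i → f i ℚ.* g (suc n ∸ i))))

  -- fᵐ / m!
  term : PS → ℕ → PS
  term f zero    = C 1ℚ
  term f (suc m) = C (w m) ⊛ (f ⊛ term f m)

  terms : PS → ℕ → PS
  terms f zero    = term f 0
  terms f (suc m) = terms f m ⊞ term f (suc m)

  -- For f without constant term, fᵐ starts at zᵐ, so coefficient n is already final in the partial
  -- sum up to m = n.
  exp : PS → PS
  exp f n = terms f n n

  module _ {f : PS} (f0≡0 : f 0 ≡ 0ℚ) where
    f⊛-vanish : ∀ g n → (∀ i → i ℕ.< n → g i ≡ 0ℚ) → (f ⊛ g) n ≡ 0ℚ
    f⊛-vanish g zero    _  = ≡.trans (cong (ℚ._* g 0) f0≡0) (ℚ.*-zeroˡ (g 0))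
    f⊛-vanish g (suc n) g≡ = ≡.trans (cong₂ ℚ._+_ (≡.trans (cong (ℚ._* g (suc n)) f0≡0) (ℚ.*-zeroˡ (g (suc n))))
      (≡.trans (⊛-local (tail f) n (λ i i≤n → g≡ i (ℕ.s≤s i≤n))) (⊛-0 (tail f) n))) ≡.refl

    term-vanish : ∀ m n → n ℕ.< m → term f m n ≡ 0ℚ
    term-vanish (suc m) n (ℕ.s≤s n≤m) = ≡.trans (C⊛ (w m) (f ⊛ term f m) n)
      (≡.trans (cong (w m ℚ.*_) (f⊛-vanish (term f m) n (λ i i<n → term-vanish m i (ℕ.<-≤-trans i<n n≤m)))) (ℚ.*-zeroʳ (w m)))

    terms-stable : ∀ n d → terms f (n ℕ.+ d) n ≡ exp f n
    terms-stable n zero    = cong (λ m → terms f m n) (ℕ.+-identityʳ n)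
    terms-stable n (suc d) = ≡.trans (cong (λ m → terms f m n) (ℕ.+-suc n d))
      (≡.trans (cong (terms f (n ℕ.+ d) n ℚ.+_) (term-vanish (suc (n ℕ.+ d)) n (ℕ.s≤s (ℕ.m≤m+n n d))))
        (≡.trans (ℚ.+-identityʳ (terms f (n ℕ.+ d) n)) (terms-stable n d)))

    terms≡exp : ∀ n m → n ℕ.≤ m → terms f m n ≡ exp f n
    terms≡exp n m n≤m = ≡.trans (cong (λ k → terms f k n) (≡.sym (ℕ.m+[n∸m]≡n n≤m))) (terms-stable n (m ∸ n))

    θ-term : ∀ m → θ (term f (suc m)) ≋ θ f ⊛ term f m
    θ-term m n = ≡.trans (θ-cong (C⊛ (w m) (f ⊛ term f m)) n)
      (≡.trans (solve 3 (λ i w x → i :* (w :* x) := w :* (i :* x)) ≡.refl (ι n) (w m) ((f ⊛ term f m) n))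
      (≡.trans (cong (w m ℚ.*_) (≡.trans (θ-* f (term f m) n) (sum m)))
        (≡.trans (≡.sym (ℚ.*-assoc (w m) (ι (suc m)) ((θ f ⊛ term f m) n)))
          (≡.trans (cong (ℚ._* (θ f ⊛ term f m) n) (w*ι m)) (ℚ.*-identityˡ ((θ f ⊛ term f m) n))))))
      where
      sum : ∀ m → (θ f ⊛ term f m) n ℚ.+ (f ⊛ θ (term f m)) n ≡ ι (suc m) ℚ.* (θ f ⊛ term f m) n
      sum zero = ≡.trans (cong (λ y → (θ f ⊛ C 1ℚ) n ℚ.+ y) (≡.trans (⊛-cong {f} {f} (λ _ → ≡.refl) (θ-C 1ℚ) n) (⊛-0 f n)))
        (≡.trans (ℚ.+-identityʳ ((θ f ⊛ C 1ℚ) n)) (≡.sym (ℚ.*-identityˡ ((θ f ⊛ C 1ℚ) n))))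
      sum (suc m) = ≡.trans (cong (y ℚ.+_) (≡.trans (⊛-cong {f} {f} (λ _ → ≡.refl) (θ-term m) n) swap))
        (≡.trans (solve 2 (λ i y → y :+ i :* y := (con 1ℚ :+ i) :* y) ≡.refl (ι (suc m)) y) (cong (ℚ._* y) (≡.sym (ι-suc (suc m)))))
        where
        y = (θ f ⊛ term f (suc m)) n
        X = θ f ⊛ (f ⊛ term f m)
        swap : (f ⊛ (θ f ⊛ term f m)) n ≡ ι (suc m) ℚ.* y
        swap = ≡.trans (≡.trans (≡.sym (⊛-assoc f (θ f) (term f m) n))
            (≡.trans (⊛-cong {g = term f m} (⊛-comm f (θ f)) (λ _ → ≡.refl) n) (⊛-assoc (θ f) f (term f m) n)))
          (≡.sym (≡.trans (cong (ι (suc m) ℚ.*_) y≡)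
            (≡.trans (≡.sym (ℚ.*-assoc (ι (suc m)) (w m) (X n)))
              (≡.trans (cong (ℚ._* X n) (ι*w m)) (ℚ.*-identityˡ (X n))))))
          where
          y≡ : y ≡ w m ℚ.* X n
          y≡ = ≡.trans (≡.sym (⊛-assoc (θ f) (C (w m)) (f ⊛ term f m) n))
            (≡.trans (⊛-cong {g = f ⊛ term f m} (⊛-comm (θ f) (C (w m))) (λ _ → ≡.refl) n)
              (≡.trans (⊛-assoc (C (w m)) (θ f) (f ⊛ term f m) n) (C⊛ (w m) X n)))

    θ-terms : ∀ m → θ (terms f (suc m)) ≋ θ f ⊛ terms f m
    θ-terms zero    n = ≡.trans (θ-+ (C 1ℚ) (term f 1) n) (≡.trans (cong₂ ℚ._+_ (θ-C 1ℚ n) (θ-term 0 n)) (ℚ.+-identityˡ ((θ f ⊛ term f 0) n)))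
    θ-terms (suc m) n = ≡.trans (θ-+ (terms f (suc m)) (term f (suc (suc m))) n)
      (≡.trans (cong₂ ℚ._+_ (θ-terms m n) (θ-term (suc m) n)) (≡.sym (⊛-distribˡ (θ f) (terms f m) (term f (suc m)) n)))

    exp-logDerivative : exp f HasLogDerivative θ f
    exp-logDerivative zero    = ≡.trans (ℚ.*-zeroˡ 1ℚ) (≡.sym (≡.trans (cong (ℚ._* 1ℚ) (ℚ.*-zeroˡ (f 0))) (ℚ.*-zeroˡ 1ℚ)))
    exp-logDerivative (suc n) = ≡.trans (θ-terms n (suc n)) (cong₂ ℚ._+_
      (≡.trans (zero-first (terms f n (suc n))) (≡.sym (zero-first (exp f (suc n)))))
      (⊛-local (tail (θ f)) n (λ i i≤n → terms≡exp i n i≤n)))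
      where
      zero-first : ∀ x → θ f 0 ℚ.* x ≡ 0ℚ
      zero-first x = ≡.trans (cong (ℚ._* x) (ℚ.*-zeroˡ (f 0))) (ℚ.*-zeroˡ x)

  factorial⁻¹ : ℕ → ℚ
  factorial⁻¹ zero    = 1ℚ
  factorial⁻¹ (suc n) = w n ℚ.* factorial⁻¹ n

  z⊛-suc : ∀ f n → (z ⊛ f) (suc n) ≡ f n
  z⊛-suc f n = ≡.trans (cong₂ ℚ._+_ (ℚ.*-zeroˡ (f (suc n)))
    (≡.trans (⊛-cong {g = f} tail-z (λ _ → ≡.refl) n) (≡.trans (C⊛ 1ℚ f n) (ℚ.*-identityˡ (f n))))) (ℚ.+-identityˡ (f n))
    where
    tail-z : tail z ≋ C 1ℚ
    tail-z zero    = ≡.refl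
    tail-z (suc n) = ≡.refl

  module _ (A : ℚ) where
    private
      f = C A ⊛ z

    linear-0 : f 0 ≡ 0ℚ
    linear-0 = ℚ.*-zeroʳ A

    linear-⊛ : ∀ g n → (f ⊛ g) (suc n) ≡ A ℚ.* g n
    linear-⊛ g n = ≡.trans (⊛-assoc (C A) z g (suc n)) (≡.trans (C⊛ A (z ⊛ g) (suc n)) (cong (A ℚ.*_) (z⊛-suc g n)))

    linear-term : ∀ n → term f n n ≡ factorial⁻¹ n ℚ.* A ^ n
    linear-term zero    = ≡.refl
    linear-term (suc n) = ≡.trans (C⊛ (w n) (f ⊛ term f n) (suc n)) (≡.trans (cong (w n ℚ.*_) (≡.trans (linear-⊛ (term f n) n) (cong (A ℚ.*_) (linear-term n))))
      (solve 4 (λ w a k p → w :* (a :* (k :* p)) := w :* k :* (a :* p)) ≡.refl (w n) A (factorial⁻¹ n) (A ^ n)))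

    linear-term-vanish : ∀ m n → m ℕ.< n → term f m n ≡ 0ℚ
    linear-term-vanish zero    (suc n) _           = ≡.refl
    linear-term-vanish (suc m) (suc n) (ℕ.s≤s m<n) = ≡.trans (C⊛ (w m) (f ⊛ term f m) (suc n))
      (≡.trans (cong (w m ℚ.*_) (≡.trans (linear-⊛ (term f m) n) (≡.trans (cong (A ℚ.*_) (linear-term-vanish m n m<n)) (ℚ.*-zeroʳ A)))) (ℚ.*-zeroʳ (w m)))

    linear-terms-vanish : ∀ m n → m ℕ.< n → terms f m n ≡ 0ℚ
    linear-terms-vanish zero    n m<n = linear-term-vanish 0 n m<n
    linear-terms-vanish (suc m) n m<n = cong₂ ℚ._+_ (linear-terms-vanish m n (ℕ.<-trans (ℕ.n<1+n m) m<n)) (linear-term-vanish (suc m) n m<n)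

    exp-linear : ∀ n → exp f n ≡ factorial⁻¹ n ℚ.* A ^ n
    exp-linear zero    = linear-term 0
    exp-linear (suc n) = ≡.trans (cong (ℚ._+ term f (suc n) (suc n)) (linear-terms-vanish n (suc n) (ℕ.n<1+n n)))
      (≡.trans (ℚ.+-identityˡ (term f (suc n) (suc n))) (linear-term (suc n)))

  terms-∑ : ∀ f m n → terms f m n ≡ ∑ (upTo (suc m)) (λ i → term f i n)
  terms-∑ f zero    n = ≡.sym (ℚ.+-identityʳ (term f 0 n))
  terms-∑ f (suc m) n = ≡.trans (cong (ℚ._+ term f (suc m) n) (terms-∑ f m n)) (≡.sym (∑-upTo-last (suc m) (λ i → term f i n)))

  module _ (b : ℕ → ℚ) where
    f₂ : PS
    f₂ 0 = 0ℚ
    f₂ 1 = 0ℚ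
    f₂ n = b n

    ∏b : List (Part 1) → ℚ
    ∏b ns = ∏ ns (b ∘ proj₁)

    -- Expanding the m-th power of `f₂` chooses one exponent ≥ 2 in each factor, which is an
    -- m-tuple. The factorial undoes the division built into `term`.
    tuples-sum : ∀ m v → ∑ (tuples 1 v m) ∏b ≡ (term f₂ m v) ℚ.* ι (m ℕ.!)
    tuples-sum zero    zero    = ≡.refl
    tuples-sum zero    (suc v) = ≡.refl
    tuples-sum (suc m) v = begin
      ∑ (tuples 1 v (suc m)) ∏b
        ≡⟨ cong (λ xs → ∑ xs ∏b) (unfold v) ⟩
      ∑ (concatMap (λ k → map (k ∷_) (tuples 1 (v ∸ proj₁ k) m)) (parts 1 v)) ∏b
        ≡⟨ ∑-concatMap _ (parts 1 v) ∏b ⟩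
      ∑ (parts 1 v) (λ k → ∑ (map (k ∷_) (tuples 1 (v ∸ proj₁ k) m)) ∏b)
        ≡⟨ ∑-cong (parts 1 v) (λ k → ≡.trans (∑-map (k ∷_) (tuples 1 (v ∸ proj₁ k) m) ∏b)
             (≡.trans (∑-*ˡ (b (proj₁ k)) (tuples 1 (v ∸ proj₁ k) m) ∏b)
               (cong (b (proj₁ k) ℚ.*_) (tuples-sum m (v ∸ proj₁ k))))) ⟩
      ∑ (parts 1 v) (λ k → b (proj₁ k) ℚ.* (term f₂ m (v ∸ proj₁ k) ℚ.* ι (m ℕ.!)))
        ≡⟨ ∑-map _ (upTo (v ∸ 1)) _ ⟩
      ∑ (upTo (v ∸ 1)) (λ i → b (2 ℕ.+ i) ℚ.* (term f₂ m (v ∸ (2 ℕ.+ i)) ℚ.* ι (m ℕ.!)))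
        ≡⟨ ∑-cong (upTo (v ∸ 1)) (λ i → solve 3 (λ x y z → x :* (y :* z) := z :* (x :* y)) ≡.refl (b (2 ℕ.+ i)) (term f₂ m (v ∸ (2 ℕ.+ i))) (ι (m ℕ.!))) ⟩
      ∑ (upTo (v ∸ 1)) (λ i → ι (m ℕ.!) ℚ.* (b (2 ℕ.+ i) ℚ.* term f₂ m (v ∸ (2 ℕ.+ i))))
        ≡⟨ ∑-*ˡ (ι (m ℕ.!)) (upTo (v ∸ 1)) _ ⟩
      ι (m ℕ.!) ℚ.* ∑ (upTo (v ∸ 1)) (λ i → b (2 ℕ.+ i) ℚ.* term f₂ m (v ∸ (2 ℕ.+ i)))
        ≡⟨ cong (ι (m ℕ.!) ℚ.*_) (convolution v) ⟩
      ι (m ℕ.!) ℚ.* (f₂ ⊛ term f₂ m) v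
        ≡⟨ cong (ι (m ℕ.!) ℚ.*_) (≡.trans (≡.sym (ℚ.*-identityˡ ((f₂ ⊛ term f₂ m) v))) (cong (ℚ._* (f₂ ⊛ term f₂ m) v) (≡.sym (w*ι m)))) ⟩
      ι (m ℕ.!) ℚ.* (w m ℚ.* ι (suc m) ℚ.* (f₂ ⊛ term f₂ m) v)
        ≡⟨ solve 4 (λ k w i x → k :* (w :* i :* x) := w :* x :* (i :* k)) ≡.refl (ι (m ℕ.!)) (w m) (ι (suc m)) ((f₂ ⊛ term f₂ m) v) ⟩
      w m ℚ.* (f₂ ⊛ term f₂ m) v ℚ.* (ι (suc m) ℚ.* ι (m ℕ.!))
        ≡⟨ cong₂ ℚ._*_ (≡.sym (C⊛ (w m) (f₂ ⊛ term f₂ m) v)) (≡.sym (ι-* (suc m) (m ℕ.!))) ⟩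
      term f₂ (suc m) v ℚ.* ι (suc m ℕ.!) ∎
      where
      open ≡.≡-Reasoning
      unfold : ∀ v → tuples 1 v (suc m) ≡ concatMap (λ k → map (k ∷_) (tuples 1 (v ∸ proj₁ k) m)) (parts 1 v)
      unfold zero    = ≡.refl
      unfold (suc v) = ≡.refl
      convolution : ∀ v → ∑ (upTo (v ∸ 1)) (λ i → b (2 ℕ.+ i) ℚ.* term f₂ m (v ∸ (2 ℕ.+ i))) ≡ (f₂ ⊛ term f₂ m) v
      convolution 0 = ≡.sym (ℚ.*-zeroˡ (term f₂ m 0))
      convolution 1 = ≡.sym (cong₂ ℚ._+_ (ℚ.*-zeroˡ (term f₂ m 1)) (ℚ.*-zeroˡ (term f₂ m 0)))
      convolution (suc (suc v)) = ≡.trans (≡.sym (⊛-∑ (tail (tail f₂)) (term f₂ m) v))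
        (≡.sym (≡.trans (cong₂ ℚ._+_ (ℚ.*-zeroˡ (term f₂ m (2 ℕ.+ v)))
          (≡.trans (cong (ℚ._+ (tail (tail f₂) ⊛ term f₂ m) v) (ℚ.*-zeroˡ (term f₂ m (1 ℕ.+ v)))) (ℚ.+-identityˡ x))) (ℚ.+-identityˡ x)))
        where x = (tail (tail f₂) ⊛ term f₂ m) v

  factorial⁻¹-! : ∀ m → factorial⁻¹ m ℚ.* ι (m ℕ.!) ≡ 1ℚ
  factorial⁻¹-! zero    = ≡.refl
  factorial⁻¹-! (suc m) = ≡.trans (cong (w m ℚ.* factorial⁻¹ m ℚ.*_) (ι-* (suc m) (m ℕ.!)))
    (≡.trans (solve 4 (λ w k i j → w :* k :* (i :* j) := w :* i :* (k :* j)) ≡.refl (w m) (factorial⁻¹ m) (ι (suc m)) (ι (m ℕ.!)))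
      (≡.trans (cong₂ ℚ._*_ (w*ι m) (factorial⁻¹-! m)) (ℚ.*-identityˡ 1ℚ)))

  -- exp (p₁ z + ∑ₙ≥₂ pₙ zⁿ / n), as a sum over the tuples of the theorem
  solutionSum : (ℕ → ℚ) → ℕ → ℚ
  solutionSum p v = ∑ (solutions v) λ (n , ns) →
    factorial⁻¹ n ℚ.* p 1 ^ n ℚ.* (factorial⁻¹ (length ns) ℚ.* ∏ ns (λ (j , _) → w (j ∸ 1) ℚ.* p j))

  module _ (p : ℕ → ℚ) where
    private
      b : ℕ → ℚ
      b j = w (j ∸ 1) ℚ.* p j

      f₁ = C (p 1) ⊛ z

      -- Makes the factor 1/(length)! constant over the tuples of one length, so that it can leave
      -- the sum.
      length-tuples : ∀ {b} m v (F : List (Part b) → ℕ → ℚ) → ∑ (tuples b v m) (λ ns → F ns (length ns)) ≡ ∑ (tuples b v m) (λ ns → F ns m)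
      length-tuples zero    zero    F = ≡.refl
      length-tuples zero    (suc v) F = ≡.refl
      length-tuples {b} (suc m) v F = step v
        where
        step : ∀ v → ∑ (tuples b v (suc m)) (λ ns → F ns (length ns)) ≡ ∑ (tuples b v (suc m)) (λ ns → F ns (suc m))
        unfolded : ∀ v → ∑ (concatMap (λ k → map (k ∷_) (tuples b (v ∸ proj₁ k) m)) (parts b v)) (λ ns → F ns (length ns)) ≡
          ∑ (concatMap (λ k → map (k ∷_) (tuples b (v ∸ proj₁ k) m)) (parts b v)) (λ ns → F ns (suc m))
        unfolded v = ≡.trans (∑-concatMap cons (parts b v) (λ ns → F ns (length ns))) (≡.trans (∑-cong (parts b v) (λ k →
          ≡.trans (∑-map (k ∷_) (tuples b (v ∸ proj₁ k) m) (λ ns → F ns (length ns)))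
            (≡.trans (length-tuples m (v ∸ proj₁ k) (λ ns l → F (k ∷ ns) (suc l)))
              (≡.sym (∑-map (k ∷_) (tuples b (v ∸ proj₁ k) m) (λ ns → F ns (suc m)))))))
            (≡.sym (∑-concatMap cons (parts b v) (λ ns → F ns (suc m)))))
          where
          cons : Part b → List (List (Part b))
          cons k = map (k ∷_) (tuples b (v ∸ proj₁ k) m)
        step zero    = unfolded zero
        step (suc v) = unfolded (suc v)

    solutionSum-exp : ∀ v → solutionSum p v ≡ (exp f₁ ⊛ exp (f₂ b)) v
    solutionSum-exp v = begin
      ∑ (solutions v) F
        ≡⟨ ∑-concatMap (λ n → concatMap (pairs n) (upTo (suc v))) (upTo (suc v)) F ⟩
      ∑ (upTo (suc v)) (λ n → ∑ (concatMap (pairs n) (upTo (suc v))) F)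
        ≡⟨ ∑-cong (upTo (suc v)) (λ n → ≡.trans (∑-concatMap (pairs n) (upTo (suc v)) F)
             (∑-cong (upTo (suc v)) (λ m → ≡.trans (∑-map (n ,_) (tuples 1 (v ∸ n) m) F) (inner n m)))) ⟩
      ∑ (upTo (suc v)) (λ n → ∑ (upTo (suc v)) (λ m → exp f₁ n ℚ.* term (f₂ b) m (v ∸ n)))
        ≡⟨ ∑-cong (upTo (suc v)) (λ n → ≡.trans (∑-*ˡ (exp f₁ n) (upTo (suc v)) (λ m → term (f₂ b) m (v ∸ n)))
             (cong (exp f₁ n ℚ.*_) (≡.trans (≡.sym (terms-∑ (f₂ b) v (v ∸ n))) (terms≡exp ≡.refl (v ∸ n) v (ℕ.m∸n≤m v n))))) ⟩
      ∑ (upTo (suc v)) (λ n → exp f₁ n ℚ.* exp (f₂ b) (v ∸ n))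
        ≡⟨ ⊛-∑ (exp f₁) (exp (f₂ b)) v ⟨
      (exp f₁ ⊛ exp (f₂ b)) v ∎
      where
      open ≡.≡-Reasoning
      pairs : ℕ → ℕ → List (ℕ × List (Part 1))
      pairs n m = map (n ,_) (tuples 1 (v ∸ n) m)
      F : ℕ × List (Part 1) → ℚ
      F (n , ns) = factorial⁻¹ n ℚ.* p 1 ^ n ℚ.* (factorial⁻¹ (length ns) ℚ.* ∏ ns (λ (j , _) → w (j ∸ 1) ℚ.* p j))
      inner : ∀ n m → ∑ (tuples 1 (v ∸ n) m) (λ ns → F (n , ns)) ≡ exp f₁ n ℚ.* term (f₂ b) m (v ∸ n)
      inner n m = begin
        ∑ T (λ ns → F (n , ns))
          ≡⟨ length-tuples m (v ∸ n) (λ ns l → c ℚ.* (factorial⁻¹ l ℚ.* ∏b b ns)) ⟩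
        ∑ T (λ ns → c ℚ.* (factorial⁻¹ m ℚ.* ∏b b ns))
          ≡⟨ ≡.trans (∑-*ˡ c T (λ ns → factorial⁻¹ m ℚ.* ∏b b ns)) (cong (c ℚ.*_) (∑-*ˡ (factorial⁻¹ m) T (∏b b))) ⟩
        c ℚ.* (factorial⁻¹ m ℚ.* ∑ T (∏b b))
          ≡⟨ cong (λ y → c ℚ.* (factorial⁻¹ m ℚ.* y)) (tuples-sum b m (v ∸ n)) ⟩
        c ℚ.* (factorial⁻¹ m ℚ.* (x ℚ.* ι (m ℕ.!)))
          ≡⟨ solve 4 (λ c k x i → c :* (k :* (x :* i)) := c :* x :* (k :* i)) ≡.refl c (factorial⁻¹ m) x (ι (m ℕ.!)) ⟩
        c ℚ.* x ℚ.* (factorial⁻¹ m ℚ.* ι (m ℕ.!))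
          ≡⟨ cong (c ℚ.* x ℚ.*_) (factorial⁻¹-! m) ⟩
        c ℚ.* x ℚ.* 1ℚ
          ≡⟨ ℚ.*-identityʳ (c ℚ.* x) ⟩
        c ℚ.* x
          ≡⟨ cong (ℚ._* x) (exp-linear (p 1) n) ⟨
        exp f₁ n ℚ.* x ∎
        where
        T = tuples 1 (v ∸ n) m
        c = factorial⁻¹ n ℚ.* p 1 ^ n
        x = term (f₂ b) m (v ∸ n)

    -- The division of pₙ by n in the exponent is undone by θ. This is where the denominators n₁ ⋯
    -- nₘ of the theorem originate.
    θ-exponent : p 0 ≡ 0ℚ → p ≋ θ f₁ ⊞ θ (f₂ b)
    θ-exponent p0≡0 0 = ≡.trans p0≡0 (≡.sym (cong₂ ℚ._+_ (ℚ.*-zeroˡ (f₁ 0)) (ℚ.*-zeroˡ 0ℚ)))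
    θ-exponent p0≡0 1 = ≡.sym (≡.trans (cong₂ ℚ._+_ (≡.trans (ℚ.*-identityˡ (f₁ 1)) (≡.trans (C⊛ (p 1) z 1) (ℚ.*-identityʳ (p 1)))) (ℚ.*-zeroʳ 1ℚ)) (ℚ.+-identityʳ (p 1)))
    θ-exponent p0≡0 (suc (suc n)) = ≡.sym (≡.trans (cong₂ ℚ._+_
      (≡.trans (cong (ι (2 ℕ.+ n) ℚ.*_) (≡.trans (C⊛ (p 1) z (2 ℕ.+ n)) (ℚ.*-zeroʳ (p 1)))) (ℚ.*-zeroʳ (ι (2 ℕ.+ n))))
      (≡.trans (≡.sym (ℚ.*-assoc (ι (2 ℕ.+ n)) (w (suc n)) (p (2 ℕ.+ n)))) (≡.trans (cong (ℚ._* p (2 ℕ.+ n)) (ι*w (suc n))) (ℚ.*-identityˡ (p (2 ℕ.+ n))))))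
      (ℚ.+-identityˡ (p (2 ℕ.+ n))))

    solutionSum-logDerivative : p 0 ≡ 0ℚ → solutionSum p HasLogDerivative p
    solutionSum-logDerivative p0≡0 n = ≡.trans (θ-cong solutionSum-exp n)
      (≡.trans (*-logDerivative (exp-logDerivative (linear-0 (p 1))) (exp-logDerivative {f₂ b} ≡.refl) n)
        (≡.sym (⊛-cong (θ-exponent p0≡0) solutionSum-exp n)))

  -- Both sides have the logarithmic derivative `P N` and the same constant term. The right side is
  -- a finite sum whose shape does not depend on N, so the limit in N can be taken in each
  -- coefficient of `P N` separately.
  ∏σ-solutionSum : ∀ N → let open LogDerivativeOfProduct in
    ∀ n → (inv 0 ⊛ D.∏σ N) n ≡ (inv 0 ⊛ D.∏σ N) 0 ℚ.* solutionSum (P N) n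
  ∏σ-solutionSum N n = ≡.trans (logDerivative-unique (P-0 N) (∏σ-logDerivative N) scaled (≡.sym (≡.trans (C⊛ c (solutionSum (P N)) 0)
      (≡.trans (cong (c ℚ.*_) (solutionSum-exp (P N) 0)) (ℚ.*-identityʳ c)))) n) (C⊛ c (solutionSum (P N)) n)
    where
    open LogDerivativeOfProduct
    c = (inv 0 ⊛ D.∏σ N) 0
    scaled : C c ⊛ solutionSum (P N) HasLogDerivative P N
    scaled = logDerivative-cong (P N) (*-logDerivative (κ-logDerivative c) (solutionSum-logDerivative (P N) (P-0 N)))
      (λ k → ≡.sym (ℚ.+-identityˡ (P N k)))

odd-multiple : ∀ i a′ → suc (i ℕ.* (2 ℕ.* suc a′) ℕ.+ a′) ≡ suc a′ ℕ.* suc (i ℕ.+ i)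
odd-multiple = solve 2 (λ i a →
  con 1 :+ (i :* (con 2 :* (con 1 :+ a)) :+ a) := (con 1 :+ a) :* (con 1 :+ (i :+ i))) ≡.refl
  where open ℕ-Solver

-- Truncated t-values and their generating functions

module Nodes where
  open ℚ-Solver
  open ℚF using (_^_)

  -- The index j stands for the integer j + 1, as in tPartial
  node : (N a j : ℕ) → ℚ
  node N a j with N ∣? ℕ.∣ suc j - a ∣
  ... | yes _ = w j
  ... | no  _ = 0ℚ

  -- The congruence condition is absorbed into nodes with value 0. Positivity of k enters here: an
  -- excluded integer must contribute 0ᵏ = 0, while 0⁰ would be 1.
  tPartial-suc : ∀ N a M k ks → 0 ℕ.< k →
    tPartial N a (suc M) (k ∷ ks) ≡ tPartial N a M (k ∷ ks) ℚ.+ node N a M ^ k ℚ.* tPartial N a M ks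
  tPartial-suc N a M (suc k) ks _ = ≡.trans (Convergence.T-step N a (suc k) ks M) (cong (tPartial N a M (suc k ∷ ks) ℚ.+_) last≡)
    where
    last≡ : Convergence.last N a (suc k) ks M ≡ node N a M ^ suc k ℚ.* tPartial N a M ks
    last≡ with N ∣? ℕ.∣ suc M - a ∣
    ... | yes _ = ℚ.+-identityʳ (w M ^ suc k ℚ.* tPartial N a M ks)
    ... | no  _ = solve 2 (λ x y → con 0ℚ := con 0ℚ :* x :* y) ≡.refl (0ℚ ^ k) (tPartial N a M ks)

  w-* : ∀ m p q → suc m ≡ suc p ℕ.* suc q → w m ≡ w p ℚ.* w q
  w-* m p q eq = begin
    w m                                                    ≡⟨ ℚ.*-identityʳ (w m) ⟨
    w m ℚ.* 1ℚ                                             ≡⟨ cong (w m ℚ.*_) (cong₂ ℚ._*_ (w*ι p) (w*ι q)) ⟨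
    w m ℚ.* (w p ℚ.* ι (suc p) ℚ.* (w q ℚ.* ι (suc q)))    ≡⟨ solve 5 (λ m p i q j → m :* (p :* i :* (q :* j)) := m :* (i :* j) :* (p :* q)) ≡.refl (w m) (w p) (ι (suc p)) (w q) (ι (suc q)) ⟩
    w m ℚ.* (ι (suc p) ℚ.* ι (suc q)) ℚ.* (w p ℚ.* w q)    ≡⟨ cong (λ x → w m ℚ.* x ℚ.* (w p ℚ.* w q)) (≡.trans (≡.sym (ι-* (suc p) (suc q))) (cong ι (≡.sym eq))) ⟩
    w m ℚ.* ι (suc m) ℚ.* (w p ℚ.* w q)                    ≡⟨ cong (ℚ._* (w p ℚ.* w q)) (w*ι m) ⟩
    1ℚ ℚ.* (w p ℚ.* w q)                                   ≡⟨ ℚ.*-identityˡ (w p ℚ.* w q) ⟩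
    w p ℚ.* w q                                            ∎
    where open ≡.≡-Reasoning

  module Level2a (a′ : ℕ) where
    private
      a = suc a′
      N = 2 ℕ.* a

    a′<N : a′ ℕ.< N
    a′<N = ℕ.m≤m+n a (a ℕ.+ 0)

    -- In each block of 2a consecutive integers exactly one is congruent to a, the odd multiple a
    -- (2i + 1).
    node-hit : ∀ i → node N a (i ℕ.* N ℕ.+ a′) ≡ w a′ ℚ.* w (i ℕ.+ i)
    node-hit i with N ∣? ℕ.∣ suc (i ℕ.* N ℕ.+ a′) - a ∣
    ... | yes _ = w-* (i ℕ.* N ℕ.+ a′) a′ (i ℕ.+ i) (odd-multiple i a′)
    ... | no ¬p = contradiction (subst (N ∣_) (≡.sym ∣∣≡) (n∣m*n i)) ¬p
      where
      ∣∣≡ : ℕ.∣ i ℕ.* N ℕ.+ a′ - a′ ∣ ≡ i ℕ.* N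
      ∣∣≡ = ≡.trans (ℕ.∣-∣-comm (i ℕ.* N ℕ.+ a′) a′) (≡.trans (cong (ℕ.∣ a′ -_∣) (ℕ.+-comm (i ℕ.* N) a′)) (ℕ.∣m-m+n∣≡n a′ (i ℕ.* N)))

    node-miss : ∀ i r → r ℕ.< N → ¬ r ≡ a′ → node N a (i ℕ.* N ℕ.+ r) ≡ 0ℚ
    node-miss i r r<N r≢a′ with N ∣? ℕ.∣ i ℕ.* N ℕ.+ r - a′ ∣
    ... | no  _ = ≡.refl
    ... | yes (divides q eq) with ℕ.≤-total a′ (i ℕ.* N ℕ.+ r)
    ...   | inj₁ a′≤m = contradiction (begin
      r                            ≡⟨ m<n⇒m%n≡m r<N ⟨
      r % N                        ≡⟨ [m+kn]%n≡m%n r i N ⟨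
      (r ℕ.+ i ℕ.* N) % N          ≡⟨ cong (_% N) (≡.trans (ℕ.+-comm r (i ℕ.* N)) (≡.trans (≡.sym (ℕ.m+[n∸m]≡n a′≤m)) (cong (a′ ℕ.+_) (≡.trans (≡.sym (ℕ.m≤n⇒∣n-m∣≡n∸m a′≤m)) eq)))) ⟩
      (a′ ℕ.+ q ℕ.* N) % N         ≡⟨ [m+kn]%n≡m%n a′ q N ⟩
      a′ % N                       ≡⟨ m<n⇒m%n≡m a′<N ⟩
      a′                           ∎) r≢a′
      where open ≡.≡-Reasoning
    -- The distance to a′ is now below N, so i and q are both 0 and r would equal a′.
    ...   | inj₂ m≤a′ = below i q (≡.trans (≡.sym (ℕ.m≤n⇒∣m-n∣≡n∸m m≤a′)) eq) m≤a′
      where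
      below : ∀ i q → a′ ∸ (i ℕ.* N ℕ.+ r) ≡ q ℕ.* N → i ℕ.* N ℕ.+ r ℕ.≤ a′ → w (i ℕ.* N ℕ.+ r) ≡ 0ℚ
      below zero    zero    a′∸r≡0 r≤a′ = contradiction (ℕ.≤-antisym r≤a′ (ℕ.m∸n≡0⇒m≤n a′∸r≡0)) r≢a′
      below zero    (suc q) eq     _    = contradiction (ℕ.≤-trans (ℕ.≤-trans (ℕ.m≤m+n N (q ℕ.* N)) (ℕ.≤-reflexive (≡.sym eq))) (ℕ.m∸n≤m a′ r)) (ℕ.<⇒≱ a′<N)
      below (suc i) q       _      m≤a′ = contradiction (ℕ.≤-trans (ℕ.≤-trans (ℕ.m≤m+n N (i ℕ.* N)) (ℕ.m≤m+n (N ℕ.+ i ℕ.* N) r)) m≤a′) (ℕ.<⇒≱ a′<N)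

    -- Formulated for any recurrence driven by the nodes, because it serves both for the generating
    -- functions and for the power sums that define t(k).
    module Blocks {A : Set} {_~_ : A → A → Set} (~-equiv : IsEquivalence _~_) (step : ℚ → A → A)
      (step-cong : ∀ x {s s′} → s ~ s′ → step x s ~ step x s′) (step-0 : ∀ s → step 0ℚ s ~ s)
      (f : ℕ → A) (f-suc : ∀ M → f (suc M) ~ step (node N a M) (f M)) where
      open IsEquivalence ~-equiv

      skip : ∀ M d → (∀ r → r ℕ.< d → node N a (M ℕ.+ r) ≡ 0ℚ) → f (M ℕ.+ d) ~ f M
      skip M zero    _  = reflexive (cong f (ℕ.+-identityʳ M))
      skip M (suc d) 0s = trans (reflexive (cong f (ℕ.+-suc M d)))
        (trans (f-suc (M ℕ.+ d)) (trans (reflexive (cong (λ x → step x (f (M ℕ.+ d))) (0s d (ℕ.n<1+n d))))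
          (trans (step-0 (f (M ℕ.+ d))) (skip M d (λ r r<d → 0s r (ℕ.<-trans r<d (ℕ.n<1+n d)))))))

      block : ∀ i → f (suc i ℕ.* N) ~ step (w a′ ℚ.* w (i ℕ.+ i)) (f (i ℕ.* N))
      block i = trans (reflexive (cong f end≡))
        (trans (skip (suc (i ℕ.* N ℕ.+ a′)) a after)
        (trans (f-suc (i ℕ.* N ℕ.+ a′))
        (trans (reflexive (cong (λ x → step x (f (i ℕ.* N ℕ.+ a′))) (node-hit i)))
          (step-cong (w a′ ℚ.* w (i ℕ.+ i)) (skip (i ℕ.* N) a′ (λ r r<a′ → node-miss i r (ℕ.<-trans r<a′ a′<N) (ℕ.<⇒≢ r<a′)))))))
        where
        end≡ : suc i ℕ.* N ≡ suc (i ℕ.* N ℕ.+ a′) ℕ.+ a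
        end≡ = ≡.trans (ℕ.+-comm N (i ℕ.* N)) (≡.trans (cong (λ x → i ℕ.* N ℕ.+ (a ℕ.+ x)) (ℕ.+-identityʳ a))
          (≡.trans (≡.sym (ℕ.+-assoc (i ℕ.* N) a a)) (cong (ℕ._+ a) (ℕ.+-suc (i ℕ.* N) a′))))
        after : ∀ r → r ℕ.< a → node N a (suc (i ℕ.* N ℕ.+ a′) ℕ.+ r) ≡ 0ℚ
        after r r<a = ≡.trans (cong (node N a) (≡.trans (cong (ℕ._+ r) (≡.sym (ℕ.+-suc (i ℕ.* N) a′))) (ℕ.+-assoc (i ℕ.* N) a r)))
          (node-miss i (a ℕ.+ r) (ℕ.+-monoʳ-< a (ℕ.<-≤-trans r<a (ℕ.m≤m+n a 0))) (λ eq → ℕ.<-irrefl (≡.sym eq) (ℕ.m≤m+n a r)))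

  module GeneratingFunction where
    -- G x = 1 / (1 - x z)
    G : ℚ → PS
    G x n = x ^ n

    -- (1 + xz)/(1 - xz), which is (m + z)/(m - z) for x = 1/m.
    factor : ℚ → PS
    factor x = (C 1ℚ ⊞ C x ⊛ z) ⊛ G x

    -- The contribution of the largest summation variable 1/x. The factor x² is the part of its
    -- exponent forced by admissibility; z marks the weight in excess of 2.
    increment : ℚ → PS → PS
    increment x f = C (x ℚ.* x) ⊛ (G x ⊛ f)

    step : ℚ → PS × PS → PS × PS
    step x (f , g) = f ⊛ factor x , g ⊞ increment x f

    infix 4 _≋₂_
    _≋₂_ : PS × PS → PS × PS → Set
    (f , g) ≋₂ (f′ , g′) = f ≋ f′ × g ≋ g′

    ≋₂-isEquivalence : IsEquivalence _≋₂_
    ≋₂-isEquivalence = record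
      { refl  = (λ _ → ≡.refl) , (λ _ → ≡.refl)
      ; sym   = λ (p , q) → (λ n → ≡.sym (p n)) , (λ n → ≡.sym (q n))
      ; trans = λ (p , q) (p′ , q′) → (λ n → ≡.trans (p n) (p′ n)) , (λ n → ≡.trans (q n) (q′ n)) }

    increment-cong : ∀ x {f f′} → f ≋ f′ → increment x f ≋ increment x f′
    increment-cong x f≋ = ⊛-cong {C (x ℚ.* x)} (λ _ → ≡.refl) (⊛-cong {G x} (λ _ → ≡.refl) f≋)

    step-cong : ∀ x {s s′} → s ≋₂ s′ → step x s ≋₂ step x s′
    step-cong x {f , g} {f′ , g′} (f≋ , g≋) = ⊛-cong {f} {f′} {factor x} f≋ (λ _ → ≡.refl)
      , (λ n → cong₂ ℚ._+_ (g≋ n) (increment-cong x f≋ n))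

    ⊛-identityʳ : ∀ f → f ⊛ C 1ℚ ≋ f
    ⊛-identityʳ f n = ≡.trans (⊛-comm f (C 1ℚ) n) (≡.trans (C⊛ 1ℚ f n) (ℚ.*-identityˡ (f n)))

    G-0 : G 0ℚ ≋ C 1ℚ
    G-0 zero    = ≡.refl
    G-0 (suc n) = ℚ.*-zeroˡ (0ℚ ^ n)

    factor-0 : factor 0ℚ ≋ C 1ℚ
    factor-0 n = ≡.trans (⊛-cong {f′ = C 1ℚ} {G 0ℚ} {C 1ℚ} (λ k → ≡.trans (cong (C 1ℚ k ℚ.+_) (≡.trans (C⊛ 0ℚ z k) (ℚ.*-zeroˡ (z k)))) (ℚ.+-identityʳ (C 1ℚ k))) G-0 n)
      (⊛-identityʳ (C 1ℚ) n)

    step-0 : ∀ s → step 0ℚ s ≋₂ s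
    step-0 (f , g) = (λ n → ≡.trans (⊛-cong {f} {f} (λ _ → ≡.refl) factor-0 n) (⊛-identityʳ f n))
      , (λ n → ≡.trans (cong (g n ℚ.+_) (≡.trans (C⊛ 0ℚ (G 0ℚ ⊛ f) n) (ℚ.*-zeroˡ ((G 0ℚ ⊛ f) n)))) (ℚ.+-identityʳ (g n)))

    start : PS × PS
    start = C 1ℚ , λ _ → 0ℚ

    state : (ℕ → ℚ) → ℕ → PS × PS
    state x zero    = start
    state x (suc M) = step (x M) (state x M)

    -- The substitution of cz for z.
    scale : ℚ → PS → PS
    scale c f n = c ^ n ℚ.* f n

    tail-scale : ∀ c f → tail (scale c f) ≋ (λ n → c ℚ.* scale c (tail f) n)
    tail-scale c f n = ℚ.*-assoc c (c ^ n) (f (suc n))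

    scale-⊛ : ∀ c f g → scale c (f ⊛ g) ≋ scale c f ⊛ scale c g
    scale-⊛ c f g zero    = solve 2 (λ x y → con 1ℚ :* (x :* y) := (con 1ℚ :* x) :* (con 1ℚ :* y)) ≡.refl (f 0) (g 0)
    scale-⊛ c f g (suc n) = ≡.trans
      (solve 5 (λ c k x y r → c :* k :* (x :* y :+ r) := con 1ℚ :* x :* (c :* k :* y) :+ c :* (k :* r)) ≡.refl c (c ^ n) (f 0) (g (suc n)) ((tail f ⊛ g) n))
      (cong (λ y → 1ℚ ℚ.* f 0 ℚ.* (c ℚ.* c ^ n ℚ.* g (suc n)) ℚ.+ y)
        (≡.trans (cong (c ℚ.*_) (scale-⊛ c (tail f) g n)) (≡.trans (≡.sym (⊛-scale c (scale c (tail f)) (scale c g) n))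
          (⊛-cong {g = scale c g} (λ k → ≡.sym (tail-scale c f k)) (λ _ → ≡.refl) n))))

    scale-C : ∀ c q → scale c (C q) ≋ C q
    scale-C c q zero    = ℚ.*-identityˡ q
    scale-C c q (suc n) = ℚ.*-zeroʳ (c ^ suc n)

    scale-z : ∀ c → scale c z ≋ C c ⊛ z
    scale-z c n = ≡.trans (scale-z′ n) (≡.sym (C⊛ c z n))
      where
      scale-z′ : ∀ n → scale c z n ≡ c ℚ.* z n
      scale-z′ 0 = ≡.trans (ℚ.*-zeroʳ 1ℚ) (≡.sym (ℚ.*-zeroʳ c))
      scale-z′ 1 = cong (ℚ._* 1ℚ) (ℚ.*-identityʳ c)
      scale-z′ (suc (suc n)) = ≡.trans (ℚ.*-zeroʳ (c ^ suc (suc n))) (≡.sym (ℚ.*-zeroʳ c))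

    scale-G : ∀ c x → scale c (G x) ≋ G (c ℚ.* x)
    scale-G c x zero    = ≡.refl
    scale-G c x (suc n) = ≡.trans (solve 4 (λ c k x y → c :* k :* (x :* y) := c :* x :* (k :* y)) ≡.refl c (c ^ n) x (x ^ n))
      (cong (c ℚ.* x ℚ.*_) (scale-G c x n))

    scale-factor : ∀ c x → scale c (factor x) ≋ factor (c ℚ.* x)
    scale-factor c x n = ≡.trans (scale-⊛ c (C 1ℚ ⊞ C x ⊛ z) (G x) n) (⊛-cong linear (scale-G c x) n)
      where
      linear : scale c (C 1ℚ ⊞ C x ⊛ z) ≋ C 1ℚ ⊞ C (c ℚ.* x) ⊛ z
      linear k = ≡.trans (ℚ.*-distribˡ-+ (c ^ k) (C 1ℚ k) ((C x ⊛ z) k)) (cong₂ ℚ._+_ (scale-C c 1ℚ k)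
        (≡.trans (cong (c ^ k ℚ.*_) (C⊛ x z k)) (≡.trans (solve 3 (λ k x y → k :* (x :* y) := x :* (k :* y)) ≡.refl (c ^ k) x (z k))
          (≡.trans (cong (x ℚ.*_) (≡.trans (scale-z c k) (C⊛ c z k))) (≡.trans (solve 3 (λ x c y → x :* (c :* y) := c :* x :* y) ≡.refl x c (z k)) (≡.sym (C⊛ (c ℚ.* x) z k)))))))

    -- A common factor c of all nodes can be moved into z. The additional c² in the second component
    -- belongs to the weight 2 not marked by z; for c = 1/a the total is a⁻ᵏ.
    state-scale : ∀ c x M → state (λ i → c ℚ.* x i) M ≋₂
      (scale c (proj₁ (state x M)) , (λ n → c ℚ.* c ℚ.* scale c (proj₂ (state x M)) n))
    state-scale c x zero    = (λ n → ≡.sym (scale-C c 1ℚ n))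
      , (λ n → ≡.sym (≡.trans (cong (c ℚ.* c ℚ.*_) (ℚ.*-zeroʳ (c ^ n))) (ℚ.*-zeroʳ (c ℚ.* c))))
    state-scale c x (suc M) = (λ n → ≡.trans (⊛-cong p (λ k → ≡.sym (scale-factor c (x M) k)) n) (≡.sym (scale-⊛ c f (factor (x M)) n)))
      , (λ n → ≡.trans (cong₂ ℚ._+_ (q n) (≡.trans (C⊛ (c ℚ.* x M ℚ.* (c ℚ.* x M)) (G (c ℚ.* x M) ⊛ f′) n)
          (cong (c ℚ.* x M ℚ.* (c ℚ.* x M) ℚ.*_) (≡.trans (⊛-cong (λ k → ≡.sym (scale-G c (x M) k)) p n) (≡.sym (scale-⊛ c (G (x M)) f n))))))
          (≡.trans (solve 5 (λ c x k g r → c :* c :* (k :* g) :+ c :* x :* (c :* x) :* (k :* r) := c :* c :* (k :* (g :+ x :* x :* r))) ≡.refl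
            c (x M) (c ^ n) (g n) ((G (x M) ⊛ f) n))
            (cong (λ y → c ℚ.* c ℚ.* (c ^ n ℚ.* (g n ℚ.+ y))) (≡.sym (C⊛ (x M ℚ.* x M) (G (x M) ⊛ f) n)))))
      where
      f = proj₁ (state x M)
      g = proj₂ (state x M)
      f′ = proj₁ (state (λ i → c ℚ.* x i) M)
      p = proj₁ (state-scale c x M)
      q = proj₂ (state-scale c x M)

    odd : ℕ → ℚ
    odd i = w (i ℕ.+ i)

    state-block : ∀ a′ L → state (node (2 ℕ.* suc a′) (suc a′)) (L ℕ.* (2 ℕ.* suc a′)) ≋₂ state (λ i → w a′ ℚ.* odd i) L
    state-block a′ zero    = IsEquivalence.refl ≋₂-isEquivalence
    state-block a′ (suc L) = IsEquivalence.trans ≋₂-isEquivalence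
      (block L) (step-cong (w a′ ℚ.* odd L) (state-block a′ L))
      where open Level2a.Blocks a′ ≋₂-isEquivalence step step-cong step-0 (state (node (2 ℕ.* suc a′) (suc a′))) (λ _ → IsEquivalence.refl ≋₂-isEquivalence)

    inv-G : ∀ m → inv m ≋ C (w m) ⊛ G (w m)
    inv-G m n = ≡.trans (go n) (≡.sym (C⊛ (w m) (G (w m)) n))
      where
      go : ∀ n → inv m n ≡ w m ℚ.* w m ^ n
      go zero    = ≡.sym (ℚ.*-identityʳ (w m))
      go (suc n) = cong (w m ℚ.*_) (go n)

    state-Dixon : ∀ L → state odd L ≋₂ (D.Π L , inv 0 ⊛ D.∑t 0 L)
    state-Dixon zero    = (λ _ → ≡.refl) , (λ n → ≡.sym (θ-Derivation.⊛-0 (inv 0) n))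
    state-Dixon (suc L) = (λ n → ⊛-cong p (factor≋) n)
      , (λ n → ≡.trans (cong₂ ℚ._+_ (q n) (inc n)) (≡.sym (⊛-distribˡ (inv 0) (D.∑t 0 L) (D.t 0 L) n)))
      where
      p = proj₁ (state-Dixon L)
      q = proj₂ (state-Dixon L)
      m = L ℕ.+ L
      x = w m
      linear : C 1ℚ ⊞ C x ⊛ z ≋ C x ⊛ (C (ι (suc m)) ⊞ z)
      linear k = ≡.trans (cong₂ ℚ._+_ (≡.trans (C-cong (≡.sym (w*ι m)) k) (C-* x (ι (suc m)) k)) ≡.refl) (≡.sym (⊛-distribˡ (C x) (C (ι (suc m))) z k))
      factor≋ : factor x ≋ (C (ι (suc m)) ⊞ z) ⊛ inv m
      factor≋ k = ≡.trans (⊛-cong {g = G x} (λ i → ≡.trans (linear i) (⊛-comm (C x) (C (ι (suc m)) ⊞ z) i)) (λ _ → ≡.refl) k)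
        (≡.trans (⊛-assoc (C (ι (suc m)) ⊞ z) (C x) (G x) k) (⊛-cong {f = C (ι (suc m)) ⊞ z} (λ _ → ≡.refl) (λ i → ≡.sym (inv-G m i)) k))
      inc : increment x (proj₁ (state odd L)) ≋ inv 0 ⊛ D.t 0 L
      inc k = ≡.trans (⊛-cong {C (x ℚ.* x)} {C x ⊛ C x} (C-* x x) (⊛-cong {G x} (λ _ → ≡.refl) p) k)
        (≡.trans (≡.trans (⊛-assoc (C x) (C x) (G x ⊛ D.Π L) k)
          (⊛-cong {C x} (λ _ → ≡.refl) (λ i → ≡.trans (≡.sym (⊛-assoc (C x) (G x) (D.Π L) i)) (⊛-cong {g = D.Π L} (λ j → ≡.sym (inv-G m j)) (λ _ → ≡.refl) i)) k))
        (≡.trans (≡.sym (⊛-assoc (C x) (inv m) (D.Π L) k)) (≡.sym (D.inv*t L k))))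

open Nodes

-- Interpolated sums: cancellation of the parameter r

part : ∀ i b → Part b
part i b = suc (b ℕ.+ i) , ℕ.s≤s (ℕ.m≤m+n b i)

tuples-suc : ∀ b v n → tuples b v (suc n) ≡ concatMap (λ k → map (k ∷_) (tuples b (v ∸ proj₁ k) n)) (parts b v)
tuples-suc b zero    n = ≡.refl
tuples-suc b (suc v) n = ≡.refl

dep-contractions : ∀ {b} (k : Part b) ls → All (λ 𝐩 → dep 𝐩 ℕ.≤ dep (k , ls)) (contractions k ls)
dep-contractions k []       = ℕ.≤-refl ∷ []
dep-contractions k (l ∷ ls) = All.++⁺ (All.map⁺ (All.map ℕ.s≤s (dep-contractions l ls)))
  (All.map ℕ.m≤n⇒m≤1+n (dep-contractions (k ⊕ l) ls))

+-exchange : ∀ i n e → suc i ℕ.+ (n ℕ.+ e) ≡ suc n ℕ.+ (i ℕ.+ e)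
+-exchange = solve 3 (λ i n e → con 1 :+ i :+ (n :+ e) := con 1 :+ n :+ (i :+ e)) ≡.refl
  where open ℕ-Solver

-- T M ks stands for a sum over M > m₁ > ⋯ > mₙ ≥ 0 of the products of the powers (x mᵢ)^kᵢ
module Interpolation (R : CommutativeRing 0ℓ 0ℓ) (h : ℚ.+-*-rawRing -Raw-AlmostCommutative⟶ fromCommutativeRing R)
  (X : CommutativeRing.Carrier R) (x : ℕ → ℚ) (T : ℕ → List ℕ → ℚ)
  (T-nil : ∀ M → T M [] ≡ 1ℚ) (T-zero : ∀ k ks → T 0 (k ∷ ks) ≡ 0ℚ)
  (T-suc : ∀ M k ks → 0 ℕ.< k → T (suc M) (k ∷ ks) ≡ T M (k ∷ ks) ℚ.+ x M ℚF.^ k ℚ.* T M ks) where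
  open ℚ-Algebra R h
  open ℚF using () renaming (_^_ to _^ℚ_)
  open Solver
  open ℚ-Solver using () renaming (solve to solveℚ; _:*_ to _⊗_; _:+_ to _⊞′_; _:-_ to _⊟′_; con to 𝕜; _:=_ to _⊜_)
  open Sums R
  open Finite rawRing using (_^_)

  interpolated : ∀ {b} → (Index b → ℚ) → Part b → List (Part 0) → Carrier
  interpolated F k ks = ∑ (contractions k ks) λ 𝐩 → X ^ (dep (k , ks) ∸ dep 𝐩) * κ (F 𝐩)

  Tʳ Bʳ : ∀ {b} → ℕ → Part b → List (Part 0) → Carrier
  Tʳ M = interpolated (λ 𝐩 → T M (entries 𝐩))
  -- the part of Tʳ (M + 1) with m₁ = M
  Bʳ M = interpolated (λ (k , ks) → x M ^ℚ proj₁ k ℚ.* T M (map proj₁ ks))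

  interpolated-cong : ∀ {b} {F G : Index b → ℚ} → (∀ 𝐩 → F 𝐩 ≡ G 𝐩) → ∀ k ks → interpolated F k ks ≈ interpolated G k ks
  interpolated-cong F≡G k ks = ∑-cong (contractions k ks) (λ 𝐩 → *-congˡ (reflexive (cong κ (F≡G 𝐩))))

  interpolated-+ : ∀ {b} (F G : Index b → ℚ) k ks → interpolated (λ 𝐩 → F 𝐩 ℚ.+ G 𝐩) k ks ≈ interpolated F k ks + interpolated G k ks
  interpolated-+ F G k ks = trans (∑-cong (contractions k ks) (λ 𝐩 → trans (*-congˡ (κ-+ (F 𝐩) (G 𝐩))) (distribˡ _ _ _)))
    (∑-+ (contractions k ks) _ _)

  Tʳ-suc : ∀ {b} M (k : Part b) ks → Tʳ (suc M) k ks ≈ Tʳ M k ks + Bʳ M k ks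
  Tʳ-suc M k ks = trans (interpolated-cong (λ ((k , b<k) , ks) → T-suc M k (map proj₁ ks) (ℕ.≤-<-trans ℕ.z≤n b<k)) k ks)
    (interpolated-+ (λ 𝐩 → T M (entries 𝐩)) (λ (k , ks) → x M ^ℚ proj₁ k ℚ.* T M (map proj₁ ks)) k ks)

  Tʳ-zero : ∀ {b} (k : Part b) ks → Tʳ 0 k ks ≈ 0#
  Tʳ-zero k ks = ∑-0 (contractions k ks) (λ (k , ks) → trans (*-congˡ (trans (reflexive (cong κ (T-zero (proj₁ k) (map proj₁ ks)))) κ-0)) (zeroʳ _))

  -- `U` collects what can follow a first part placed at m₁ = M: after a comma a sum over smaller
  -- variables, after a plus a further part at the same M, at the price of a factor X. The empty
  -- list allows only the former, hence the values 1 and 0.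
  T′ B′ U : ℕ → List (Part 0) → Carrier
  T′ M []       = 1#
  T′ M (l ∷ ls) = Tʳ M l ls
  B′ M []       = 0#
  B′ M (l ∷ ls) = Bʳ M l ls
  U M ls = T′ M ls + X * B′ M ls

  -- Case distinction on the first box. A plus lowers the depth by one and so contributes X.
  Bʳ-∷ : ∀ {b} M (k : Part b) l ls → Bʳ M k (l ∷ ls) ≈ κ (x M ^ℚ proj₁ k) * Tʳ M l ls + X * Bʳ M (k ⊕ l) ls
  Bʳ-∷ M k l ls = trans (∑-++ (map _ (contractions l ls)) (contractions (k ⊕ l) ls) _) (+-cong
    (trans (∑-map _ (contractions l ls) _) (trans (∑-cong (contractions l ls) (λ 𝐩 →
      trans (*-congˡ (κ-* _ _)) (trans (sym (*-assoc _ _ _)) (trans (*-congʳ (*-comm _ _)) (*-assoc _ _ _)))))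
      (∑-*ˡ (κ (x M ^ℚ proj₁ k)) (contractions l ls) _)))
    -- The bound on the depth makes the truncated subtraction in the exponent exact.
    (trans (∑-All (All.map (λ {𝐩} dep≤ → trans (*-congʳ (reflexive (cong (X ^_) (ℕ.+-∸-assoc 1 dep≤)))) (*-assoc X _ _))
      (dep-contractions (k ⊕ l) ls))) (∑-*ˡ X (contractions (k ⊕ l) ls) _)))

  ^ℚ-+ : ∀ y m n → y ^ℚ (m ℕ.+ n) ≡ y ^ℚ m ℚ.* y ^ℚ n
  ^ℚ-+ y zero    n = ≡.sym (ℚ.*-identityˡ (y ^ℚ n))
  ^ℚ-+ y (suc m) n = ≡.trans (cong (y ℚ.*_) (^ℚ-+ y m n)) (≡.sym (ℚ.*-assoc y (y ^ℚ m) (y ^ℚ n)))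

  -- Merging adds exponents of the same node, so the first part k contributes xᵏ alone, whatever is
  -- merged into it.
  Bʳ-U : ∀ {b} M (k : Part b) ls → Bʳ M k ls ≈ κ (x M ^ℚ proj₁ k) * U M ls
  Bʳ-U M k [] = trans (+-identityʳ _) (trans (*-identityˡ _)
    (trans (reflexive (cong κ (≡.trans (cong (x M ^ℚ proj₁ k ℚ.*_) (T-nil M)) (ℚ.*-identityʳ (x M ^ℚ proj₁ k)))))
      (sym (trans (*-congˡ (trans (+-congˡ (zeroʳ X)) (+-identityʳ 1#))) (*-identityʳ _)))))
  Bʳ-U M k (l ∷ ls) = begin
    Bʳ M k (l ∷ ls)                                          ≈⟨ Bʳ-∷ M k l ls ⟩
    y * Tʳ M l ls + X * Bʳ M (k ⊕ l) ls                      ≈⟨ +-congˡ (*-congˡ (trans (Bʳ-U M (k ⊕ l) ls) (trans (*-congʳ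
                                                                  (trans (reflexive (cong κ (^ℚ-+ (x M) (proj₁ k) (proj₁ l)))) (κ-* (x M ^ℚ proj₁ k) (x M ^ℚ proj₁ l)))) (*-assoc _ _ _)))) ⟩
    y * Tʳ M l ls + X * (y * (κ (x M ^ℚ proj₁ l) * U M ls))  ≈⟨ +-congˡ (*-congˡ (*-congˡ (Bʳ-U M l ls))) ⟨
    y * Tʳ M l ls + X * (y * Bʳ M l ls)                      ≈⟨ solve 4 (λ y t X b → y :* t :+ X :* (y :* b) := y :* (t :+ X :* b)) refl y (Tʳ M l ls) X (Bʳ M l ls) ⟩
    y * U M (l ∷ ls)                                         ∎
    where
    open SetoidReasoning setoid
    y = κ (x M ^ℚ proj₁ k)

  s : Carrier
  s = κ 1ℚ + - (κ (ι 2) * X)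

  -- The factor 2ⁿ s^(v - n) for depth n and weight v, distributed as 2 s^(k - 1) over the parts k.
  -- In this form it is multiplicative.
  weight : List (Part 0) → Carrier
  weight []       = 1#
  weight (k ∷ ks) = κ (ι 2) * s ^ (proj₁ k ∸ 1) * weight ks

  ^-+ : ∀ y m n → y ^ (m ℕ.+ n) ≈ y ^ m * y ^ n
  ^-+ = Exp.^-homo-* semiring

  weight-tuples : ∀ n v → All (λ ks → ∃ λ e → v ≡ n ℕ.+ e × weight ks ≈ κ (ι 2) ^ n * s ^ e) (tuples 0 v n)
  weight-tuples zero    zero    = (0 , ≡.refl , sym (*-identityˡ 1#)) ∷ []
  weight-tuples zero    (suc v) = []
  weight-tuples (suc n) v rewrite tuples-suc 0 v n = All.concat⁺ (All.map⁺ (All.map⁺ (All.applyUpTo⁺₁ (λ i → i) v λ {i} i<v →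
    All.map⁺ (All.map (λ {ks} (e , v≡ , eq) → i ℕ.+ e
      , ≡.trans (≡.sym (ℕ.m+[n∸m]≡n i<v)) (≡.trans (cong (suc i ℕ.+_) v≡) (+-exchange i n e))
      , trans (*-congˡ eq) (trans (solve 4 (λ t p q r → t :* p :* (q :* r) := t :* q :* (p :* r)) refl (κ (ι 2)) (s ^ i) (κ (ι 2) ^ n) (s ^ e))
          (*-congˡ (sym (^-+ s i e)))))
      (weight-tuples n (v ∸ suc i))))))

  ∑-tuples-suc : ∀ v n (F : List (Part 0) → Carrier) →
    ∑ (tuples 0 v (suc n)) F ≈ ∑ (upTo v) (λ i → ∑ (tuples 0 (v ∸ suc i) n) (λ ks → F (part i 0 ∷ ks)))
  ∑-tuples-suc v n F = trans (reflexive (cong (λ xs → ∑ xs F) (tuples-suc 0 v n)))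
    (trans (∑-concatMap (λ k → map (k ∷_) (tuples 0 (v ∸ proj₁ k) n)) (parts 0 v) F)
    (trans (∑-map (λ i → part i 0) (upTo v) (λ k → ∑ (map (k ∷_) (tuples 0 (v ∸ proj₁ k) n)) F))
      (∑-cong (upTo v) (λ i → ∑-map (part i 0 ∷_) (tuples 0 (v ∸ suc i) n) F))))

  -- A bound K > v on the depth includes all indices of weight v. It is kept as a separate variable
  -- because removing the first part lowers it by one and the weight by an arbitrary amount.
  total : (List (Part 0) → Carrier) → ℕ → ℕ → Carrier
  total F K v = ∑ (upTo K) λ n → ∑ (tuples 0 v n) λ ks → weight ks * F ks

  total-cong : ∀ {F G} → (∀ ks → F ks ≈ G ks) → ∀ K v → total F K v ≈ total G K v
  total-cong F≈G K v = ∑-cong (upTo K) (λ n → ∑-cong (tuples 0 v n) (λ ks → *-congˡ (F≈G ks)))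

  total-+ : ∀ F G K v → total (λ ks → F ks + G ks) K v ≈ total F K v + total G K v
  total-+ F G K v = trans (∑-cong (upTo K) (λ n → trans (∑-cong (tuples 0 v n) (λ ks → distribˡ _ _ _)) (∑-+ (tuples 0 v n) _ _))) (∑-+ (upTo K) _ _)

  total-*ˡ : ∀ c F K v → total (λ ks → c * F ks) K v ≈ c * total F K v
  total-*ˡ c F K v = trans (∑-cong (upTo K) (λ n → trans (∑-cong (tuples 0 v n)
    (λ ks → trans (sym (*-assoc _ _ _)) (trans (*-congʳ (*-comm _ _)) (*-assoc _ _ _)))) (∑-*ˡ c (tuples 0 v n) _))) (∑-*ˡ c (upTo K) _)

  -- Half of the contribution of m₁ = M: the first part is i + 1 and its factor 2 is left out.
  -- Without that factor it satisfies the simple recurrence `Y-suc`.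
  Y : ℕ → ℕ → ℕ → Carrier
  Y M K v = ∑ (upTo v) λ i → s ^ i * κ (x M ^ℚ suc i) * total (U M) K (v ∸ suc i)

  total-B′ : ∀ M K v → total (B′ M) (suc K) v ≈ κ (ι 2) * Y M K v
  total-B′ M K v = begin
    total (B′ M) (suc K) v
      ≈⟨ trans (∑-upTo-suc K _) (trans (+-congʳ (empty v)) (+-identityˡ _)) ⟩
    ∑ (upTo K) (λ n → ∑ (tuples 0 v (suc n)) (λ ks → weight ks * B′ M ks))
      ≈⟨ ∑-cong (upTo K) (λ n → trans (∑-tuples-suc v n (λ ks → weight ks * B′ M ks)) (∑-cong (upTo v) (λ i →
           trans (∑-cong (tuples 0 (v ∸ suc i) n) (λ ks → trans (*-congˡ (Bʳ-U M (part i 0) ks))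
             (solve 5 (λ t p q y u → t :* p :* q :* (y :* u) := t :* (p :* y) :* (q :* u)) refl
               (κ (ι 2)) (s ^ i) (weight ks) (κ (x M ^ℚ suc i)) (U M ks))))
             (∑-*ˡ (κ (ι 2) * (s ^ i * κ (x M ^ℚ suc i))) (tuples 0 (v ∸ suc i) n) _)))) ⟩
    ∑ (upTo K) (λ n → ∑ (upTo v) (λ i → κ (ι 2) * (s ^ i * κ (x M ^ℚ suc i)) * ∑ (tuples 0 (v ∸ suc i) n) (λ ks → weight ks * U M ks)))
      ≈⟨ ∑-swap (upTo K) (upTo v) _ ⟩
    ∑ (upTo v) (λ i → ∑ (upTo K) (λ n → κ (ι 2) * (s ^ i * κ (x M ^ℚ suc i)) * ∑ (tuples 0 (v ∸ suc i) n) (λ ks → weight ks * U M ks)))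
      ≈⟨ ∑-cong (upTo v) (λ i → trans (∑-*ˡ _ (upTo K) _) (*-assoc _ _ _)) ⟩
    ∑ (upTo v) (λ i → κ (ι 2) * (s ^ i * κ (x M ^ℚ suc i) * total (U M) K (v ∸ suc i)))
      ≈⟨ ∑-*ˡ (κ (ι 2)) (upTo v) _ ⟩
    κ (ι 2) * Y M K v ∎
    where
    open SetoidReasoning setoid
    empty : ∀ v → ∑ (tuples 0 v 0) (λ ks → weight ks * B′ M ks) ≈ 0#
    empty zero    = trans (+-identityʳ _) (zeroʳ _)
    empty (suc v) = refl

  T′-suc : ∀ M ks → T′ (suc M) ks ≈ T′ M ks + B′ M ks
  T′-suc M []       = sym (+-identityʳ 1#)
  T′-suc M (l ∷ ls) = Tʳ-suc M l ls

  Y-suc : ∀ M K v → Y M K (suc v) ≈ κ (x M) * total (U M) K v + s * κ (x M) * Y M K v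
  Y-suc M K v = trans (∑-upTo-suc v _) (+-cong
    (*-congʳ (trans (*-identityˡ _) (reflexive (cong κ (ℚ.*-identityʳ (x M))))))
    (trans (∑-cong (upTo v) (λ i → trans (*-congʳ (*-congˡ (κ-* (x M) (x M ^ℚ suc i))))
      (solve 5 (λ s p y q u → s :* p :* (y :* q) :* u := s :* y :* (p :* q :* u)) refl s (s ^ i) (κ (x M)) (κ (x M ^ℚ suc i)) (total (U M) K (v ∸ suc i)))))
      (∑-*ˡ (s * κ (x M)) (upTo v) _)))

  open GeneratingFunction using (G; factor; increment; state)

  -- `y` is xz/(1 - xz) times `f`. So (1 + xz)/(1 - xz) acts as f + 2y, and the increment of `g` is
  -- x y with indices lowered by one.
  f g y : ℕ → PS
  f M = proj₁ (state x M)
  g M = proj₂ (state x M)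
  y M v = (G (x M) ⊛ f M) v ℚ.- f M v

  G⊛-suc : ∀ c f v → (G c ⊛ f) (suc v) ≡ f (suc v) ℚ.+ c ℚ.* (G c ⊛ f) v
  G⊛-suc c f v = cong₂ ℚ._+_ (ℚ.*-identityˡ (f (suc v))) (⊛-scale c (G c) f v)

  y-zero : ∀ M → y M 0 ≡ 0ℚ
  y-zero M = ≡.trans (cong (ℚ._- f M 0) (ℚ.*-identityˡ (f M 0))) (ℚ.+-inverseʳ (f M 0))

  y-suc : ∀ M v → y M (suc v) ≡ x M ℚ.* (f M v ℚ.+ y M v)
  y-suc M v = ≡.trans (cong (ℚ._- f M (suc v)) (G⊛-suc (x M) (f M) v))
    (solveℚ 4 (λ a c q b → a ⊞′ c ⊗ q ⊟′ a ⊜ c ⊗ (b ⊞′ (q ⊟′ b))) ≡.refl (f M (suc v)) (x M) ((G (x M) ⊛ f M) v) (f M v))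

  f-suc : ∀ M v → f (suc M) v ≡ f M v ℚ.+ ι 2 ℚ.* y M v
  f-suc M v = ≡.trans (⊛-comm (f M) (factor (x M)) v) (≡.trans (⊛-assoc (C 1ℚ ⊞ C (x M) ⊛ z) (G (x M)) (f M) v)
    (≡.trans (⊛-distribʳ q (C 1ℚ) (C (x M) ⊛ z) v) (≡.trans (cong₂ ℚ._+_ (≡.trans (C⊛ 1ℚ q v) (ℚ.*-identityˡ (q v)))
      (≡.trans (⊛-assoc (C (x M)) z q v) (C⊛ (x M) (z ⊛ q) v))) (cases v))))
    where
    q = G (x M) ⊛ f M
    cases : ∀ v → q v ℚ.+ x M ℚ.* (z ⊛ q) v ≡ f M v ℚ.+ ι 2 ℚ.* (q v ℚ.- f M v)
    cases zero    = solveℚ 3 (λ b c q → 𝕜 1ℚ ⊗ b ⊞′ c ⊗ (𝕜 0ℚ ⊗ q) ⊜ b ⊞′ 𝕜 (ι 2) ⊗ (𝕜 1ℚ ⊗ b ⊟′ b)) ≡.refl (f M 0) (x M) (q 0)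
    cases (suc v) = ≡.trans (cong₂ (λ a b → a ℚ.+ x M ℚ.* b) (G⊛-suc (x M) (f M) v) (Exponential.z⊛-suc q v))
      (≡.trans (solveℚ 3 (λ b c q → b ⊞′ c ⊗ q ⊞′ c ⊗ q ⊜ b ⊞′ 𝕜 (ι 2) ⊗ (b ⊞′ c ⊗ q ⊟′ b)) ≡.refl (f M (suc v)) (x M) (q v))
        (cong (λ a → f M (suc v) ℚ.+ ι 2 ℚ.* (a ℚ.- f M (suc v))) (≡.sym (G⊛-suc (x M) (f M) v))))

  g-suc : ∀ M v → g (suc M) v ≡ g M v ℚ.+ x M ℚ.* y M (suc v)
  g-suc M v = cong (g M v ℚ.+_) (≡.trans (C⊛ (x M ℚ.* x M) (G (x M) ⊛ f M) v)
    (≡.trans (solveℚ 3 (λ c q b → c ⊗ c ⊗ q ⊜ c ⊗ (c ⊗ (b ⊞′ (q ⊟′ b)))) ≡.refl (x M) ((G (x M) ⊛ f M) v) (f M v))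
      (cong (x M ℚ.*_) (≡.sym (y-suc M v)))))

  -- Here the interpolation parameter drops out, as s + 2 X = 1
  Y-value : ∀ M → (∀ K v → v ℕ.< K → total (T′ M) K v ≈ κ (f M v)) → ∀ v K → v ℕ.≤ K → Y M K v ≈ κ (y M v)
  Y-value M T-value zero    K       _           = sym (trans (reflexive (cong κ (y-zero M))) κ-0)
  Y-value M T-value (suc v) (suc K) (ℕ.s≤s v≤K) = begin
    Y M (suc K) (suc v)
      ≈⟨ Y-suc M (suc K) v ⟩
    c * total (U M) (suc K) v + s * c * Y M (suc K) v
      ≈⟨ +-cong (*-congˡ (trans (total-+ (T′ M) (λ ks → X * B′ M ks) (suc K) v) (+-cong (T-value (suc K) v (ℕ.s≤s v≤K))
           (trans (total-*ˡ X (B′ M) (suc K) v) (*-congˡ (trans (total-B′ M K v) (*-congˡ (Y-value M T-value v K v≤K))))))))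
           (*-congˡ (Y-value M T-value v (suc K) (ℕ.m≤n⇒m≤1+n v≤K))) ⟩
    c * (κ (f M v) + X * (κ (ι 2) * κ (y M v))) + s * c * κ (y M v)
      ≈⟨ solve 4 (λ c b X y → c :* (b :+ X :* (con (ι 2) :* y)) :+ (con 1ℚ :+ :- (con (ι 2) :* X)) :* c :* y := c :* (b :+ y)) refl c (κ (f M v)) X (κ (y M v)) ⟩
    c * (κ (f M v) + κ (y M v))
      ≈⟨ *-congˡ (κ-+ (f M v) (y M v)) ⟨
    c * κ (f M v ℚ.+ y M v)
      ≈⟨ κ-* (x M) (f M v ℚ.+ y M v) ⟨
    κ (x M ℚ.* (f M v ℚ.+ y M v))
      ≡⟨ cong κ (y-suc M v) ⟨
    κ (y M (suc v)) ∎
    where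
    open SetoidReasoning setoid
    c = κ (x M)

  -- Induction on M: admitting one more variable adds 2y, which is multiplication of the generating
  -- function by (1 + xz)/(1 - xz).
  T′-value : ∀ M K v → v ℕ.< K → total (T′ M) K v ≈ κ (f M v)
  T′-value zero (suc K) v _ = trans (∑-upTo-suc K _) (trans (+-cong (first v) (∑-0 (upTo K) (λ n → trans (∑-tuples-suc v n _)
      (∑-0 (upTo v) (λ i → ∑-0 (tuples 0 (v ∸ suc i) n) (λ ks → trans (*-congˡ (Tʳ-zero (part i 0) ks)) (zeroʳ _))))))) (+-identityʳ _))
    where
    first : ∀ v → ∑ (tuples 0 v 0) (λ ks → weight ks * T′ 0 ks) ≈ κ (C 1ℚ v)
    first zero    = trans (+-identityʳ _) (trans (*-identityˡ 1#) (sym κ-1))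
    first (suc v) = sym κ-0
  T′-value (suc M) (suc K) v (ℕ.s≤s v≤K) = begin
    total (T′ (suc M)) (suc K) v                       ≈⟨ total-cong (T′-suc M) (suc K) v ⟩
    total (λ ks → T′ M ks + B′ M ks) (suc K) v         ≈⟨ total-+ (T′ M) (B′ M) (suc K) v ⟩
    total (T′ M) (suc K) v + total (B′ M) (suc K) v    ≈⟨ +-cong (T′-value M (suc K) v (ℕ.s≤s v≤K)) (trans (total-B′ M K v) (*-congˡ (Y-value M (T′-value M) v K v≤K))) ⟩
    κ (f M v) + κ (ι 2) * κ (y M v)                    ≈⟨ +-congˡ (κ-* (ι 2) (y M v)) ⟨
    κ (f M v) + κ (ι 2 ℚ.* y M v)                      ≈⟨ κ-+ (f M v) (ι 2 ℚ.* y M v) ⟨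
    κ (f M v ℚ.+ ι 2 ℚ.* y M v)                        ≡⟨ cong κ (f-suc M v) ⟨
    κ (f (suc M) v)                                    ∎
    where open SetoidReasoning setoid

  -- The first part i + 2 receives s^i and no factor 2. With k = v + 2 and n parts after the first,
  -- the weight becomes s^(v - n) 2ⁿ, as in the theorem at depth n + 1.
  admissible : (Part 1 → List (Part 0) → Carrier) → ℕ → Carrier
  admissible F v = ∑ (upTo (suc v)) λ n → ∑ (upTo (suc v)) λ i → ∑ (tuples 0 (v ∸ i) n) λ ks → s ^ i * weight ks * F (part i 1) ks

  admissible-B : ∀ M v → admissible (Bʳ M) v ≈ κ (x M) * Y M (suc v) (suc v)
  admissible-B M v = begin
    admissible (Bʳ M) v
      ≈⟨ ∑-swap (upTo (suc v)) (upTo (suc v)) _ ⟩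
    ∑ (upTo (suc v)) (λ i → ∑ (upTo (suc v)) (λ n → ∑ (tuples 0 (v ∸ i) n) (λ ks → s ^ i * weight ks * Bʳ M (part i 1) ks)))
      ≈⟨ ∑-cong (upTo (suc v)) (λ i → trans (∑-cong (upTo (suc v)) (λ n → trans (∑-cong (tuples 0 (v ∸ i) n) (λ ks →
           trans (*-congˡ (trans (Bʳ-U M (part i 1) ks) (*-congʳ (κ-* (x M) (x M ^ℚ suc i)))))
             (solve 5 (λ p q c k u → p :* q :* (c :* k :* u) := c :* (p :* k) :* (q :* u)) refl (s ^ i) (weight ks) (κ (x M)) (κ (x M ^ℚ suc i)) (U M ks))))
             (∑-*ˡ (κ (x M) * (s ^ i * κ (x M ^ℚ suc i))) (tuples 0 (v ∸ i) n) _)))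
           (trans (∑-*ˡ (κ (x M) * (s ^ i * κ (x M ^ℚ suc i))) (upTo (suc v)) _) (*-assoc _ _ _))) ⟩
    ∑ (upTo (suc v)) (λ i → κ (x M) * (s ^ i * κ (x M ^ℚ suc i) * total (U M) (suc v) (v ∸ i)))
      ≈⟨ ∑-*ˡ (κ (x M)) (upTo (suc v)) _ ⟩
    κ (x M) * Y M (suc v) (suc v) ∎
    where open SetoidReasoning setoid

  admissible-value : ∀ M v → admissible (Tʳ M) v ≈ κ (g M v)
  admissible-value zero    v = trans (∑-0 (upTo (suc v)) (λ n → ∑-0 (upTo (suc v)) (λ i → ∑-0 (tuples 0 (v ∸ i) n) (λ ks →
    trans (*-congˡ (Tʳ-zero (part i 1) ks)) (zeroʳ _))))) (sym κ-0)
  admissible-value (suc M) v = begin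
    admissible (Tʳ (suc M)) v
      ≈⟨ ∑-cong (upTo (suc v)) (λ n → trans (∑-cong (upTo (suc v)) (λ i → trans (∑-cong (tuples 0 (v ∸ i) n) (λ ks →
           trans (*-congˡ (Tʳ-suc M (part i 1) ks)) (distribˡ _ _ _))) (∑-+ (tuples 0 (v ∸ i) n) _ _))) (∑-+ (upTo (suc v)) _ _)) ⟩
    ∑ (upTo (suc v)) (λ n → _ + _)
      ≈⟨ ∑-+ (upTo (suc v)) _ _ ⟩
    admissible (Tʳ M) v + admissible (Bʳ M) v
      ≈⟨ +-cong (admissible-value M v) (trans (admissible-B M v) (*-congˡ (Y-value M (T′-value M) (suc v) (suc v) ℕ.≤-refl))) ⟩
    κ (g M v) + κ (x M) * κ (y M (suc v))
      ≈⟨ +-congˡ (κ-* (x M) (y M (suc v))) ⟨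
    κ (g M v) + κ (x M ℚ.* y M (suc v))
      ≈⟨ κ-+ (g M v) (x M ℚ.* y M (suc v)) ⟨
    κ (g M v ℚ.+ x M ℚ.* y M (suc v))
      ≡⟨ cong κ (g-suc M v) ⟨
    κ (g (suc M) v) ∎
    where open SetoidReasoning setoid

  indices : ∀ M v → ∑ (applyUpTo suc (suc v)) (λ n →
      s ^ (2 ℕ.+ v ∸ n ∸ 1) * κ (ι 2) ^ (n ∸ 1) * ∑ (I₀ (2 ℕ.+ v) n) (λ (k , ks) → Tʳ M k ks)) ≈ admissible (Tʳ M) v
  indices M v = trans (reflexive (cong (λ ns → ∑ ns F) (≡.sym (List.map-upTo suc (suc v)))))
    (trans (∑-map suc (upTo (suc v)) F) (∑-cong (upTo (suc v)) (λ n → begin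
      c n * ∑ (I₀ (2 ℕ.+ v) (suc n)) (λ (k , ks) → Tʳ M k ks)
        ≈⟨ *-congˡ (trans (∑-concatMap (λ k → map (k ,_) (tuples 0 (2 ℕ.+ v ∸ proj₁ k) n)) (parts 1 (2 ℕ.+ v)) uncurried)
             (trans (∑-map (λ i → part i 1) (upTo (suc v)) (λ k → ∑ (map (k ,_) (tuples 0 (2 ℕ.+ v ∸ proj₁ k) n)) uncurried))
               (∑-cong (upTo (suc v)) (λ i → ∑-map (part i 1 ,_) (tuples 0 (v ∸ i) n) uncurried)))) ⟩
      c n * ∑ (upTo (suc v)) (λ i → ∑ (tuples 0 (v ∸ i) n) (Tʳ M (part i 1)))
        ≈⟨ ∑-*ˡ (c n) (upTo (suc v)) _ ⟨
      ∑ (upTo (suc v)) (λ i → c n * ∑ (tuples 0 (v ∸ i) n) (Tʳ M (part i 1)))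
        ≈⟨ ∑-All (All.applyUpTo⁺₁ (λ i → i) (suc v) (λ {i} i≤v → trans (sym (∑-*ˡ (c n) (tuples 0 (v ∸ i) n) _))
             (∑-All (All.map (λ {ks} (e , v∸i≡ , eq) → *-congʳ (c≈ n i e v∸i≡ (ℕ.≤-pred i≤v) eq)) (weight-tuples n (v ∸ i)))))) ⟩
      ∑ (upTo (suc v)) (λ i → ∑ (tuples 0 (v ∸ i) n) (λ ks → s ^ i * weight ks * Tʳ M (part i 1) ks)) ∎)))
    where
    open SetoidReasoning setoid
    uncurried : Index 1 → Carrier
    uncurried (k , ks) = Tʳ M k ks
    F : ℕ → Carrier
    F n = s ^ (2 ℕ.+ v ∸ n ∸ 1) * κ (ι 2) ^ (n ∸ 1) * ∑ (I₀ (2 ℕ.+ v) n) (λ (k , ks) → Tʳ M k ks)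
    c : ℕ → Carrier
    c n = s ^ (2 ℕ.+ v ∸ suc n ∸ 1) * κ (ι 2) ^ n
    c≈ : ∀ n i e → v ∸ i ≡ n ℕ.+ e → i ℕ.≤ v → ∀ {W} → W ≈ κ (ι 2) ^ n * s ^ e → c n ≈ s ^ i * W
    c≈ n i e v∸i≡ i≤v {W} eq = begin
      s ^ (suc v ∸ n ∸ 1) * κ (ι 2) ^ n    ≡⟨ cong (λ m → s ^ m * κ (ι 2) ^ n) exponent ⟩
      s ^ (i ℕ.+ e) * κ (ι 2) ^ n          ≈⟨ *-congʳ (^-+ s i e) ⟩
      s ^ i * s ^ e * κ (ι 2) ^ n          ≈⟨ trans (*-assoc _ _ _) (*-congˡ (*-comm _ _)) ⟩
      s ^ i * (κ (ι 2) ^ n * s ^ e)        ≈⟨ *-congˡ eq ⟨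
      s ^ i * W                            ∎
      where
      v≡ : v ≡ n ℕ.+ (i ℕ.+ e)
      v≡ = ≡.trans (≡.sym (ℕ.m+[n∸m]≡n i≤v)) (≡.trans (cong (i ℕ.+_) v∸i≡)
        (≡.trans (≡.sym (ℕ.+-assoc i n e)) (≡.trans (cong (ℕ._+ e) (ℕ.+-comm i n)) (ℕ.+-assoc n i e))))
      exponent : suc v ∸ n ∸ 1 ≡ i ℕ.+ e
      exponent = ≡.trans (ℕ.∸-+-assoc (suc v) n 1) (≡.trans (cong (suc v ∸_) (ℕ.+-comm n 1))
        (≡.trans (cong (_∸ n) v≡) (ℕ.m+n∸m≡n n (i ℕ.+ e))))

open import Defs

module PSF = Finite (CommutativeRing.rawRing PowerSeries.ring)

-- Real polynomials at one stage of approximation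

module Approximation (M : ℕ) where
  -- Replacing each real coefficient by its M-th approximation respects the ring operations. In its
  -- image the series variable `z` stands for the interpolation parameter r; it no longer marks the
  -- weight.
  φ : ℝ[X] → PS
  φ p i = approx (coeff p i) M

  φ-const : ∀ c → φ (const c) ≋ C (approx c M)
  φ-const c zero    = ≡.refl
  φ-const c (suc n) = ≡.refl

  φ-X : φ X ≋ z
  φ-X 0             = ≡.refl
  φ-X 1             = ≡.refl
  φ-X (suc (suc n)) = ≡.refl

  φ-+ : ∀ p q → φ (p +ₚ q) ≋ φ p ⊞ φ q
  φ-+ []      q       n       = ≡.sym (ℚ.+-identityˡ (φ q n))
  φ-+ (c ∷ p) []      n       = ≡.sym (ℚ.+-identityʳ (φ (c ∷ p) n))
  φ-+ (c ∷ p) (d ∷ q) zero    = ≡.refl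
  φ-+ (c ∷ p) (d ∷ q) (suc n) = φ-+ p q n

  φ-scale : ∀ c p n → φ (map (c *_) p) n ≡ approx c M ℚ.* φ p n
  φ-scale c []      n       = ≡.sym (ℚ.*-zeroʳ (approx c M))
  φ-scale c (d ∷ p) zero    = ≡.refl
  φ-scale c (d ∷ p) (suc n) = φ-scale c p n

  φ-neg : ∀ p → φ (map -_ p) ≋ ⊟ φ p
  φ-neg []      n       = ≡.refl
  φ-neg (c ∷ p) zero    = ≡.refl
  φ-neg (c ∷ p) (suc n) = φ-neg p n

  φ-* : ∀ p q → φ (p *ₚ q) ≋ φ p ⊛ φ q
  φ-* []      q n       = ≡.sym (≡.trans (⊛-comm (λ _ → 0ℚ) (φ q) n) (θ-Derivation.⊛-0 (φ q) n))
  φ-* (c ∷ p) q zero    = ≡.trans (φ-+ (map (c *_) q) (fromℚ 0ℚ ∷ p *ₚ q) 0)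
    (≡.trans (ℚ.+-identityʳ (φ (map (c *_) q) 0)) (φ-scale c q 0))
  φ-* (c ∷ p) q (suc n) = ≡.trans (φ-+ (map (c *_) q) (fromℚ 0ℚ ∷ p *ₚ q) (suc n))
    (cong₂ ℚ._+_ (φ-scale c q (suc n)) (φ-* p q n))

  φ-^ : ∀ p n → φ (p ^ₚ n) ≋ φ p PSF.^ n
  φ-^ p zero    = φ-const (fromℚ 1ℚ)
  φ-^ p (suc n) i = ≡.trans (φ-* p (p ^ₚ n) i) (⊛-cong {φ p} (λ _ → ≡.refl) (φ-^ p n) i)

  φ-∑ : ∀ {A : Set} (xs : List A) (f : A → ℝ[X]) → φ (∑ₚ xs f) ≋ PSF.∑ xs (φ ∘ f)
  φ-∑ []       f n = ≡.refl
  φ-∑ (x ∷ xs) f n = ≡.trans (φ-+ (f x) (∑ₚ xs f) n) (cong (φ (f x) n ℚ.+_) (φ-∑ xs f n))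

  ^-cong : ∀ {f g} → f ≋ g → ∀ n → f PSF.^ n ≋ g PSF.^ n
  ^-cong f≋g zero    = λ _ → ≡.refl
  ^-cong f≋g (suc n) = ⊛-cong f≋g (^-cong f≋g n)

  module _ (N a : ℕ) where
    open Interpolation PowerSeries.ring C-homomorphism z (node N a) (tPartial N a)
      (λ _ → ≡.refl) (λ _ _ → ≡.refl) (tPartial-suc N a) using (Tʳ; s; indices; admissible; admissible-value)
    open GeneratingFunction using (state)

    φ-tʳ : ∀ k ks → φ (tʳ N a (k , ks)) ≋ Tʳ M k ks
    φ-tʳ k ks n = ≡.trans (φ-∑ (contractions k ks) F n)
      (Sums.∑-cong PowerSeries.ring (contractions k ks) (λ 𝐩 i → ≡.trans (φ-* (X ^ₚ (dep (k , ks) ∸ dep 𝐩)) (const (t N a 𝐩)) i)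
        (⊛-cong {g = φ (const (t N a 𝐩))} (λ j → ≡.trans (φ-^ X (dep (k , ks) ∸ dep 𝐩) j) (^-cong φ-X (dep (k , ks) ∸ dep 𝐩) j)) (φ-const (t N a 𝐩)) i)) n)
      where
      F : Index 1 → ℝ[X]
      F 𝐩 = X ^ₚ (dep (k , ks) ∸ dep 𝐩) *ₚ const (t N a 𝐩)

    φ-s : φ (const (fromℚ 1ℚ) -ₚ const (fromℚ (+ 2 / 1)) *ₚ X) ≋ s
    φ-s n = ≡.trans (φ-+ (const (fromℚ 1ℚ)) (map -_ (const (fromℚ (+ 2 / 1)) *ₚ X)) n)
      (cong₂ ℚ._+_ (φ-const (fromℚ 1ℚ) n) (≡.trans (φ-neg (const (fromℚ (+ 2 / 1)) *ₚ X) n)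
        (cong ℚ.-_ (≡.trans (φ-* (const (fromℚ (+ 2 / 1))) X n) (⊛-cong {g = φ X} (φ-const (fromℚ (+ 2 / 1))) φ-X n)))))

    φ-sum : ∀ {k m} v → k ≡ 2 ℕ.+ v → m ≡ suc v → φ (∑ₚ (applyUpTo suc m) (λ n →
        (const (fromℚ 1ℚ) -ₚ const (fromℚ (+ 2 / 1)) *ₚ X) ^ₚ (k ∸ n ∸ 1)
          *ₚ const (fromℚ (+ 2 / 1)) ^ₚ (n ∸ 1)
          *ₚ ∑ₚ (I₀ k n) (tʳ N a)))
      ≋ C (proj₂ (state (node N a) M) v)
    φ-sum v ≡.refl ≡.refl = begin
      φ (∑ₚ (applyUpTo suc (suc v)) F)           ≈⟨ φ-∑ (applyUpTo suc (suc v)) F ⟩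
      PSF.∑ (applyUpTo suc (suc v)) (φ ∘ F)      ≈⟨ Sums.∑-cong PowerSeries.ring (applyUpTo suc (suc v)) {φ ∘ F} {F′} term≋ ⟩
      PSF.∑ (applyUpTo suc (suc v)) F′           ≈⟨ indices M v ⟩
      admissible (Tʳ M) v                        ≈⟨ admissible-value M v ⟩
      C (proj₂ (state (node N a) M) v)           ∎
      where
      open SetoidReasoning (CommutativeRing.setoid PowerSeries.ring)
      S = const (fromℚ 1ℚ) -ₚ const (fromℚ (+ 2 / 1)) *ₚ X
      2ₚ = const (fromℚ (+ 2 / 1))
      F : ℕ → ℝ[X]
      F n = S ^ₚ (2 ℕ.+ v ∸ n ∸ 1) *ₚ 2ₚ ^ₚ (n ∸ 1) *ₚ ∑ₚ (I₀ (2 ℕ.+ v) n) (tʳ N a)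
      F′ : ℕ → PS
      F′ n = s PSF.^ (2 ℕ.+ v ∸ n ∸ 1) ⊛ C (ι 2) PSF.^ (n ∸ 1) ⊛ PSF.∑ (I₀ (2 ℕ.+ v) n) (λ (k , ks) → Tʳ M k ks)
      term≋ : ∀ n → φ (F n) ≋ F′ n
      term≋ n j = ≡.trans (φ-* (S ^ₚ (2 ℕ.+ v ∸ n ∸ 1) *ₚ 2ₚ ^ₚ (n ∸ 1)) (∑ₚ (I₀ (2 ℕ.+ v) n) (tʳ N a)) j)
        (⊛-cong (λ l → ≡.trans (φ-* (S ^ₚ (2 ℕ.+ v ∸ n ∸ 1)) (2ₚ ^ₚ (n ∸ 1)) l)
            (⊛-cong (λ m → ≡.trans (φ-^ S (2 ℕ.+ v ∸ n ∸ 1) m) (^-cong φ-s (2 ℕ.+ v ∸ n ∸ 1) m))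
              (λ m → ≡.trans (φ-^ 2ₚ (n ∸ 1) m) (^-cong (φ-const (fromℚ (+ 2 / 1))) (n ∸ 1) m)) l))
          (λ l → ≡.trans (φ-∑ (I₀ (2 ℕ.+ v) n) (tʳ N a) l) (Sums.∑-cong PowerSeries.ring (I₀ (2 ℕ.+ v) n) (λ (k , ks) → φ-tʳ k ks) l)) j)

-- Convergence of rational sequences to real numbers

infix 4 _⇝_
record _⇝_ (x : ℕ → ℚ) (r : ℝ) : Set where
  constructor converges
  field
    difference : Null (λ n → x n ℚ.- approx r n)
open _⇝_ public

module Convergent where
  open Limits
  open ℚ-Solver

  ⇝-cong : ∀ {x y r} → (∀ n → x n ≡ y n) → x ⇝ r → y ⇝ r
  ⇝-cong {r = r} x≡y (converges d) = converges (Null-cong (λ n → cong (ℚ._- approx r n) (x≡y n)) d)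

  ⇝-limit-cong : ∀ {x r r′} → (∀ n → approx r n ≡ approx r′ n) → x ⇝ r → x ⇝ r′
  ⇝-limit-cong {x} r≡r′ (converges d) = converges (Null-cong (λ n → cong (λ y → x n ℚ.- y) (r≡r′ n)) d)

  ⇝-Null : ∀ {x y r} → x ⇝ r → Null (λ n → y n ℚ.- x n) → y ⇝ r
  ⇝-Null {x} {y} {r} (converges d) e = converges (Null-cong
    (λ n → solve 3 (λ x y r → x :- r :+ (y :- x) := y :- r) ≡.refl (x n) (y n) (approx r n)) (Null-+ d e))

  ⇝-const : ∀ q → (λ _ → q) ⇝ fromℚ q
  ⇝-const q = converges (Null-cong (λ _ → ≡.sym (ℚ.+-inverseʳ q)) Null-0)

  ⇝-approx : ∀ r → approx r ⇝ r
  ⇝-approx r = converges (Null-cong (λ n → ≡.sym (ℚ.+-inverseʳ (approx r n))) Null-0)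

  ⇝-+ : ∀ {x x′ r r′} → x ⇝ r → x′ ⇝ r′ → (λ n → x n ℚ.+ x′ n) ⇝ r + r′
  ⇝-+ {x} {x′} {r} {r′} (converges d) (converges d′) = converges (Null-cong
    (λ n → solve 4 (λ x r x′ r′ → x :- r :+ (x′ :- r′) := x :+ x′ :- (r :+ r′)) ≡.refl (x n) (approx r n) (x′ n) (approx r′ n))
    (Null-+ d d′))

  real-bounded : ∀ r → ∃ λ B → ∃ λ N → ∀ n → N ℕ.≤ n → ℚ.∣ approx r n ∣ ℚ.≤ B
  real-bounded r = let B , _ , N , r≤B = CauchyLemmas.bounded (cauchy r) in B , N , r≤B

  ⇝-* : ∀ {x x′ r r′} → x ⇝ r → x′ ⇝ r′ → (λ n → x n ℚ.* x′ n) ⇝ r * r′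
  ⇝-* {x} {x′} {r} {r′} (converges d) (converges d′) = converges (Null-cong
    (λ n → solve 4 (λ x r x′ r′ → (x :- r) :* (x′ :- r′) :+ ((x :- r) :* r′ :+ (x′ :- r′) :* r) := x :* x′ :- r :* r′) ≡.refl
      (x n) (approx r n) (x′ n) (approx r′ n))
    (Null-+ (Null-* 1ℚ (let N , small≤ = small d′ 1ℚ (ℚ.positive⁻¹ 1ℚ) in N , λ n n≥ → ℚ.<⇒≤ (small≤ n n≥)) d)
      (Null-+ (Null-* (proj₁ (real-bounded r′)) (proj₂ (real-bounded r′)) d) (Null-* (proj₁ (real-bounded r)) (proj₂ (real-bounded r)) d′))))

  ⇝-^ : ∀ {x r} → x ⇝ r → ∀ m → (λ n → x n ℚF.^ m) ⇝ r ^ m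
  ⇝-^ x⇝r zero    = ⇝-const 1ℚ
  ⇝-^ {x} {r} x⇝r (suc m) = ⇝-limit-cong {r = r * r ^ m} {r ^ suc m} (λ _ → ≡.refl) (⇝-* {x} {λ n → x n ℚF.^ m} {r} {r ^ m} x⇝r (⇝-^ x⇝r m))

  ⇝-∑ : ∀ {A : Set} (as : List A) {x : A → ℕ → ℚ} {r : A → ℝ} → (∀ a → x a ⇝ r a) → (λ n → ℚF.∑ as (λ a → x a n)) ⇝ ∑ as r
  ⇝-∑ []       x⇝r = ⇝-const 0ℚ
  ⇝-∑ (a ∷ as) {x} {r} x⇝r = ⇝-limit-cong {r = r a + ∑ as r} {∑ (a ∷ as) r} (λ _ → ≡.refl)
    (⇝-+ {x a} {λ n → ℚF.∑ as (λ b → x b n)} {r a} {∑ as r} (x⇝r a) (⇝-∑ as x⇝r))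

  ⇝-∏ : ∀ {A : Set} (as : List A) {x : A → ℕ → ℚ} {r : A → ℝ} → (∀ a → x a ⇝ r a) → (λ n → ℚF.∏ as (λ a → x a n)) ⇝ ∏ as r
  ⇝-∏ []       x⇝r = ⇝-const 1ℚ
  ⇝-∏ (a ∷ as) {x} {r} x⇝r = ⇝-limit-cong {r = r a * ∏ as r} {∏ (a ∷ as) r} (λ _ → ≡.refl)
    (⇝-* {x a} {λ n → ℚF.∏ as (λ b → x b n)} {r a} {∏ as r} (x⇝r a) (⇝-∏ as x⇝r))

  Null-subsequence : ∀ r (f : ℕ → ℕ) → (∀ n → n ℕ.≤ f n) → Null (λ n → approx r (f n) ℚ.- approx r n)
  Null-subsequence r f n≤f = null λ ε 0<ε → let N , close = cauchy r ε 0<ε in N , λ n n≥ → close (f n) n (ℕ.≤-trans n≥ (n≤f n)) n≥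

  ⇝-subsequence : ∀ r (f : ℕ → ℕ) → (∀ n → n ℕ.≤ f n) → (approx r ∘ f) ⇝ r
  ⇝-subsequence r f n≤f = converges (Null-subsequence r f n≤f)

  -- A Cauchy sequence has the limit of any of its subsequences. This allows truncation at multiples
  -- of 2a only.
  subsequence-≈ : ∀ r r′ (f : ℕ → ℕ) → (∀ n → n ℕ.≤ f n) → (approx r ∘ f) ⇝ r′ → r ≈ r′
  subsequence-≈ r r′ f n≤f (converges d) = small (Null-cong
    (λ n → solve 3 (λ a b c → :- (a :- b) :+ (a :- c) := b :- c) ≡.refl (approx r (f n)) (approx r n) (approx r′ n))
    (Null-+ (Null-neg (Null-subsequence r f n≤f)) d))

-- Limits of the coefficients of the logarithmic derivative

module PowerSums where
  open Limits
  open ℚ-Solver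
  open ℚF using () renaming (_^_ to _^ℚ_)
  open LogDerivativeOfProduct using (P; P-suc; powers-suc)
  open Convergent
  open GeneratingFunction using (odd)

  oddSum fullSum : ℕ → ℕ → ℚ
  oddSum k zero     = 0ℚ
  oddSum k (suc L)  = oddSum k L ℚ.+ odd L ^ℚ k
  fullSum k zero    = 0ℚ
  fullSum k (suc M) = fullSum k M ℚ.+ w M ^ℚ k

  ^-* : ∀ x y n → (x ℚ.* y) ^ℚ n ≡ x ^ℚ n ℚ.* y ^ℚ n
  ^-* x y zero    = ≡.refl
  ^-* x y (suc n) = ≡.trans (cong (x ℚ.* y ℚ.*_) (^-* x y n))
    (solve 4 (λ x y a b → x :* y :* (a :* b) := x :* a :* (y :* b)) ≡.refl x y (x ^ℚ n) (y ^ℚ n))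

  1^ : ∀ n → 1ℚ ^ℚ n ≡ 1ℚ
  1^ zero    = ≡.refl
  1^ (suc n) = ≡.trans (ℚ.*-identityˡ (1ℚ ^ℚ n)) (1^ n)

  w-even : ∀ M → w (suc (M ℕ.+ M)) ≡ ½ ℚ.* w M
  w-even M = ≡.trans (cong w (≡.sym (ℕ.+-suc M M))) (≡.trans
    (solve 1 (λ x → x := con ½ :* (x :+ x)) ≡.refl (w (M ℕ.+ suc M))) (cong (½ ℚ.*_) (≡.sym (w-double M))))

  -- The truncated form of ζ(k) = t(k) + 2⁻ᵏ ζ(k): the even terms up to 2L are 2⁻ᵏ times the full
  -- sum up to L.
  fullSum-double : ∀ k L → fullSum k (L ℕ.+ L) ≡ oddSum k L ℚ.+ ½ ^ℚ k ℚ.* fullSum k L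
  fullSum-double k zero    = ≡.sym (≡.trans (ℚ.+-identityˡ (½ ^ℚ k ℚ.* 0ℚ)) (ℚ.*-zeroʳ (½ ^ℚ k)))
  fullSum-double k (suc L) = begin
    fullSum k (suc (L ℕ.+ suc L))
      ≡⟨ cong (λ m → fullSum k (suc m)) (ℕ.+-suc L L) ⟩
    fullSum k (L ℕ.+ L) ℚ.+ w (L ℕ.+ L) ^ℚ k ℚ.+ w (suc (L ℕ.+ L)) ^ℚ k
      ≡⟨ cong₂ (λ x y → x ℚ.+ odd L ^ℚ k ℚ.+ y) (fullSum-double k L) (≡.trans (cong (_^ℚ k) (w-even L)) (^-* ½ (w L) k)) ⟩
    oddSum k L ℚ.+ ½ ^ℚ k ℚ.* fullSum k L ℚ.+ odd L ^ℚ k ℚ.+ ½ ^ℚ k ℚ.* w L ^ℚ k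
      ≡⟨ solve 5 (λ o h f d e → o :+ h :* f :+ d :+ h :* e := o :+ d :+ h :* (f :+ e)) ≡.refl (oddSum k L) (½ ^ℚ k) (fullSum k L) (odd L ^ℚ k) (w L ^ℚ k) ⟩
    oddSum k L ℚ.+ odd L ^ℚ k ℚ.+ ½ ^ℚ k ℚ.* (fullSum k L ℚ.+ w L ^ℚ k) ∎
    where open ≡.≡-Reasoning

  inv≡w^ : ∀ m i → inv m i ≡ w m ^ℚ suc i
  inv≡w^ m zero    = ≡.sym (ℚ.*-identityʳ (w m))
  inv≡w^ m (suc i) = cong (w m ℚ.*_) (inv≡w^ m i)

  P-value : ∀ L i → let k = suc i in
    P L k ≡ ι 2 ℚ.* (oddSum k L ℚ.- ½ ^ℚ k ℚ.* fullSum k L) ℚ.+ odd L ^ℚ k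
  P-value zero    i = ≡.trans (powers-suc 0 i) (≡.trans (inv≡w^ 0 i)
    (solve 2 (λ h x → x := con (ι 2) :* (con 0ℚ :- h :* con 0ℚ) :+ x) ≡.refl (½ ^ℚ suc i) (w 0 ^ℚ suc i)))
  P-value (suc L) i = begin
    P (suc L) k
      ≡⟨ P-suc L i ⟩
    P L k ℚ.+ ((inv (L ℕ.+ L) i ℚ.+ inv (suc (suc (L ℕ.+ L))) i) ℚ.+ (ℚ.- inv (suc (L ℕ.+ L)) i ℚ.+ ℚ.- inv (suc (L ℕ.+ L)) i))
      ≡⟨ cong₂ ℚ._+_ (P-value L i) (cong₂ ℚ._+_ (cong₂ ℚ._+_ (inv≡w^ (L ℕ.+ L) i) (≡.trans (inv≡w^ (suc (suc (L ℕ.+ L))) i)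
           (cong (λ m → w (suc m) ^ℚ k) (≡.sym (ℕ.+-suc L L))))) (cong₂ (λ x y → ℚ.- x ℚ.+ ℚ.- y) even≡ even≡)) ⟩
    ι 2 ℚ.* (O ℚ.- h ℚ.* F) ℚ.+ x ℚ.+ ((x ℚ.+ odd (suc L) ^ℚ k) ℚ.+ (ℚ.- (h ℚ.* y) ℚ.+ ℚ.- (h ℚ.* y)))
      ≡⟨ solve 6 (λ o h f x x′ y → con (ι 2) :* (o :- h :* f) :+ x :+ ((x :+ x′) :+ (:- (h :* y) :+ :- (h :* y))) :=
           con (ι 2) :* (o :+ x :- h :* (f :+ y)) :+ x′) ≡.refl O h F x (odd (suc L) ^ℚ k) y ⟩
    ι 2 ℚ.* (O ℚ.+ x ℚ.- h ℚ.* (F ℚ.+ y)) ℚ.+ odd (suc L) ^ℚ k ∎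
    where
    open ≡.≡-Reasoning
    k = suc i
    O = oddSum k L
    F = fullSum k L
    h = ½ ^ℚ k
    x = odd L ^ℚ k
    y = w L ^ℚ k
    even≡ : inv (suc (L ℕ.+ L)) i ≡ h ℚ.* y
    even≡ = ≡.trans (inv≡w^ (suc (L ℕ.+ L)) i) (≡.trans (cong (_^ℚ k) (w-even L)) (^-* ½ (w L) k))

  oddSum-tPartial : ∀ k L → 0 ℕ.< k → tPartial 2 1 (L ℕ.* 2) (k ∷ []) ≡ oddSum k L
  oddSum-tPartial k@(suc _) zero    0<k = ≡.refl
  oddSum-tPartial k@(suc k′) (suc L) 0<k = ≡.trans (block L)
    (cong₂ (λ s x → s ℚ.+ x ^ℚ k) (oddSum-tPartial k L 0<k) (ℚ.*-identityˡ (odd L)))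
    where
    open Level2a.Blocks 0 ≡.isEquivalence (λ x s → s ℚ.+ x ^ℚ k) (λ x → cong (ℚ._+ x ^ℚ k))
      (λ s → ≡.trans (cong (s ℚ.+_) (ℚ.*-zeroˡ (0ℚ ^ℚ k′))) (ℚ.+-identityʳ s)) (λ M → tPartial 2 1 M (k ∷ []))
      (λ M → ≡.trans (tPartial-suc 2 1 M k [] 0<k) (cong (tPartial 2 1 M (k ∷ []) ℚ.+_) (ℚ.*-identityʳ (node 2 1 M ^ℚ k))))

  fullSum-tPartial : ∀ k M → 0 ℕ.< k → tPartial 1 1 M (k ∷ []) ≡ fullSum k M
  fullSum-tPartial k       zero    0<k = ≡.refl
  fullSum-tPartial k (suc M) 0<k = ≡.trans (tPartial-suc 1 1 M k [] 0<k)
    (cong₂ ℚ._+_ (fullSum-tPartial k M 0<k) (≡.trans (ℚ.*-identityʳ (node 1 1 M ^ℚ k)) (cong (_^ℚ k) node≡w)))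
    where
    node≡w : node 1 1 M ≡ w M
    node≡w with 1 ∣? ℕ.∣ suc M - 1 ∣
    ... | yes _ = ≡.refl
    ... | no ¬1∣ = contradiction (1∣ _) ¬1∣

  odd-Null : ∀ i → Null (λ L → odd L ^ℚ suc i)
  odd-Null i = Null-≤ (λ L → ∣nonneg∣≤ (0≤w^ (L ℕ.+ L) (suc i)) (w^≤w (L ℕ.+ L) (suc i) (ℕ.s≤s ℕ.z≤n)))
    (Null-∘ (λ L → L ℕ.+ L) (λ L → ℕ.m≤m+n L L) w-Null)

  oddSum-⇝ : ∀ (k : Part 1) → oddSum (proj₁ k) ⇝ t₁ k
  oddSum-⇝ k@(j , 1<j) = ⇝-cong (λ L → oddSum-tPartial j L (ℕ.<-trans (ℕ.s≤s ℕ.z≤n) 1<j))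
    (⇝-subsequence (t₁ k) (ℕ._* 2) (λ L → ℕ.m≤m*n L 2))

  -- These sums are truncated t-values of level 1, that is ζ(k), and hence Cauchy.
  fullSum-Null : ∀ (k : Part 1) → Null (λ L → fullSum (proj₁ k) (L ℕ.+ L) ℚ.- fullSum (proj₁ k) L)
  fullSum-Null k@(j , 1<j) = Null-cong (λ L → cong₂ ℚ._-_ (fullSum-tPartial j (L ℕ.+ L) 0<j) (fullSum-tPartial j L 0<j))
    (Null-subsequence (t 1 1 (k , [])) (λ L → L ℕ.+ L) (λ L → ℕ.m≤m+n L L))
    where 0<j = ℕ.<-trans (ℕ.s≤s ℕ.z≤n) 1<j

  -- For k = 1 the odd and the even sum diverge separately. Their difference is the alternating
  -- harmonic sum of length 2L, which equals the sum of 1/(L + i) over 1 ≤ i ≤ L.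
  P-1 : ∀ L → P L 1 ≡ ι 2 ℚ.* log2Partial L ℚ.+ odd L
  P-1 zero    = ≡.trans (powers-suc 0 0) (≡.sym (≡.trans (cong (ℚ._+ w 0) (ℚ.*-zeroʳ (ι 2))) (ℚ.+-identityˡ (w 0))))
  P-1 (suc L) = begin
    P (suc L) 1
      ≡⟨ P-suc L 0 ⟩
    P L 1 ℚ.+ ((x ℚ.+ w (suc (suc (L ℕ.+ L)))) ℚ.+ (ℚ.- y ℚ.+ ℚ.- y))
      ≡⟨ cong₂ (λ p x′ → p ℚ.+ ((x ℚ.+ x′) ℚ.+ (ℚ.- y ℚ.+ ℚ.- y))) (P-1 L) (cong (λ m → w (suc m)) (≡.sym (ℕ.+-suc L L))) ⟩
    ι 2 ℚ.* log2Partial L ℚ.+ x ℚ.+ ((x ℚ.+ x′) ℚ.+ (ℚ.- y ℚ.+ ℚ.- y))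
      ≡⟨ solve 4 (λ l x x′ y → con (ι 2) :* l :+ x :+ ((x :+ x′) :+ (:- y :+ :- y)) := con (ι 2) :* (l :+ x :- y) :+ x′) ≡.refl (log2Partial L) x x′ y ⟩
    ι 2 ℚ.* (log2Partial L ℚ.+ x ℚ.- y) ℚ.+ x′
      ≡⟨ cong (λ l → ι 2 ℚ.* (l ℚ.- y) ℚ.+ x′) (≡.trans (≡.sym (log2-step L)) (cong (λ m → log2Partial (suc L) ℚ.+ w m) (ℕ.+-suc L L))) ⟩
    ι 2 ℚ.* (log2Partial (suc L) ℚ.+ y ℚ.- y) ℚ.+ x′
      ≡⟨ solve 3 (λ l x′ y → con (ι 2) :* (l :+ y :- y) :+ x′ := con (ι 2) :* l :+ x′) ≡.refl (log2Partial (suc L)) x′ y ⟩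
    ι 2 ℚ.* log2Partial (suc L) ℚ.+ x′ ∎
    where
    open ≡.≡-Reasoning
    x  = odd L
    x′ = odd (suc L)
    y  = w (suc (L ℕ.+ L))

  P-1-⇝ : (λ L → P L 1) ⇝ fromℚ (ι 2) * log2
  P-1-⇝ = ⇝-Null (⇝-* {r = fromℚ (ι 2)} {log2} (⇝-const (ι 2)) (⇝-approx log2))
    (Null-cong (λ L → ≡.trans (ℚ.*-identityʳ (odd L)) (≡.sym (≡.trans (cong (ℚ._- ι 2 ℚ.* log2Partial L) (P-1 L))
      (solve 2 (λ l x → con (ι 2) :* l :+ x :- con (ι 2) :* l := x) ≡.refl (log2Partial L) (odd L))))) (odd-Null 0))

  /-*-cancel : ∀ m n .{{_ : ℕ.NonZero n}} → (+ m / n) ℚ.* ι n ≡ ι m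
  /-*-cancel m (suc d) = ℚ.toℚᵘ-injective (ℚᵘ.≃-trans (ℚ.toℚᵘ-homo-* (+ m / suc d) (ι (suc d)))
    (ℚᵘ.≃-trans (ℚᵘ.*-cong (ℚ.toℚᵘ-fromℚᵘ (mkℚᵘ (+ m) d)) (ℚ.toℚᵘ-fromℚᵘ (mkℚᵘ (+ suc d) 0)))
    (ℚᵘ.≃-trans (*≡* (≡.trans (ℤ.*-identityʳ (+ m ℤ.* + suc d)) (cong (λ n → + m ℤ.* + suc n) (≡.sym (ℕ.*-identityʳ d)))))
      (ℚᵘ.≃-sym (ℚ.toℚᵘ-fromℚᵘ (mkℚᵘ (+ m) 0))))))

  Mersenne≢0 : (k : Part 1) → ℕ.NonZero (2 ℕ.^ proj₁ k ∸ 1)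
  Mersenne≢0 (j , 1<j) = ℕ.>-nonZero (ℕ.m<n⇒0<n∸m (ℕ.^-monoʳ-≤ 2 {1} {j} (ℕ.<⇒≤ 1<j)))

  -- The limit 2 (t(k) - 2⁻ᵏ ζ(k)) becomes `ratio k` times t(k) = 4 (2^(k-1) - 1)/(2ᵏ - 1) · t(k)
  -- when ζ(k) is eliminated by t(k) = (1 - 2⁻ᵏ) ζ(k).
  δ ratio : Part 1 → ℚ
  δ k = (+ 1 / (2 ℕ.^ proj₁ k ∸ 1)) {{Mersenne≢0 k}}
  ratio k = ι (4 ℕ.* (2 ℕ.^ (proj₁ k ∸ 1) ∸ 1)) ℚ.* δ k

  ι-∸1 : ∀ n → 1 ℕ.≤ n → ι (n ∸ 1) ≡ ι n ℚ.- 1ℚ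
  ι-∸1 (suc n) _ = ≡.sym (≡.trans (cong (ℚ._- 1ℚ) (ι-suc n)) (solve 1 (λ i → con 1ℚ :+ i :- con 1ℚ := i) ≡.refl (ι n)))

  P-⇝ : ∀ (k : Part 1) → (λ L → P L (proj₁ k)) ⇝ fromℚ (ratio k) * t₁ k
  P-⇝ k@(suc i , 1<j) = ⇝-Null (⇝-* {r = fromℚ (ratio k)} {t₁ k} (⇝-const (ratio k)) (oddSum-⇝ k))
    (Null-cong (λ L → ≡.sym (≡.trans (cong (ℚ._- ratio k ℚ.* oddSum j L) (P-value L i)) (rearrange L)))
      (Null-+ (Null-scale (ι 2 ℚ.* δ k) (fullSum-Null k)) (odd-Null i)))
    where
    j = suc i
    p = ι (2 ℕ.^ i)
    h = ½ ^ℚ j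
    1≤2^ : ∀ n → 1 ℕ.≤ 2 ℕ.^ n
    1≤2^ n = ℕ.m^n>0 2 n
    ratio≡ : ratio k ≡ ι 4 ℚ.* (p ℚ.- 1ℚ) ℚ.* δ k
    ratio≡ = cong (ℚ._* δ k) (≡.trans (ι-* 4 (2 ℕ.^ i ∸ 1)) (cong (ι 4 ℚ.*_) (ι-∸1 (2 ℕ.^ i) (1≤2^ i))))
    δ-law : δ k ℚ.* (ι 2 ℚ.* p ℚ.- 1ℚ) ≡ 1ℚ
    δ-law = ≡.trans (cong (δ k ℚ.*_) (≡.trans (cong (ℚ._- 1ℚ) (≡.sym (ι-* 2 (2 ℕ.^ i)))) (≡.sym (ι-∸1 (2 ℕ.^ j) (1≤2^ j)))))
      (/-*-cancel 1 (2 ℕ.^ j ∸ 1) {{Mersenne≢0 k}})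
    ½^-law : ∀ n → ½ ^ℚ n ℚ.* ι (2 ℕ.^ n) ≡ 1ℚ
    ½^-law zero    = ≡.refl
    ½^-law (suc n) = ≡.trans (cong (½ ^ℚ suc n ℚ.*_) (ι-* 2 (2 ℕ.^ n)))
      (≡.trans (solve 2 (λ a b → con ½ :* a :* (con (ι 2) :* b) := a :* b) ≡.refl (½ ^ℚ n) (ι (2 ℕ.^ n))) (½^-law n))
    h-law : ι 2 ℚ.* p ℚ.* h ≡ 1ℚ
    h-law = ≡.trans (cong (ℚ._* h) (≡.sym (ι-* 2 (2 ℕ.^ i)))) (≡.trans (ℚ.*-comm (ι (2 ℕ.^ j)) h) (½^-law j))
    rearrange : ∀ L → ι 2 ℚ.* (oddSum j L ℚ.- h ℚ.* fullSum j L) ℚ.+ odd L ^ℚ j ℚ.- ratio k ℚ.* oddSum j L ≡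
      ι 2 ℚ.* δ k ℚ.* (fullSum j (L ℕ.+ L) ℚ.- fullSum j L) ℚ.+ odd L ^ℚ j
    rearrange L = begin
      ι 2 ℚ.* (O ℚ.- h ℚ.* F) ℚ.+ b ℚ.- ratio k ℚ.* O
        ≡⟨ cong (λ e → ι 2 ℚ.* (O ℚ.- h ℚ.* F) ℚ.+ b ℚ.- e ℚ.* O) ratio≡ ⟩
      ι 2 ℚ.* (O ℚ.- h ℚ.* F) ℚ.+ b ℚ.- ι 4 ℚ.* (p ℚ.- 1ℚ) ℚ.* δ k ℚ.* O
        -- The last two summands are multiples of the defects in `δ-law` and `h-law`. With them the
        -- equation is a polynomial identity, and the two laws then turn them into 0.
        ≡⟨ solve 6 (λ o h f b p d → let 2′ = con (ι 2) in
             2′ :* (o :- h :* f) :+ b :- con (ι 4) :* (p :- con 1ℚ) :* d :* o :=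
             2′ :* d :* (o :+ h :* f :- f) :+ b
               :+ 2′ :* (con 1ℚ :- d :* (2′ :* p :- con 1ℚ)) :* (o :- h :* f) :+ 2′ :* d :* (con 1ℚ :- 2′ :* p :* h) :* f)
             ≡.refl O h F b p (δ k) ⟩
      main ℚ.+ ι 2 ℚ.* (1ℚ ℚ.- δ k ℚ.* (ι 2 ℚ.* p ℚ.- 1ℚ)) ℚ.* (O ℚ.- h ℚ.* F) ℚ.+ ι 2 ℚ.* δ k ℚ.* (1ℚ ℚ.- ι 2 ℚ.* p ℚ.* h) ℚ.* F
        ≡⟨ cong₂ (λ x y → main ℚ.+ ι 2 ℚ.* (1ℚ ℚ.- x) ℚ.* (O ℚ.- h ℚ.* F) ℚ.+ ι 2 ℚ.* δ k ℚ.* (1ℚ ℚ.- y) ℚ.* F) δ-law h-law ⟩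
      main ℚ.+ ι 2 ℚ.* (1ℚ ℚ.- 1ℚ) ℚ.* (O ℚ.- h ℚ.* F) ℚ.+ ι 2 ℚ.* δ k ℚ.* (1ℚ ℚ.- 1ℚ) ℚ.* F
        ≡⟨ solve 4 (λ m x d f → m :+ con (ι 2) :* (con 1ℚ :- con 1ℚ) :* x :+ con (ι 2) :* d :* (con 1ℚ :- con 1ℚ) :* f := m) ≡.refl main (O ℚ.- h ℚ.* F) (δ k) F ⟩
      main
        ≡⟨ cong (λ x → ι 2 ℚ.* δ k ℚ.* (x ℚ.- F) ℚ.+ b) (fullSum-double j L) ⟨
      ι 2 ℚ.* δ k ℚ.* (fullSum j (L ℕ.+ L) ℚ.- F) ℚ.+ b ∎
      where
      open ≡.≡-Reasoning
      O = oddSum j L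
      F = fullSum j L
      b = odd L ^ℚ j
      main = ι 2 ℚ.* δ k ℚ.* (O ℚ.+ h ℚ.* F ℚ.- F) ℚ.+ b

-- The rational coefficients of the right-hand side

module Coefficients where
  open PowerSums
  open ℚ-Solver
  open ℚF using () renaming (_^_ to _^ℚ_)
  open Exponential using (factorial⁻¹; factorial⁻¹-!)

  ι-^ : ∀ m n → ι (m ℕ.^ n) ≡ ι m ^ℚ n
  ι-^ m zero    = ≡.refl
  ι-^ m (suc n) = ≡.trans (ι-* m (m ℕ.^ n)) (cong (ι m ℚ.*_) (ι-^ m n))

  ι-cancel : ∀ n .{{_ : ℕ.NonZero n}} {x y} → x ℚ.* ι n ≡ y ℚ.* ι n → x ≡ y
  ι-cancel (suc n) {x} {y} eq = θ-Derivation.ι-suc-cancel n (≡.trans (ℚ.*-comm (ι (suc n)) x) (≡.trans eq (ℚ.*-comm y (ι (suc n)))))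

  factors : List (Part 1) → ℚ
  factors ns = ℚF.∏ ns (λ k → w (proj₁ k ∸ 1) ℚ.* ratio k)

  numerators denominators : List (Part 1) → ℕ
  numerators   ns = product (map (λ (j , _) → 2 ℕ.^ (j ∸ 1) ∸ 1) ns)
  denominators ns = product (map (λ (j , _) → j ℕ.* (2 ℕ.^ j ∸ 1)) ns)

  factor-law : ∀ (k : Part 1) → let j = proj₁ k in
    w (j ∸ 1) ℚ.* ratio k ℚ.* ι (j ℕ.* (2 ℕ.^ j ∸ 1)) ≡ ι (4 ℕ.* (2 ℕ.^ (j ∸ 1) ∸ 1))
  factor-law k@(suc i , _) = begin
    w i ℚ.* (x ℚ.* δ k) ℚ.* ι (suc i ℕ.* D)
      ≡⟨ cong (w i ℚ.* (x ℚ.* δ k) ℚ.*_) (ι-* (suc i) D) ⟩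
    w i ℚ.* (x ℚ.* δ k) ℚ.* (ι (suc i) ℚ.* ι D)
      ≡⟨ solve 5 (λ w x d i D → w :* (x :* d) :* (i :* D) := w :* i :* (d :* D) :* x) ≡.refl (w i) x (δ k) (ι (suc i)) (ι D) ⟩
    w i ℚ.* ι (suc i) ℚ.* (δ k ℚ.* ι D) ℚ.* x
      ≡⟨ cong₂ (λ a b → a ℚ.* b ℚ.* x) (w*ι i) (/-*-cancel 1 D {{Mersenne≢0 k}}) ⟩
    1ℚ ℚ.* 1ℚ ℚ.* x
      ≡⟨ ℚ.*-identityˡ x ⟩
    x ∎
    where
    open ≡.≡-Reasoning
    D = 2 ℕ.^ suc i ∸ 1
    x = ι (4 ℕ.* (2 ℕ.^ i ∸ 1))

  factors-law : ∀ ns → factors ns ℚ.* ι (denominators ns) ≡ ι 4 ^ℚ length ns ℚ.* ι (numerators ns)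
  factors-law []       = ≡.refl
  factors-law (k ∷ ns) = begin
    f ℚ.* factors ns ℚ.* ι (d ℕ.* denominators ns)
      ≡⟨ cong (f ℚ.* factors ns ℚ.*_) (ι-* d (denominators ns)) ⟩
    f ℚ.* factors ns ℚ.* (ι d ℚ.* ι (denominators ns))
      ≡⟨ solve 4 (λ f F d D → f :* F :* (d :* D) := f :* d :* (F :* D)) ≡.refl f (factors ns) (ι d) (ι (denominators ns)) ⟩
    f ℚ.* ι d ℚ.* (factors ns ℚ.* ι (denominators ns))
      ≡⟨ cong₂ ℚ._*_ (≡.trans (factor-law k) (ι-* 4 n)) (factors-law ns) ⟩
    ι 4 ℚ.* ι n ℚ.* (ι 4 ^ℚ length ns ℚ.* ι (numerators ns))
      ≡⟨ solve 4 (λ a b c d → a :* b :* (c :* d) := a :* c :* (b :* d)) ≡.refl (ι 4) (ι n) (ι 4 ^ℚ length ns) (ι (numerators ns)) ⟩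
    ι 4 ^ℚ suc (length ns) ℚ.* (ι n ℚ.* ι (numerators ns))
      ≡⟨ cong (ι 4 ^ℚ suc (length ns) ℚ.*_) (ι-* n (numerators ns)) ⟨
    ι 4 ^ℚ suc (length ns) ℚ.* ι (n ℕ.* numerators ns) ∎
    where
    open ≡.≡-Reasoning
    j = proj₁ k
    f = w (j ∸ 1) ℚ.* ratio k
    d = j ℕ.* (2 ℕ.^ j ∸ 1)
    n = 2 ℕ.^ (j ∸ 1) ∸ 1

  w^*ι^ : ∀ m n → w m ^ℚ n ℚ.* ι (suc m ℕ.^ n) ≡ 1ℚ
  w^*ι^ m n = ≡.trans (cong (w m ^ℚ n ℚ.*_) (ι-^ (suc m) n)) (≡.trans (≡.sym (^-* (w m) (ι (suc m)) n))
    (≡.trans (cong (_^ℚ n) (w*ι m)) (1^ n)))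

  -- In the power 2^(n + 2m) the part 2ⁿ stems from (2 log 2)ⁿ, and each of the m values of `ratio`
  -- supplies a 4.
  coefficient-value : ∀ a′ .{{nz : NonZero (suc a′)}} k n ns → coefficient (suc a′) {{nz}} k n ns ≡
    w a′ ^ℚ k ℚ.* (factorial⁻¹ n ℚ.* ι 2 ^ℚ n ℚ.* (factorial⁻¹ (length ns) ℚ.* factors ns))
  coefficient-value a′ {{nz}} k n ns = ι-cancel (den (suc a′) k n ns) {{den≢0 (suc a′) {{nz}} k n ns}}
    (≡.trans (/-*-cancel (num n ns) (den (suc a′) k n ns) {{den≢0 (suc a′) {{nz}} k n ns}}) (≡.sym (begin
      A ℚ.* (F ℚ.* ι 2 ^ℚ n ℚ.* (G ℚ.* factors ns)) ℚ.* ι (suc a′ ℕ.^ k ℕ.* n ℕ.! ℕ.* l ℕ.! ℕ.* denominators ns)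
        ≡⟨ cong (A ℚ.* (F ℚ.* ι 2 ^ℚ n ℚ.* (G ℚ.* factors ns)) ℚ.*_)
             (≡.trans (ι-* (suc a′ ℕ.^ k ℕ.* n ℕ.! ℕ.* l ℕ.!) (denominators ns)) (cong (ℚ._* ι (denominators ns))
               (≡.trans (ι-* (suc a′ ℕ.^ k ℕ.* n ℕ.!) (l ℕ.!)) (cong (ℚ._* ι (l ℕ.!)) (ι-* (suc a′ ℕ.^ k) (n ℕ.!)))))) ⟩
      A ℚ.* (F ℚ.* ι 2 ^ℚ n ℚ.* (G ℚ.* factors ns)) ℚ.* (ι (suc a′ ℕ.^ k) ℚ.* ι (n ℕ.!) ℚ.* ι (l ℕ.!) ℚ.* ι (denominators ns))
        ≡⟨ solve 9 (λ A F p G f a n l d → A :* (F :* p :* (G :* f)) :* (a :* n :* l :* d) := A :* a :* (F :* n) :* (G :* l) :* (p :* (f :* d))) ≡.refl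
             A F (ι 2 ^ℚ n) G (factors ns) (ι (suc a′ ℕ.^ k)) (ι (n ℕ.!)) (ι (l ℕ.!)) (ι (denominators ns)) ⟩
      A ℚ.* ι (suc a′ ℕ.^ k) ℚ.* (F ℚ.* ι (n ℕ.!)) ℚ.* (G ℚ.* ι (l ℕ.!)) ℚ.* (ι 2 ^ℚ n ℚ.* (factors ns ℚ.* ι (denominators ns)))
        ≡⟨ cong₂ ℚ._*_ (cong₂ ℚ._*_ (cong₂ ℚ._*_ (w^*ι^ a′ k) (factorial⁻¹-! n)) (factorial⁻¹-! l)) (cong (ι 2 ^ℚ n ℚ.*_) (factors-law ns)) ⟩
      1ℚ ℚ.* 1ℚ ℚ.* 1ℚ ℚ.* (ι 2 ^ℚ n ℚ.* (ι 4 ^ℚ l ℚ.* ι (numerators ns)))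
        ≡⟨ solve 3 (λ p q r → con 1ℚ :* con 1ℚ :* con 1ℚ :* (p :* (q :* r)) := p :* q :* r) ≡.refl (ι 2 ^ℚ n) (ι 4 ^ℚ l) (ι (numerators ns)) ⟩
      ι 2 ^ℚ n ℚ.* ι 4 ^ℚ l ℚ.* ι (numerators ns)
        ≡⟨ cong (ℚ._* ι (numerators ns)) (≡.trans (cong₂ ℚ._*_ (≡.sym (ι-^ 2 n)) (≡.sym (ι-^ 4 l))) (≡.sym (ι-* (2 ℕ.^ n) (4 ℕ.^ l)))) ⟩
      ι (2 ℕ.^ n ℕ.* 4 ℕ.^ l) ℚ.* ι (numerators ns)
        ≡⟨ cong (λ m → ι m ℚ.* ι (numerators ns)) (≡.trans (cong (2 ℕ.^ n ℕ.*_) (ℕ.^-*-assoc 2 2 l)) (≡.sym (ℕ.^-distribˡ-+-* 2 n (2 ℕ.* l)))) ⟩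
      ι (2 ℕ.^ (n ℕ.+ 2 ℕ.* l)) ℚ.* ι (numerators ns)
        ≡⟨ ι-* (2 ℕ.^ (n ℕ.+ 2 ℕ.* l)) (numerators ns) ⟨
      ι (num n ns) ∎)))
    where
    open ≡.≡-Reasoning
    l = length ns
    A = w a′ ^ℚ k
    F = factorial⁻¹ n
    G = factorial⁻¹ l

-- Passage to the limit

module Limit where
  open Limits
  open PowerSums
  open Convergent
  open ℚ-Solver
  open ℚF using () renaming (_^_ to _^ℚ_)
  open Exponential using (factorial⁻¹; solutionSum; ∏σ-solutionSum)
  open LogDerivativeOfProduct using (P)
  open Coefficients
  open GeneratingFunction using (odd; state; state-Dixon; state-block; state-scale; ⊛-identityʳ)
  open ℚ-Sums using (∑-cong; ∑-*ˡ)

  two : Part 1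
  two = 2 , ℕ.s≤s (ℕ.s≤s ℕ.z≤n)

  state-constant : ∀ L → proj₁ (state odd L) 0 ≡ 1ℚ
  state-constant zero    = ≡.refl
  state-constant (suc L) = ≡.trans (cong (ℚ._* ((1ℚ ℚ.+ odd L ℚ.* 0ℚ) ℚ.* 1ℚ)) (state-constant L))
    (solve 1 (λ x → con 1ℚ :* ((con 1ℚ :+ x :* con 0ℚ) :* con 1ℚ) := con 1ℚ) ≡.refl (odd L))

  state-oddSum : ∀ L → proj₂ (state odd L) 0 ≡ oddSum 2 L
  state-oddSum zero    = ≡.refl
  state-oddSum (suc L) = cong₂ ℚ._+_ (state-oddSum L) (≡.trans (cong (λ f → odd L ℚ.* odd L ℚ.* (1ℚ ℚ.* f)) (state-constant L))
    (solve 1 (λ x → x :* x :* (con 1ℚ :* con 1ℚ) := x :* (x :* con 1ℚ)) ≡.refl (odd L)))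

  -- Comparison of the constant terms in Dixon's summation identifies the limit of the Wallis
  -- product as the sum of 1/m² over odd m, without a closed form.
  constant-⇝ : (λ L → (inv 0 ⊛ D.∏σ L) 0) ⇝ t₁ two
  constant-⇝ = ⇝-Null {x = oddSum 2} (oddSum-⇝ two) (Null-cong (λ L → cong (λ y → (inv 0 ⊛ D.∏σ L) 0 ℚ.- y)
    (≡.trans (≡.sym (proj₂ (state-Dixon L) 0)) (state-oddSum L))) (∏σ-∑t-Null 0))

  limitFactor : Part 1 → ℝ
  limitFactor k = fromℚ (w (proj₁ k ∸ 1)) * (fromℚ (ratio k) * t₁ k)

  2log2 : ℝ
  2log2 = fromℚ (ι 2) * log2

  limitTerm : ℕ × List (Part 1) → ℝ
  limitTerm (n , ns) = (fromℚ (factorial⁻¹ n) * 2log2 ^ n) * (fromℚ (factorial⁻¹ (length ns)) * ∏ ns limitFactor)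

  limitSum : ℕ → ℝ
  limitSum v = ∑ (solutions v) limitTerm

  limitFactor-⇝ : ∀ k → (λ L → w (proj₁ k ∸ 1) ℚ.* P L (proj₁ k)) ⇝ limitFactor k
  limitFactor-⇝ k = ⇝-* {r = fromℚ (w (proj₁ k ∸ 1))} {fromℚ (ratio k) * t₁ k} (⇝-const (w (proj₁ k ∸ 1))) (P-⇝ k)

  solutionSum-⇝ : ∀ v → (λ L → solutionSum (P L) v) ⇝ limitSum v
  solutionSum-⇝ v = ⇝-∑ (solutions v) {λ (n , ns) L → factorial⁻¹ n ℚ.* P L 1 ^ℚ n ℚ.* (factorial⁻¹ (length ns) ℚ.* ℚF.∏ ns (λ (j , _) → w (j ∸ 1) ℚ.* P L j))} {limitTerm} term-⇝
    where
    term-⇝ : ∀ p → let (n , ns) = p in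
      (λ L → factorial⁻¹ n ℚ.* P L 1 ^ℚ n ℚ.* (factorial⁻¹ (length ns) ℚ.* ℚF.∏ ns (λ (j , _) → w (j ∸ 1) ℚ.* P L j))) ⇝ limitTerm p
    term-⇝ (n , ns) = ⇝-* {r = fromℚ (factorial⁻¹ n) * 2log2 ^ n} {fromℚ (factorial⁻¹ (length ns)) * ∏ ns limitFactor}
      (⇝-* {r = fromℚ (factorial⁻¹ n)} {2log2 ^ n} (⇝-const (factorial⁻¹ n)) (⇝-^ {r = 2log2} P-1-⇝ n))
      (⇝-* {r = fromℚ (factorial⁻¹ (length ns))} {∏ ns limitFactor} (⇝-const (factorial⁻¹ (length ns)))
        (⇝-∏ ns {λ (j , _) L → w (j ∸ 1) ℚ.* P L j} {limitFactor} limitFactor-⇝))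

  module _ (v : ℕ) where
    private
      exact dixon constant solution : ℕ → ℚ
      exact    L = (inv 0 ⊛ D.∏σ L) v
      dixon    L = (inv 0 ⊛ D.∑t 0 L) v
      constant L = (inv 0 ⊛ D.∏σ L) 0
      solution L = solutionSum (P L) v

    exact-⇝ : exact ⇝ t₁ two * limitSum v
    exact-⇝ = ⇝-cong {λ L → constant L ℚ.* solution L} {exact} {t₁ two * limitSum v} (λ L → ≡.sym (∏σ-solutionSum L v))
      (⇝-* {constant} {solution} {t₁ two} {limitSum v} constant-⇝ (solutionSum-⇝ v))

    dixon-⇝ : dixon ⇝ t₁ two * limitSum v
    dixon-⇝ = ⇝-Null {exact} {dixon} {t₁ two * limitSum v} exact-⇝
      (Null-cong {λ L → ℚ.- (exact L ℚ.- dixon L)} {λ L → dixon L ℚ.- exact L}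
        (λ L → solve 2 (λ a b → :- (a :- b) := b :- a) ≡.refl (exact L) (dixon L)) (Null-neg (∏σ-∑t-Null v)))

  approx-∑ : ∀ {A : Set} (as : List A) (r : A → ℝ) n → approx (∑ as r) n ≡ ℚF.∑ as (λ a → approx (r a) n)
  approx-∑ []       r n = ≡.refl
  approx-∑ (a ∷ as) r n = cong (approx (r a) n ℚ.+_) (approx-∑ as r n)

  approx-∏ : ∀ {A : Set} (as : List A) (r : A → ℝ) n → approx (∏ as r) n ≡ ℚF.∏ as (λ a → approx (r a) n)
  approx-∏ []       r n = ≡.refl
  approx-∏ (a ∷ as) r n = cong (approx (r a) n ℚ.*_) (approx-∏ as r n)

  approx-^ : ∀ r m n → approx (r ^ m) n ≡ approx r n ^ℚ m
  approx-^ r zero    n = ≡.refl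
  approx-^ r (suc m) n = cong (approx r n ℚ.*_) (approx-^ r m n)

  ∏-* : ∀ {A : Set} (as : List A) (f g : A → ℚ) → ℚF.∏ as (λ a → f a ℚ.* g a) ≡ ℚF.∏ as f ℚ.* ℚF.∏ as g
  ∏-* []       f g = ≡.refl
  ∏-* (a ∷ as) f g = ≡.trans (cong (f a ℚ.* g a ℚ.*_) (∏-* as f g))
    (solve 4 (λ f g F G → f :* g :* (F :* G) := f :* F :* (g :* G)) ≡.refl (f a) (g a) (ℚF.∏ as f) (ℚF.∏ as g))

  ∏-cong : ∀ {A : Set} (as : List A) {f g : A → ℚ} → (∀ a → f a ≡ g a) → ℚF.∏ as f ≡ ℚF.∏ as g
  ∏-cong []       f≡g = ≡.refl
  ∏-cong (a ∷ as) f≡g = cong₂ ℚ._*_ (f≡g a) (∏-cong as f≡g)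

  module _ (a′ : ℕ) .{{nz : NonZero (suc a′)}} (v : ℕ) where
    rhsTerm : ℕ × List (Part 1) → ℝ
    rhsTerm (n , ns) = fromℚ (coefficient (suc a′) {{nz}} (suc (suc v)) n ns) * t₁ (2 , ℕ.s≤s (ℕ.s≤s ℕ.z≤n)) * ∏ ns t₁ * log2 ^ n

    rhs : ℝ
    rhs = ∑ (solutions v) rhsTerm

    rhsTerm≡ : ∀ m p → w a′ ^ℚ (2 ℕ.+ v) ℚ.* (approx (t₁ two) m ℚ.* approx (limitTerm p) m) ≡ approx (rhsTerm p) m
    rhsTerm≡ m (n , ns) = begin
      A ℚ.* (τ ℚ.* (F ℚ.* approx (2log2 ^ n) m ℚ.* (G ℚ.* approx (∏ ns limitFactor) m)))
        ≡⟨ cong₂ (λ x y → A ℚ.* (τ ℚ.* (F ℚ.* x ℚ.* (G ℚ.* y))))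
             (≡.trans (approx-^ 2log2 n m) (^-* (ι 2) (approx log2 m) n))
             (≡.trans (approx-∏ ns limitFactor m) (≡.trans (∏-cong ns (λ k → ≡.sym (ℚ.*-assoc (w (proj₁ k ∸ 1)) (ratio k) (approx (t₁ k) m))))
               (∏-* ns (λ k → w (proj₁ k ∸ 1) ℚ.* ratio k) (λ k → approx (t₁ k) m)))) ⟩
      A ℚ.* (τ ℚ.* (F ℚ.* (ι 2 ^ℚ n ℚ.* λⁿ) ℚ.* (G ℚ.* (factors ns ℚ.* T))))
        ≡⟨ solve 8 (λ A τ F p l G f T → A :* (τ :* (F :* (p :* l) :* (G :* (f :* T)))) := A :* (F :* p :* (G :* f)) :* τ :* T :* l) ≡.refl
             A τ F (ι 2 ^ℚ n) λⁿ G (factors ns) T ⟩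
      A ℚ.* (F ℚ.* ι 2 ^ℚ n ℚ.* (G ℚ.* factors ns)) ℚ.* τ ℚ.* T ℚ.* λⁿ
        ≡⟨ cong₂ (λ x y → x ℚ.* τ ℚ.* y ℚ.* λⁿ) (coefficient-value a′ {{nz}} (suc (suc v)) n ns) (approx-∏ ns t₁ m) ⟨
      coefficient (suc a′) {{nz}} (suc (suc v)) n ns ℚ.* τ ℚ.* approx (∏ ns t₁) m ℚ.* λⁿ
        ≡⟨ cong (coefficient (suc a′) {{nz}} (suc (suc v)) n ns ℚ.* τ ℚ.* approx (∏ ns t₁) m ℚ.*_) (approx-^ log2 n m) ⟨
      approx (rhsTerm (n , ns)) m ∎
      where
      open ≡.≡-Reasoning
      A = w a′ ^ℚ (2 ℕ.+ v)
      τ = approx (t₁ two) m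
      F = factorial⁻¹ n
      G = factorial⁻¹ (length ns)
      T = ℚF.∏ ns (λ k → approx (t₁ k) m)
      λⁿ = approx log2 m ^ℚ n

    rhs≡ : ∀ m → w a′ ^ℚ (2 ℕ.+ v) ℚ.* (approx (t₁ two) m ℚ.* approx (limitSum v) m) ≡ approx rhs m
    rhs≡ m = begin
      A ℚ.* (τ ℚ.* approx (limitSum v) m)
        ≡⟨ cong (λ x → A ℚ.* (τ ℚ.* x)) (approx-∑ (solutions v) limitTerm m) ⟩
      A ℚ.* (τ ℚ.* ℚF.∑ (solutions v) (λ p → approx (limitTerm p) m))
        ≡⟨ cong (A ℚ.*_) (∑-*ˡ τ (solutions v) (λ p → approx (limitTerm p) m)) ⟨
      A ℚ.* ℚF.∑ (solutions v) (λ p → τ ℚ.* approx (limitTerm p) m)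
        ≡⟨ ∑-*ˡ A (solutions v) (λ p → τ ℚ.* approx (limitTerm p) m) ⟨
      ℚF.∑ (solutions v) (λ p → A ℚ.* (τ ℚ.* approx (limitTerm p) m))
        ≡⟨ ∑-cong (solutions v) (rhsTerm≡ m) ⟩
      ℚF.∑ (solutions v) (λ p → approx (rhsTerm p) m)
        ≡⟨ approx-∑ (solutions v) rhsTerm m ⟨
      approx rhs m ∎
      where
      open ≡.≡-Reasoning
      A = w a′ ^ℚ (2 ℕ.+ v)
      τ = approx (t₁ two) m

    private
      N = 2 ℕ.* suc a′
      nodes = node N (suc a′)

    -- Blocks of length 2a reduce the nodes to 1/(a m) with m odd. The scaling extracts a⁻ᵏ, and
    -- what remains is the well-poised series.
    state-⇝ : (λ L → proj₂ (state nodes (L ℕ.* N)) v) ⇝ rhs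
    state-⇝ = ⇝-limit-cong {r = fromℚ A * (t₁ two * limitSum v)} {rhs} rhs≡
      (⇝-cong (λ L → ≡.sym (begin
        proj₂ (state nodes (L ℕ.* N)) v                    ≡⟨ proj₂ (state-block a′ L) v ⟩
        proj₂ (state (λ i → c ℚ.* odd i) L) v              ≡⟨ proj₂ (state-scale c odd L) v ⟩
        c ℚ.* c ℚ.* (c ^ℚ v ℚ.* proj₂ (state odd L) v)     ≡⟨ cong (λ x → c ℚ.* c ℚ.* (c ^ℚ v ℚ.* x)) (proj₂ (state-Dixon L) v) ⟩
        c ℚ.* c ℚ.* (c ^ℚ v ℚ.* (inv 0 ⊛ D.∑t 0 L) v)      ≡⟨ solve 3 (λ c k x → c :* c :* (k :* x) := c :* (c :* k) :* x) ≡.refl c (c ^ℚ v) ((inv 0 ⊛ D.∑t 0 L) v) ⟩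
        A ℚ.* (inv 0 ⊛ D.∑t 0 L) v                         ∎))
        (⇝-* {r = fromℚ A} {t₁ two * limitSum v} (⇝-const A) (dixon-⇝ v)))
      where
      open ≡.≡-Reasoning
      c = w a′
      A = c ^ℚ (2 ℕ.+ v)

-- Being a record, it keeps p and r from being unfolded when two such statements are compared
record ConstantPolynomial (p : ℝ[X]) (r : ℝ) : Set where
  field
    ≈const : p ≈ₚ const r
open ConstantPolynomial

toConstant : (a′ : ℕ) .{{nz : NonZero (suc a′)}} (v : ℕ) (p : ℝ[X]) (r : ℝ) →
  (∀ M i → approx (coeff p i) M ≡ C (proj₂ (GeneratingFunction.state (node (2 *ℕ suc a′) (suc a′)) M) v) i) →
  (∀ n → approx (Limit.rhs a′ {{nz}} v) n ≡ approx r n) → ConstantPolynomial p r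
≈const (toConstant a′ {{nz}} v p r p≡ r≡) zero = subsequence-≈ (coeff p 0) r (_*ℕ N) (λ n → ℕ.m≤m*n n N)
  (⇝-limit-cong {r = Limit.rhs a′ {{nz}} v} {r} r≡ (⇝-cong (λ L → ≡.sym (p≡ (L *ℕ N) 0)) (Limit.state-⇝ a′ {{nz}} v)))
  where
  open Convergent
  N = 2 *ℕ suc a′
-- The coefficients of r, r², ... are exactly 0 at every truncation, so any starting index works.
≈const (toConstant a′ v p r p≡ r≡) (suc i) ε 0<ε = 0 , λ n _ → subst (λ x → ℚ.∣ x ℚ.- 0ℚ ∣ ℚ.< ε) (≡.sym (p≡ n (suc i))) 0<ε

rightSide≡ : (a′ : ℕ) .{{nz : NonZero (suc a′)}} (v n : ℕ) → approx (Limit.rhs a′ {{nz}} v) n ≡ approx (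
    ∑ (solutions (suc (suc v) ∸ 2)) (λ (n , ns) →
    fromℚ (coefficient (suc a′) {{nz}} (suc (suc v)) n ns) * t₁ (2 , s≤s (s≤s z≤n)) * ∏ ns t₁ * log2 ^ n)) n
rightSide≡ a′ {{nz}} v n = ≡.trans (Limit.approx-∑ (solutions v) (Limit.rhsTerm a′ {{nz}} v) n)
  (≡.trans (ℚ-Sums.∑-cong (solutions v) (λ _ → ≡.refl)) (≡.sym (Limit.approx-∑ (solutions (suc (suc v) ∸ 2)) _ n)))

leftSide≈rightSide : (a : ℕ) .{{_ : NonZero a}} (k : ℕ) → 2 ≤ k → ConstantPolynomial
    (∑ₚ (applyUpTo suc (k ∸ 1)) (λ n →
    (const (fromℚ 1ℚ) -ₚ const (fromℚ (+ 2 / 1)) *ₚ X) ^ₚ (k ∸ n ∸ 1)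
    *ₚ const (fromℚ (+ 2 / 1)) ^ₚ (n ∸ 1)
    *ₚ ∑ₚ (I₀ k n) (tʳ (2 *ℕ a) a)))
    (∑ (solutions (k ∸ 2)) (λ (n , ns) →
    fromℚ (coefficient a k n ns) * t₁ (2 , s≤s (s≤s z≤n)) * ∏ ns t₁ * log2 ^ n))
leftSide≈rightSide zero {{()}}
leftSide≈rightSide (suc a′) (suc zero) (s≤s ())
leftSide≈rightSide (suc a′) {{nz}} (suc (suc v)) _ = toConstant a′ {{nz}} v _ _
  (λ M → Approximation.φ-sum M (2 *ℕ suc a′) (suc a′) {suc (suc v)} {suc (suc v) ∸ 1} v ≡.refl ≡.refl)
  (rightSide≡ a′ {{nz}} v)

corollary3p4 : (a : ℕ) .{{_ : NonZero a}} (k : ℕ) → 2 ≤ k →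
    ∑ₚ (applyUpTo suc (k ∸ 1)) (λ n →
    (const (fromℚ 1ℚ) -ₚ const (fromℚ (+ 2 / 1)) *ₚ X) ^ₚ (k ∸ n ∸ 1)
    *ₚ const (fromℚ (+ 2 / 1)) ^ₚ (n ∸ 1)
    *ₚ ∑ₚ (I₀ k n) (tʳ (2 *ℕ a) a))
    ≈ₚ
    const (∑ (solutions (k ∸ 2)) (λ (n , ns) →
    fromℚ (coefficient a k n ns) * t₁ (2 , s≤s (s≤s z≤n)) * ∏ ns t₁ * log2 ^ n))
corollary3p4 a {{nz}} k 2≤k = ≈const (leftSide≈rightSide a {{nz}} k 2≤k)
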